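{- There exist an absolute constant $C>0$ and a single online algorithm, which is not given $\mu_1,\mu_2$ or $\varepsilon$ as input, such that for all $\mu_1,\mu_2\ge 1$ and $\varepsilon\in(0,1]$ and every instance of the $(\varepsilon,\mu_1,\mu_2)$-online estimate model on a single machine, the schedule produced by the algorithm has total flow time at most $C\cdot\frac{\mu_1\mu_2}{\varepsilon}\cdot\mathrm{OPT}$, where $\mathrm{OPT}$ is the minimum total flow time of any feasible offline schedule for the instance.
   Context: Scheduling problem: a finite set of jobs is given; job $j$ has a release time $r_j\in\mathbb Z_{\ge 0}$ and a processing time $p_j\in\mathbb Z_{\ge 1}$. A feasible schedule on a single machine processes, during each unit interval $[t,t+1]$, $t\in\mathbb Z_{\ge0}$, at most one job $j$, which must satisfy $r_j\le t$ and be unfinished; preemption is allowed. The elapsed time $e_j(t)$ is the number of unit intervals before time $t$ in which $j$ was processed; $p_j(t)=p_j-e_j(t)$; the completion time is $C_j=\min\{t: p_j(t)=0\}$, the flow time is $F_j=C_j-r_j$, and the total flow time is $\sum_j F_j$. $(\varepsilon,\mu_1,\mu_2)$-online estimate model: for each job $j$ the adversary chooses, besides $r_j$ and $p_j$, (i) an estimate $\hat p_j\in\mathbb Z_{\ge1}$ with $p_j/\mu_2\le\hat p_j\le\mu_1p_j$, and (ii) an online estimate threshold $q_j\in\mathbb Z_{\ge0}$ with $q_j\le(1-\varepsilon)p_j$. The online algorithm learns of the existence of job $j$ at time $r_j$ (and of no other parameter of $j$); at the first time when it has processed $j$ for $q_j$ units, it is told $\hat p_j$; and it is informed when $j$ completes.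 No other information is revealed, and decisions at time $t$ may depend only on information revealed up to time $t$. -}

module Defs where

open import Algebra.Bundles using (CommutativeMonoid)
import Algebra.Properties.CommutativeSemigroup as CommutativeSemigroup
open import Data.Bool using (Bool; if_then_else_)
open import Data.Fin using (Fin)
import Data.Fin.Properties as Fin
import Data.Integer as ℤ
open import Data.List using (List; []; _∷_; allFin; applyDownFrom; filter; length; map)
open import Data.Nat.ListAction using (sum)
open import Data.Maybe as Maybe using (Maybe; just; nothing; _>>=_)
import Data.Maybe.Properties as Maybe
open import Data.Nat as ℕ using (ℕ; zero; suc)
import Data.Nat.Properties as ℕ
open import Data.Product using (Σ-syntax; ∃-syntax; _×_; _,_; proj₁; proj₂)
open import Data.Rational as ℚ using (ℚ; 0ℚ; 1ℚ; ½; 1/_; ∣_∣)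
import Data.Rational.Properties as ℚ
open import Function using (Injective)
open import Relation.Binary using (DecidableEquality)
open import Relation.Binary.PropositionalEquality using (_≡_; refl; sym; trans; cong; cong₂; subst; module ≡-Reasoning)
open import Relation.Nullary using (does; dec⇒maybe)

-- Real numbers: Cauchy sequences of rationals.  Two sequences represent
-- the same number iff each is ≤ᴿ the other; no quotient is taken, and the
-- operations and relations below respect this equivalence.

IsCauchy : (ℕ → ℚ) → Set
IsCauchy x = ∀ δ → 0ℚ ℚ.< δ →
  ∃[ N ] (∀ m n → N ℕ.≤ m → N ℕ.≤ n → ∣ x m ℚ.- x n ∣ ℚ.≤ δ)

record ℝ : Set where
  constructor mkℝ
  field
    seq      : ℕ → ℚ
    isCauchy : IsCauchy seq

open ℝ public

infix  4 _≤ᴿ_ _<ᴿ_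
infixl 6 _-ᴿ_
infixl 7 _*ᴿ_

_≤ᴿ_ : ℝ → ℝ → Set
x ≤ᴿ y = ∀ δ → 0ℚ ℚ.< δ →
  ∃[ N ] (∀ n → N ℕ.≤ n → seq x n ℚ.≤ seq y n ℚ.+ δ)

_<ᴿ_ : ℝ → ℝ → Set
x <ᴿ y = ∃[ δ ] 0ℚ ℚ.< δ ×
  (∃[ N ] (∀ n → N ℕ.≤ n → seq x n ℚ.+ δ ℚ.≤ seq y n))

fromℚ : ℚ → ℝ
fromℚ p = mkℝ (λ _ → p) λ δ 0<δ → 0 , λ _ _ _ _ →
  subst (λ z → ∣ z ∣ ℚ.≤ δ) (sym (ℚ.+-inverseʳ p)) (ℚ.<⇒≤ 0<δ)

fromℕ : ℕ → ℝ
fromℕ k = fromℚ (ℤ.+ k ℚ./ 1)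

0ᴿ 1ᴿ : ℝ
0ᴿ = fromℚ 0ℚ
1ᴿ = fromℚ 1ℚ

private
  0<½* : ∀ {δ} → 0ℚ ℚ.< δ → 0ℚ ℚ.< ½ ℚ.* δ
  0<½* {δ} 0<δ = subst (ℚ._< ½ ℚ.* δ) (ℚ.*-zeroʳ ½) (ℚ.*-monoʳ-<-pos ½ 0<δ)

  ½+½ : ∀ δ → ½ ℚ.* δ ℚ.+ ½ ℚ.* δ ≡ δ
  ½+½ δ = trans (sym (ℚ.*-distribʳ-+ δ ½ ½)) (ℚ.*-identityˡ δ)

  regroup- : ∀ a b c d → (a ℚ.- b) ℚ.- (c ℚ.- d) ≡ (a ℚ.- c) ℚ.- (b ℚ.- d)
  regroup- a b c d = begin
    (a ℚ.- b) ℚ.- (c ℚ.- d)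
      ≡⟨ cong ((a ℚ.- b) ℚ.+_) (ℚ.neg-distrib-+ c (ℚ.- d)) ⟩
    (a ℚ.- b) ℚ.+ (ℚ.- c ℚ.- ℚ.- d)
      ≡⟨ interchange a (ℚ.- b) (ℚ.- c) (ℚ.- ℚ.- d) ⟩
    (a ℚ.- c) ℚ.+ (ℚ.- b ℚ.- ℚ.- d)
      ≡⟨ cong ((a ℚ.- c) ℚ.+_) (sym (ℚ.neg-distrib-+ b (ℚ.- d))) ⟩
    (a ℚ.- c) ℚ.- (b ℚ.- d) ∎
    where
    open ≡-Reasoning
    open CommutativeSemigroup
      (CommutativeMonoid.commutativeSemigroup ℚ.+-0-commutativeMonoid) using (interchange)

  telescope : ∀ a b c → a ℚ.- c ≡ (a ℚ.- b) ℚ.+ (b ℚ.- c)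
  telescope a b c = sym (begin
    (a ℚ.- b) ℚ.+ (b ℚ.- c)         ≡⟨ ℚ.+-assoc a (ℚ.- b) (b ℚ.- c) ⟩
    a ℚ.+ (ℚ.- b ℚ.+ (b ℚ.- c))     ≡⟨ cong (a ℚ.+_) (sym (ℚ.+-assoc (ℚ.- b) b (ℚ.- c))) ⟩
    a ℚ.+ ((ℚ.- b ℚ.+ b) ℚ.- c)     ≡⟨ cong (λ z → a ℚ.+ (z ℚ.- c)) (ℚ.+-inverseˡ b) ⟩
    a ℚ.+ (0ℚ ℚ.- c)                ≡⟨ cong (a ℚ.+_) (ℚ.+-identityˡ (ℚ.- c)) ⟩
    a ℚ.- c                         ∎)
    where open ≡-Reasoning

  regroup* : ∀ a b c d → a ℚ.* b ℚ.- c ℚ.* d ≡ a ℚ.* (b ℚ.- d) ℚ.+ (a ℚ.- c) ℚ.* d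
  regroup* a b c d = trans (telescope (a ℚ.* b) (a ℚ.* d) (c ℚ.* d)) (sym (cong₂ ℚ._+_
    (trans (ℚ.*-distribˡ-+ a b (ℚ.- d))
           (cong (a ℚ.* b ℚ.+_) (sym (ℚ.neg-distribʳ-* a d))))
    (trans (ℚ.*-distribʳ-+ d a (ℚ.- c))
           (cong (a ℚ.* d ℚ.+_) (sym (ℚ.neg-distribˡ-* c d))))))

  cancel- : ∀ a b → a ≡ (a ℚ.- b) ℚ.+ b
  cancel- a b = sym (trans (ℚ.+-assoc a (ℚ.- b) b)
    (trans (cong (a ℚ.+_) (ℚ.+-inverseˡ b)) (ℚ.+-identityʳ a)))

  0<1ℚ : 0ℚ ℚ.< 1ℚ
  0<1ℚ = ℚ.positive⁻¹ 1ℚ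

  bounded : ∀ {x} → IsCauchy x →
    ∃[ B ] 0ℚ ℚ.≤ B × (∃[ N ] (∀ n → N ℕ.≤ n → ∣ x n ∣ ℚ.≤ B))
  bounded {x} cx with cx 1ℚ 0<1ℚ
  ... | N , close = 1ℚ ℚ.+ ∣ x N ∣
    , ℚ.+-mono-≤ (ℚ.<⇒≤ 0<1ℚ) (ℚ.0≤∣p∣ (x N))
    , N , λ n N≤n → begin
      ∣ x n ∣                          ≡⟨ cong ∣_∣ (cancel- (x n) (x N)) ⟩
      ∣ (x n ℚ.- x N) ℚ.+ x N ∣        ≤⟨ ℚ.∣p+q∣≤∣p∣+∣q∣ (x n ℚ.- x N) (x N) ⟩
      ∣ x n ℚ.- x N ∣ ℚ.+ ∣ x N ∣      ≤⟨ ℚ.+-monoˡ-≤ ∣ x N ∣ (close n N N≤n ℕ.≤-refl) ⟩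
      1ℚ ℚ.+ ∣ x N ∣                   ∎
    where open ℚ.≤-Reasoning

  mul-≤ : ∀ {a b A B} → ∣ a ∣ ℚ.≤ A → 0ℚ ℚ.≤ A → ∣ b ∣ ℚ.≤ B → ∣ a ℚ.* b ∣ ℚ.≤ A ℚ.* B
  mul-≤ {a} {b} {A} {B} a≤A 0≤A b≤B = begin
    ∣ a ℚ.* b ∣       ≡⟨ ℚ.∣p*q∣≡∣p∣*∣q∣ a b ⟩
    ∣ a ∣ ℚ.* ∣ b ∣   ≤⟨ ℚ.*-monoʳ-≤-nonNeg ∣ b ∣ {{ℚ.nonNegative (ℚ.0≤∣p∣ b)}} a≤A ⟩
    A ℚ.* ∣ b ∣       ≤⟨ ℚ.*-monoˡ-≤-nonNeg A {{ℚ.nonNegative 0≤A}} b≤B ⟩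
    A ℚ.* B           ∎
    where open ℚ.≤-Reasoning

  shrink : ∀ {A δ} → 0ℚ ℚ.≤ A → 0ℚ ℚ.< δ → ∃[ η ] 0ℚ ℚ.< η × A ℚ.* η ℚ.≤ ½ ℚ.* δ
  shrink {A} {δ} 0≤A 0<δ = η , 0<η , (begin
      A ℚ.* η                  ≤⟨ ℚ.*-monoʳ-≤-nonNeg η {{ℚ.nonNegative (ℚ.<⇒≤ 0<η)}} A≤K ⟩
      K ℚ.* (r ℚ.* h)          ≡⟨ sym (ℚ.*-assoc K r h) ⟩
      (K ℚ.* r) ℚ.* h          ≡⟨ cong (ℚ._* h) (ℚ.*-inverseʳ K {{nz}}) ⟩
      1ℚ ℚ.* h                 ≡⟨ ℚ.*-identityˡ h ⟩
      h                        ∎)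
    where
    open ℚ.≤-Reasoning
    K = A ℚ.+ 1ℚ
    h = ½ ℚ.* δ
    pos : ℚ.Positive K
    pos = ℚ.positive (ℚ.+-mono-≤-< 0≤A 0<1ℚ)
    nz : ℚ.NonZero K
    nz = ℚ.pos⇒nonZero K {{pos}}
    r = (1/ K) {{nz}}
    η = r ℚ.* h
    0<η : 0ℚ ℚ.< η
    0<η = subst (ℚ._< η) (ℚ.*-zeroʳ r)
      (ℚ.*-monoʳ-<-pos r {{ℚ.1/pos⇒pos K {{pos}}}} (0<½* 0<δ))
    A≤K : A ℚ.≤ K
    A≤K = subst (ℚ._≤ K) (ℚ.+-identityʳ A) (ℚ.+-monoʳ-≤ A (ℚ.<⇒≤ 0<1ℚ))

  minus-cauchy : ∀ (x y : ℕ → ℚ) → IsCauchy x → IsCauchy y → IsCauchy (λ n → x n ℚ.- y n)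
  minus-cauchy x y cx cy δ 0<δ = M ℕ.⊔ N , λ m n m≥ n≥ → begin
    ∣ (x m ℚ.- y m) ℚ.- (x n ℚ.- y n) ∣
      ≡⟨ cong ∣_∣ (regroup- (x m) (y m) (x n) (y n)) ⟩
    ∣ (x m ℚ.- x n) ℚ.- (y m ℚ.- y n) ∣
      ≤⟨ ℚ.∣p-q∣≤∣p∣+∣q∣ (x m ℚ.- x n) (y m ℚ.- y n) ⟩
    ∣ x m ℚ.- x n ∣ ℚ.+ ∣ y m ℚ.- y n ∣
      ≤⟨ ℚ.+-mono-≤ (proj₂ cx′ m n (ℕ.m⊔n≤o⇒m≤o M N m≥) (ℕ.m⊔n≤o⇒m≤o M N n≥))
                    (proj₂ cy′ m n (ℕ.m⊔n≤o⇒n≤o M N m≥) (ℕ.m⊔n≤o⇒n≤o M N n≥)) ⟩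
    ½ ℚ.* δ ℚ.+ ½ ℚ.* δ
      ≡⟨ ½+½ δ ⟩
    δ ∎
    where
    open ℚ.≤-Reasoning
    cx′ = cx (½ ℚ.* δ) (0<½* 0<δ)
    cy′ = cy (½ ℚ.* δ) (0<½* 0<δ)
    M = proj₁ cx′
    N = proj₁ cy′

  *-diff : ∀ a b c d {A B η θ δ} → 0ℚ ℚ.≤ A → 0ℚ ℚ.≤ θ →
    ∣ a ∣ ℚ.≤ A → ∣ b ℚ.- d ∣ ℚ.≤ η → ∣ a ℚ.- c ∣ ℚ.≤ θ → ∣ d ∣ ℚ.≤ B →
    A ℚ.* η ℚ.≤ ½ ℚ.* δ → B ℚ.* θ ℚ.≤ ½ ℚ.* δ → ∣ a ℚ.* b ℚ.- c ℚ.* d ∣ ℚ.≤ δ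
  *-diff a b c d {A} {B} {η} {θ} {δ} 0≤A 0≤θ a≤A b-d≤η a-c≤θ d≤B Aη≤ Bθ≤ = begin
    ∣ a ℚ.* b ℚ.- c ℚ.* d ∣
      ≡⟨ cong ∣_∣ (regroup* a b c d) ⟩
    ∣ a ℚ.* (b ℚ.- d) ℚ.+ (a ℚ.- c) ℚ.* d ∣
      ≤⟨ ℚ.∣p+q∣≤∣p∣+∣q∣ (a ℚ.* (b ℚ.- d)) ((a ℚ.- c) ℚ.* d) ⟩
    ∣ a ℚ.* (b ℚ.- d) ∣ ℚ.+ ∣ (a ℚ.- c) ℚ.* d ∣
      ≤⟨ ℚ.+-mono-≤ (mul-≤ {a} {b ℚ.- d} {A} {η} a≤A 0≤A b-d≤η)
                    (mul-≤ {a ℚ.- c} {d} {θ} {B} a-c≤θ 0≤θ d≤B) ⟩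
    A ℚ.* η ℚ.+ θ ℚ.* B
      ≡⟨ cong (A ℚ.* η ℚ.+_) (ℚ.*-comm θ B) ⟩
    A ℚ.* η ℚ.+ B ℚ.* θ
      ≤⟨ ℚ.+-mono-≤ Aη≤ Bθ≤ ⟩
    ½ ℚ.* δ ℚ.+ ½ ℚ.* δ
      ≡⟨ ½+½ δ ⟩
    δ ∎
    where open ℚ.≤-Reasoning

  *-cauchy′ : ∀ (x y : ℕ → ℚ) {A B} → 0ℚ ℚ.≤ A → 0ℚ ℚ.≤ B → ∀ {K L} →
    (∀ n → K ℕ.≤ n → ∣ x n ∣ ℚ.≤ A) → (∀ n → L ℕ.≤ n → ∣ y n ∣ ℚ.≤ B) →
    ∀ {δ η θ} → 0ℚ ℚ.< θ → A ℚ.* η ℚ.≤ ½ ℚ.* δ → B ℚ.* θ ℚ.≤ ½ ℚ.* δ →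
    ∃[ M ] (∀ m n → M ℕ.≤ m → M ℕ.≤ n → ∣ x m ℚ.- x n ∣ ℚ.≤ θ) →
    ∃[ N ] (∀ m n → N ℕ.≤ m → N ℕ.≤ n → ∣ y m ℚ.- y n ∣ ℚ.≤ η) →
    ∃[ N ] (∀ m n → N ℕ.≤ m → N ℕ.≤ n → ∣ x m ℚ.* y m ℚ.- x n ℚ.* y n ∣ ℚ.≤ δ)
  *-cauchy′ x y {A} {B} 0≤A 0≤B {K} {L} x≤A y≤B {δ} {η} {θ} 0<θ Aη≤ Bθ≤ (M , p) (N , q) =
    (K ℕ.⊔ L) ℕ.⊔ (M ℕ.⊔ N) , λ m n m≥ n≥ →
    let m≥M⊔N = ℕ.m⊔n≤o⇒n≤o (K ℕ.⊔ L) (M ℕ.⊔ N) m≥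
        n≥M⊔N = ℕ.m⊔n≤o⇒n≤o (K ℕ.⊔ L) (M ℕ.⊔ N) n≥
        m≥K   = ℕ.m⊔n≤o⇒m≤o K L (ℕ.m⊔n≤o⇒m≤o (K ℕ.⊔ L) (M ℕ.⊔ N) m≥)
        n≥L   = ℕ.m⊔n≤o⇒n≤o K L (ℕ.m⊔n≤o⇒m≤o (K ℕ.⊔ L) (M ℕ.⊔ N) n≥)
    in *-diff (x m) (y m) (x n) (y n) {A} {B} {η} {θ} {δ} 0≤A (ℚ.<⇒≤ 0<θ)
      (x≤A m m≥K)
      (q m n (ℕ.m⊔n≤o⇒n≤o M N m≥M⊔N) (ℕ.m⊔n≤o⇒n≤o M N n≥M⊔N))
      (p m n (ℕ.m⊔n≤o⇒m≤o M N m≥M⊔N) (ℕ.m⊔n≤o⇒m≤o M N n≥M⊔N))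
      (y≤B n n≥L) Aη≤ Bθ≤

  *-cauchy : ∀ (x y : ℕ → ℚ) → IsCauchy x → IsCauchy y → IsCauchy (λ n → x n ℚ.* y n)
  *-cauchy x y cx cy δ 0<δ =
    let A , 0≤A , K , x≤A = bounded {x} cx
        B , 0≤B , L , y≤B = bounded {y} cy
        η , 0<η , Aη≤     = shrink {A} {δ} 0≤A 0<δ
        θ , 0<θ , Bθ≤     = shrink {B} {δ} 0≤B 0<δ
    in *-cauchy′ x y {A} {B} 0≤A 0≤B {K} {L} x≤A y≤B {δ} {η} {θ} 0<θ Aη≤ Bθ≤ (cx θ 0<θ) (cy η 0<η)

_-ᴿ_ : ℝ → ℝ → ℝ
x -ᴿ y = mkℝ (λ n → seq x n ℚ.- seq y n) (minus-cauchy (seq x) (seq y) (isCauchy x) (isCauchy y))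

_*ᴿ_ : ℝ → ℝ → ℝ
x *ᴿ y = mkℝ (λ n → seq x n ℚ.* seq y n) (*-cauchy (seq x) (seq y) (isCauchy x) (isCauchy y))

-- Labels are the names under which the online algorithm refers to jobs.
-- They are arbitrary distinct numbers: with the indices j : Fin n as
-- names, seeing job j would reveal that at least toℕ j further jobs exist.
record Instance : Set where
  field
    n               : ℕ
    label           : Fin n → ℕ
    label-injective : Injective _≡_ _≡_ label
    release         : Fin n → ℕ
    proc            : Fin n → ℕ
    proc≥1          : ∀ j → 1 ℕ.≤ proc j
    estimate        : Fin n → ℕ
    estimate≥1      : ∀ j → 1 ℕ.≤ estimate j
    threshold       : Fin n → ℕ

  Job : Set
  Job = Fin n

  -- For one unit interval; nothing means idling.
  Decision : Set
  Decision = Maybe Job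

  _≟ᴰ_ : DecidableEquality Decision
  _≟ᴰ_ = Maybe.≡-dec Fin._≟_

  Schedule : Set
  Schedule = ℕ → Decision

  timesIn : List Decision → Job → ℕ
  timesIn ds j = length (filter (just j ≟ᴰ_) ds)

  elapsed : Schedule → Job → ℕ → ℕ
  elapsed S j t = timesIn (applyDownFrom S t) j

  remaining : Schedule → Job → ℕ → ℕ
  remaining S j t = proc j ℕ.∸ elapsed S j t

  Feasible : Schedule → Set
  Feasible S = ∀ t j → S t ≡ just j → release j ℕ.≤ t × 0 ℕ.< remaining S j t

  IsCompletionTime : Schedule → Job → ℕ → Set
  IsCompletionTime S j c =
    remaining S j c ≡ 0 × (∀ t → remaining S j t ≡ 0 → c ℕ.≤ t)

  -- A relation, since a schedule need not complete every job; one that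
  -- does not has no (finite) total flow time.
  HasTotalFlow : Schedule → ℕ → Set
  HasTotalFlow S F = Σ[ C ∈ (Job → ℕ) ] (∀ j → IsCompletionTime S j (C j)) ×
    F ≡ sum (map (λ j → C j ℕ.∸ release j) (allFin n))

  IsOPT : ℕ → Set
  IsOPT v = (∃[ S ] Feasible S × HasTotalFlow S v) ×
    (∀ S F → Feasible S → HasTotalFlow S F → v ℕ.≤ F)

-- The bounds p/μ₂ ≤ p̂ ≤ μ₁p and q ≤ (1-ε)p.  The first one is multiplied
-- out, as InModel is meant for μ₂ ≥ 1 only.
InModel : (ε μ₁ μ₂ : ℝ) → Instance → Set
InModel ε μ₁ μ₂ I = ∀ j →
    (fromℕ (proc j) ≤ᴿ μ₂ *ᴿ fromℕ (estimate j))
  × (fromℕ (estimate j) ≤ᴿ μ₁ *ᴿ fromℕ (proc j))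
  × (fromℕ (threshold j) ≤ᴿ (1ᴿ -ᴿ ε) *ᴿ fromℕ (proc j))
  where open Instance I

-- What is revealed at some time about a job released by then; snapshots
-- have one entry per released job, completed ones included.
record JobView : Set where
  field
    name      : ℕ
    processed : ℕ
    hint      : Maybe ℕ
    completed : Bool

Snapshot : Set
Snapshot = List JobView

-- A deterministic algorithm maps the snapshots at times t, t-1, …, 0 (in
-- this order) to the label of the job to process during [t,t+1], if any.
-- Release times, the times of hints and completions, and (via processed)
-- past decisions can be read off from these snapshots.
OnlineAlgorithm : Set
OnlineAlgorithm = List Snapshot → Maybe ℕ

module _ (I : Instance) where
  open Instance I

  -- In the following, past decisions are listed latest first, so that the
  -- current time is the length of the list.

  view : List Decision → Job → JobView
  view past j = record
    { name      = label j
    ; processed = timesIn past j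
    ; hint      = if does (threshold j ℕ.≤? timesIn past j)
                  then just (estimate j) else nothing
    ; completed = does (proc j ℕ.≤? timesIn past j)
    }

  snapshot : List Decision → Snapshot
  snapshot past =
    map (view past) (filter (λ j → release j ℕ.≤? length past) (allFin n))

  history : List Decision → List Snapshot
  history []         = snapshot [] ∷ []
  history (d ∷ past) = snapshot (d ∷ past) ∷ history past

  -- A label that no job carries results in idling.
  jobLabelled : ℕ → Decision
  jobLabelled ℓ = Maybe.map proj₁ (dec⇒maybe (Fin.any? (λ j → label j ℕ.≟ ℓ)))

  module _ (A : OnlineAlgorithm) where

    run       : Schedule
    decisions : ℕ → List Decision

    run t = A (history (decisions t)) >>= jobLabelled

    decisions zero    = []
    decisions (suc t) = run t ∷ decisions t

{-# OPTIONS --safe #-}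

-- A job has a level: the logarithm of the work done on it until its estimate
-- p̂ is known, and from then on the logarithm of the larger of p̂ and the work
-- done when p̂ was revealed.  Right after such a change of information the job
-- still needs at least ε/(2μ₁)·2^level units, and until the next one the work
-- done on it stays at most μ₂·2^level.  The jobs processed since their last
-- change form a stack whose levels decrease strictly towards its top.  A base
-- (see Kind) is put on the stack only if some job outside the stack has a level
-- between it and the previous base, so that at least about a third of the
-- unfinished jobs are outside the stack and have much work left.
--
-- Compare with another schedule at a fixed time.  Suppose that since time s only
-- jobs released from s on have been processed, at levels up to k.  As no time
-- was wasted, the work remaining on those of them that the other schedule has
-- finished is at most the work spent on those it has not finished.  Such a cut s
-- exists at every base, and for every level k if up to two exceptional jobs are
-- allowed, which depend only on the interval between two bases that contains k.
-- Exceptions are needed only where that interval contains the last level of a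
-- job that the other schedule has not finished, and are charged to this job.  A
-- job last processed at level K pays 2^(K - k) at level k, so the number of
-- unfinished jobs is always O(μ₁μ₂/ε) times the number in the other schedule.

module Submission where

open import Data.Bool using (Bool; true; false; not; _∧_; T; if_then_else_)
open import Data.Bool.ListAction using (any)
open import Data.Bool.Properties using (T-∧)
open import Data.Empty using (⊥; ⊥-elim)
open import Data.Fin using (Fin)
import Data.Fin.Properties as Fin
import Data.Integer as ℤ
import Data.Integer.Properties as ℤ
open import Data.List
  using (List; []; _∷_; _++_; map; length; allFin; filter; filterᵇ; concatMap; tabulate; applyDownFrom; downFrom)
open import Data.List.Membership.DecPropositional using (_∈?_)
open import Data.List.Membership.Propositional using (_∈_; _∉_)
open import Data.List.Membership.Propositional.Properties
  using (∈-allFin; ∈-filter⁺; ∈-filter⁻; ∈-map⁺; ∈-map⁻; ∈-concatMap⁺)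
open import Data.List.Properties using (length-map; map-tabulate; map-∘; map-cong; map-id)
open import Data.List.Relation.Unary.All as All using (All; []; _∷_)
open import Data.List.Relation.Unary.AllPairs using (AllPairs; []; _∷_)
open import Data.List.Relation.Unary.Any as Any using (here; there)
open import Data.List.Relation.Unary.Any.Properties using (any⁺; any⁻)
open import Data.List.Relation.Unary.Unique.Propositional using (Unique)
import Data.List.Relation.Unary.Unique.Propositional.Properties as Unique
open import Data.Maybe using (Maybe; just; nothing; _>>=_)
import Data.Maybe.Properties as Maybe
open import Data.Nat
open import Data.Nat.ListAction using (sum)
open import Data.Nat.Properties
open import Data.Nat.Tactic.RingSolver using (solve-∀)
open import Data.Product using (_×_; _,_; proj₁; proj₂; ∃-syntax; map₂)
open import Data.Rational as ℚ using (ℚ; 0ℚ; 1ℚ; ½)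
import Data.Rational.Properties as ℚ
import Data.Rational.Solver as ℚSolver
import Data.Rational.Unnormalised as ℚᵘ
import Data.Rational.Unnormalised.Properties as ℚᵘ
open import Data.Sum using (_⊎_; inj₁; inj₂)
open import Data.Unit using (⊤; tt)
open import Function using (_∘_; case_of_)
open import Function.Bundles using (Equivalence)
open import Relation.Binary.PropositionalEquality
open import Relation.Nullary using (Dec; yes; no; ¬_; ¬?; _×-dec_; does)
open import Relation.Nullary.Decidable using (dec-true; dec-false)
open import Defs

-- Finite sums and the charging argument

private
  variable
    A : Set

∑ : List A → (A → ℕ) → ℕ
∑ xs f = sum (map f xs)

infix 7 _⊳_
-- The Iverson bracket of `P` times `v`. It takes the decision itself, so that counts and restricted
-- sums share one set of lemmas.
_⊳_ : {P : Set} → Dec P → ℕ → ℕ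
yes _ ⊳ v = v
no  _ ⊳ v = 0

⊳-yes : {P : Set} (P? : Dec P) → P → ∀ v → P? ⊳ v ≡ v
⊳-yes (yes _) _ v = refl
⊳-yes (no ¬p) p v = ⊥-elim (¬p p)

⊳-no : {P : Set} (P? : Dec P) → ¬ P → ∀ v → P? ⊳ v ≡ 0
⊳-no (yes p) ¬p v = ⊥-elim (¬p p)
⊳-no (no _)  _  v = refl

⊳-≤ : {P : Set} (P? : Dec P) → ∀ v → P? ⊳ v ≤ v
⊳-≤ (yes _) v = ≤-refl
⊳-≤ (no _)  v = z≤n

⊳-mono : {P Q : Set} (P? : Dec P) (Q? : Dec Q) → ∀ {u v} →
  (P → u ≤ v) → (P → ¬ Q → u ≡ 0) → P? ⊳ u ≤ Q? ⊳ v
⊳-mono (yes p) (yes _) h _ = h p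
⊳-mono (yes p) (no ¬q) _ h = ≤-reflexive (h p ¬q)
⊳-mono (no _)  _       _ _ = z≤n

⊳-mono-→ : {P Q : Set} (P? : Dec P) (Q? : Dec Q) → ∀ {u v} →
  (P → Q) → u ≤ v → P? ⊳ u ≤ Q? ⊳ v
⊳-mono-→ P? Q? P→Q u≤v = ⊳-mono P? Q? (λ _ → u≤v) (λ p ¬q → ⊥-elim (¬q (P→Q p)))

⊳-⊎ : {P Q R : Set} (P? : Dec P) (Q? : Dec Q) (R? : Dec R) → (P → Q ⊎ R) → ∀ v →
  P? ⊳ v ≤ Q? ⊳ v + R? ⊳ v
⊳-⊎ (no _)  _       _       _ v = z≤n
⊳-⊎ (yes _) (yes _) R?      _ v = m≤m+n v _
⊳-⊎ (yes _) (no _)  (yes _) _ v = ≤-refl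
⊳-⊎ (yes p) (no ¬q) (no ¬r) f v with f p
... | inj₁ q = ⊥-elim (¬q q)
... | inj₂ r = ⊥-elim (¬r r)

∑-mono∈ : ∀ (xs : List A) {f g : A → ℕ} → (∀ x → x ∈ xs → f x ≤ g x) → ∑ xs f ≤ ∑ xs g
∑-mono∈ []       h = z≤n
∑-mono∈ (x ∷ xs) h = +-mono-≤ (h x (here refl)) (∑-mono∈ xs (λ y y∈ → h y (there y∈)))

∑-mono : ∀ (xs : List A) {f g : A → ℕ} → (∀ x → f x ≤ g x) → ∑ xs f ≤ ∑ xs g
∑-mono xs h = ∑-mono∈ xs (λ x _ → h x)

∑-strict : ∀ (xs : List A) {f g : A → ℕ} → (∀ x → f x ≤ g x) →
  ∀ {x} → x ∈ xs → f x < g x → ∑ xs f < ∑ xs g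
∑-strict (x ∷ xs) h (here refl) fx<gx = +-mono-<-≤ fx<gx (∑-mono xs h)
∑-strict (y ∷ xs) h (there x∈)  fx<gx = +-mono-≤-< (h y) (∑-strict xs h x∈ fx<gx)

∑-cong : ∀ (xs : List A) {f g : A → ℕ} → (∀ x → f x ≡ g x) → ∑ xs f ≡ ∑ xs g
∑-cong []       h = refl
∑-cong (x ∷ xs) h = cong₂ _+_ (h x) (∑-cong xs h)

interchange : ∀ a b c d → (a + b) + (c + d) ≡ (a + c) + (b + d)
interchange = solve-∀

∑-+ : ∀ (xs : List A) (f g : A → ℕ) → ∑ xs (λ x → f x + g x) ≡ ∑ xs f + ∑ xs g
∑-+ []       f g = refl
∑-+ (x ∷ xs) f g = trans (cong (f x + g x +_) (∑-+ xs f g)) (interchange (f x) (g x) _ _)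

∑-*ˡ : ∀ (xs : List A) c (f : A → ℕ) → ∑ xs (λ x → c * f x) ≡ c * ∑ xs f
∑-*ˡ []       c f = sym (*-zeroʳ c)
∑-*ˡ (x ∷ xs) c f = trans (cong (c * f x +_) (∑-*ˡ xs c f)) (sym (*-distribˡ-+ c (f x) _))

∑-0 : ∀ (xs : List A) → ∑ xs (λ _ → 0) ≡ 0
∑-0 []       = refl
∑-0 (x ∷ xs) = ∑-0 xs

∑-1 : ∀ (xs : List A) → ∑ xs (λ _ → 1) ≡ length xs
∑-1 []       = refl
∑-1 (x ∷ xs) = cong suc (∑-1 xs)

∑-swap : ∀ {B : Set} (xs : List A) (ys : List B) (f : A → B → ℕ) →
  ∑ xs (λ x → ∑ ys (f x)) ≡ ∑ ys (λ y → ∑ xs (λ x → f x y))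
∑-swap []       ys f = sym (∑-0 ys)
∑-swap (x ∷ xs) ys f =
  trans (cong (∑ ys (f x) +_) (∑-swap xs ys f)) (sym (∑-+ ys (f x) _))

∑-++ : ∀ (xs ys : List A) (f : A → ℕ) → ∑ (xs ++ ys) f ≡ ∑ xs f + ∑ ys f
∑-++ []       ys f = refl
∑-++ (x ∷ xs) ys f = trans (cong (f x +_) (∑-++ xs ys f)) (sym (+-assoc (f x) _ _))

∑-concatMap : ∀ {B : Set} (h : A → List B) (xs : List A) (f : B → ℕ) →
  ∑ (concatMap h xs) f ≡ ∑ xs (λ x → ∑ (h x) f)
∑-concatMap h []       f = refl
∑-concatMap h (x ∷ xs) f =
  trans (∑-++ (h x) (concatMap h xs) f) (cong (∑ (h x) f +_) (∑-concatMap h xs f))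

∑-map : ∀ {B : Set} (h : A → B) (xs : List A) (f : B → ℕ) → ∑ (map h xs) f ≡ ∑ xs (f ∘ h)
∑-map h []       f = refl
∑-map h (x ∷ xs) f = cong (f (h x) +_) (∑-map h xs f)

∑-member : ∀ (xs : List A) (f : A → ℕ) {x} → x ∈ xs → f x ≤ ∑ xs f
∑-member (x ∷ xs) f (here refl) = m≤m+n (f x) _
∑-member (y ∷ xs) f (there x∈)  = ≤-trans (∑-member xs f x∈) (m≤n+m _ (f y))

∑-filter : ∀ {P : A → Set} (P? : ∀ x → Dec (P x)) (xs : List A) (f : A → ℕ) →
  ∑ (filter P? xs) f ≡ ∑ xs (λ x → P? x ⊳ f x)
∑-filter P? []       f = refl
∑-filter P? (x ∷ xs) f with P? x
... | yes _ = cong (f x +_) (∑-filter P? xs f)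
... | no  _ = ∑-filter P? xs f

length-filter-∑ : ∀ {P : A → Set} (P? : ∀ x → Dec (P x)) (xs : List A) →
  length (filter P? xs) ≡ ∑ xs (λ x → P? x ⊳ 1)
length-filter-∑ P? xs = trans (sym (∑-1 (filter P? xs))) (∑-filter P? xs (λ _ → 1))

private
  ≤-split : ∀ n x v → (x ≤? suc n) ⊳ v ≡ (x ≤? n) ⊳ v + (x ≟ suc n) ⊳ v
  ≤-split n x v with x ≤? suc n | x ≤? n | x ≟ suc n
  ... | yes _  | yes p | yes refl = ⊥-elim (1+n≰n p)
  ... | yes _  | yes _ | no _     = sym (+-identityʳ v)
  ... | yes _  | no _  | yes _    = refl
  ... | yes p  | no q  | no r     = ⊥-elim (r (≤-antisym p (≰⇒> q)))
  ... | no p   | yes q | _        = ⊥-elim (p (m≤n⇒m≤1+n q))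
  ... | no p   | no _  | yes refl = ⊥-elim (p ≤-refl)
  ... | no _   | no _  | no _     = refl

-- The potential of a source at level K, seen from level n ≥ K, is 2^(K - n):
-- it halves from one level to the next and pays for the items there.
module Charging (a b : ℕ) (sources items : List ℕ) where

  private
    E R C : ℕ → ℕ
    E n = ∑ sources (λ K → (K ≤? n) ⊳ 2 ^ K)
    R n = ∑ sources (λ K → (K ≤? n) ⊳ 1)
    C n = ∑ items (λ f → (f ≤? n) ⊳ 1)

    at : List ℕ → ℕ → ℕ
    at xs n = ∑ xs (λ x → (x ≟ n) ⊳ 1)

    E-suc : ∀ n → E (suc n) ≡ E n + 2 ^ suc n * at sources (suc n)
    E-suc n = trans (∑-cong sources (λ K → ≤-split n K (2 ^ K)))
      (trans (∑-+ sources _ _) (cong (E n +_)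
        (trans (∑-cong sources scale) (∑-*ˡ sources (2 ^ suc n) _))))
      where
      scale : ∀ K → (K ≟ suc n) ⊳ 2 ^ K ≡ 2 ^ suc n * ((K ≟ suc n) ⊳ 1)
      scale K with K ≟ suc n
      ... | yes refl = sym (*-identityʳ _)
      ... | no _     = sym (*-zeroʳ (2 ^ suc n))

    step-suc : ∀ xs n → ∑ xs (λ x → (x ≤? suc n) ⊳ 1) ≡ ∑ xs (λ x → (x ≤? n) ⊳ 1) + at xs (suc n)
    step-suc xs n = trans (∑-cong xs (λ K → ≤-split n K 1)) (∑-+ xs _ _)

    at-zero : ∀ xs → ∑ xs (λ x → (x ≤? 0) ⊳ 1) ≡ at xs 0
    at-zero xs = ∑-cong xs lem
      where
      lem : ∀ x → (x ≤? 0) ⊳ 1 ≡ (x ≟ 0) ⊳ 1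
      lem zero    = refl
      lem (suc x) = refl

    E-zero : E 0 ≡ R 0
    E-zero = ∑-cong sources lem
      where
      lem : ∀ x → (x ≤? 0) ⊳ 2 ^ x ≡ (x ≤? 0) ⊳ 1
      lem zero    = refl
      lem (suc x) = refl

  module _ (bound : ∀ k → a * (2 ^ k * at items k) ≤ b * E k) where

    private
      -- Divided by `2 ^ n`: what the items up to level `n` have cost plus the potential still left
      -- is at most `2 * b` per source, since 1 + 1/2 + 1/4 + ... ≤ 2. From `n` to `n + 1` the
      -- factor doubles; the extra copy of `b * E n` which this yields pays for the new items by
      -- `bound`.
      potential : ∀ n → 2 ^ n * (a * C n) + b * E n ≤ 2 ^ n * (2 * b * R n)
      potential zero = begin
        1 * (a * C 0) + b * E 0          ≡⟨ cong (λ z → 1 * (a * z) + b * E 0) (at-zero items) ⟩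
        1 * (a * at items 0) + b * E 0   ≡⟨ cong (_+ b * E 0) (lem a (at items 0)) ⟩
        a * (2 ^ 0 * at items 0) + b * E 0 ≤⟨ +-monoˡ-≤ (b * E 0) (bound 0) ⟩
        b * E 0 + b * E 0                ≡⟨ cong (λ z → b * z + b * z) E-zero ⟩
        b * R 0 + b * R 0                ≡⟨ lem′ b (R 0) ⟩
        1 * (2 * b * R 0)                ∎
        where
        open ≤-Reasoning
        lem : ∀ x y → 1 * (x * y) ≡ x * (1 * y)
        lem = solve-∀
        lem′ : ∀ x y → x * y + x * y ≡ 1 * (2 * x * y)
        lem′ = solve-∀
      potential (suc n) = begin
        2 * p * (a * C (suc n)) + b * E (suc n)
          ≡⟨ cong (λ z → 2 * p * (a * z) + b * E (suc n)) (step-suc items n) ⟩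
        2 * p * (a * (C n + c)) + b * E (suc n)
          ≡⟨ lem₁ p a (C n) c (b * E (suc n)) ⟩
        2 * (p * (a * C n)) + (a * (2 * p * c) + b * E (suc n))
          ≤⟨ +-monoʳ-≤ (2 * (p * (a * C n))) (+-monoˡ-≤ (b * E (suc n)) (bound (suc n))) ⟩
        2 * (p * (a * C n)) + (b * E (suc n) + b * E (suc n))
          ≡⟨ cong (λ z → 2 * (p * (a * C n)) + (b * z + b * z)) (E-suc n) ⟩
        2 * (p * (a * C n)) + (b * (E n + 2 * p * r) + b * (E n + 2 * p * r))
          ≡⟨ lem₂ p (a * C n) b (E n) r ⟩
        2 * (p * (a * C n) + b * E n) + 2 * p * (2 * b * r)
          ≤⟨ +-monoˡ-≤ (2 * p * (2 * b * r)) (*-monoʳ-≤ 2 (potential n)) ⟩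
        2 * (p * (2 * b * R n)) + 2 * p * (2 * b * r)
          ≡⟨ lem₃ p b (R n) r ⟩
        2 * p * (2 * b * (R n + r))
          ≡⟨ cong (λ z → 2 * p * (2 * b * z)) (sym (step-suc sources n)) ⟩
        2 * p * (2 * b * R (suc n)) ∎
        where
        open ≤-Reasoning
        p = 2 ^ n
        c = at items (suc n)
        r = at sources (suc n)
        lem₁ : ∀ p a C c e → 2 * p * (a * (C + c)) + e ≡ 2 * (p * (a * C)) + (a * (2 * p * c) + e)
        lem₁ = solve-∀
        lem₂ : ∀ p x b e r → 2 * (p * x) + (b * (e + 2 * p * r) + b * (e + 2 * p * r))
                           ≡ 2 * (p * x + b * e) + 2 * p * (2 * b * r)
        lem₂ = solve-∀
        lem₃ : ∀ p b R r → 2 * (p * (2 * b * R)) + 2 * p * (2 * b * r) ≡ 2 * p * (2 * b * (R + r))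
        lem₃ = solve-∀

    charging : a * length items ≤ 2 * b * length sources
    charging = begin
      a * length items        ≡⟨ cong (a *_) (sym C-top) ⟩
      a * C N                 ≤⟨ *-cancelˡ-≤ (2 ^ N) {{m^n≢0 2 N}}
                                   (≤-trans (m≤m+n _ (b * E N)) (potential N)) ⟩
      2 * b * R N             ≤⟨ *-monoʳ-≤ (2 * b) (≤-trans (∑-mono sources (λ K → ⊳-≤ (K ≤? N) 1)) (≤-reflexive (∑-1 sources))) ⟩
      2 * b * length sources  ∎
      where
      open ≤-Reasoning
      -- The sum of all item levels is at least each of them, so no item is missed by `C N`.
      N = ∑ items (λ x → x)
      C-top : C N ≡ length items
      C-top = trans (≤-antisym (∑-mono items (λ f → ⊳-≤ (f ≤? N) 1))
        (∑-mono∈ items (λ f f∈ → ≤-reflexive (sym (⊳-yes (f ≤? N) (∑-member items (λ x → x) f∈) 1)))))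
        (∑-1 items)

-- The number of binary digits of `x`: it grows exactly when the next power of two is reached.
bits : ℕ → ℕ
bits zero    = 0
bits (suc x) = (2 ^ bits x ≤? suc x) ⊳ 1 + bits x

bits-< : ∀ x → x < 2 ^ bits x
bits-< zero = s≤s z≤n
bits-< (suc x) with 2 ^ bits x ≤? suc x
... | yes _ = <-≤-trans (s≤s (bits-< x)) (+-mono-≤ (m^n>0 2 (bits x)) (≤-reflexive (sym (+-identityʳ _))))
... | no ≰  = ≰⇒> ≰

-- With `bits-<` this places `2 ^ bits x` within a factor 2 of `x`, except at 0, where the power is
-- 1; hence the successor.
bits-≤ : ∀ x → 2 ^ bits (suc x) ≤ 2 * suc x
bits-≤ zero = s≤s (s≤s z≤n)
bits-≤ (suc x) with 2 ^ bits (suc x) ≤? suc (suc x)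
... | yes p = *-monoʳ-≤ 2 p
... | no _  = ≤-trans (bits-≤ x) (*-monoʳ-≤ 2 (n≤1+n (suc x)))

bits-suc : ∀ x → bits x ≤ bits (suc x)
bits-suc x with 2 ^ bits x ≤? suc x
... | yes _ = n≤1+n _
... | no _  = ≤-refl

step-mono : (f : ℕ → ℕ) → (∀ x → f x ≤ f (suc x)) → ∀ {x y} → x ≤ y → f x ≤ f y
step-mono f h {x} {y} x≤y = go (≤⇒≤′ x≤y)
  where
  go : ∀ {y} → x ≤′ y → f x ≤ f y
  go (≤′-reflexive refl) = ≤-refl
  go (≤′-step p)  = ≤-trans (go p) (h _)

bits-mono : ∀ {x y} → x ≤ y → bits x ≤ bits y
bits-mono = step-mono bits bits-suc

-- The algorithm

-- The phase is nothing once the estimate is known, and the current logarithm of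
-- the work done before; a task leaves the stack when its phase changes.
record Task (X : Set) : Set where
  constructor task
  field
    name  : X
    level : ℕ
    phase : Maybe ℕ
open Task public

-- A base task is never processed while an unstarted task of lower level
-- waits; a side task may be, with at most one such task below the base under it.
data Kind : Set where
  base side : Kind

Stack : Set → Set
Stack X = List (Kind × Task X)

-- Generic in the names: the algorithm runs the machine on labels, the analysis runs it on jobs.
module Machine {X : Set} (_==_ : X → X → Bool) where

  samePhase : Maybe ℕ → Maybe ℕ → Bool
  samePhase p q = does (Maybe.≡-dec _≟_ p q)

  -- Side tasks are transparent: a task may count as waiting although its level exceeds that of the
  -- side task on top.
  under : Stack X → ℕ → Bool
  under []               ℓ = true
  under ((base , x) ∷ σ) ℓ = ℓ <ᵇ level x
  under ((side , x) ∷ σ) ℓ = under σ ℓ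

  lowest : Task X → List (Task X) → Task X
  lowest x []       = x
  lowest x (y ∷ ys) = if level y <ᵇ level x then lowest y ys else lowest x ys

  -- A single waiting task leaves no second one to justify a base, so it can only become a side
  -- task; on top of another side task it has to wait, as adjacent side tasks would make the stack
  -- long without jobs outside it. With two or more, the lowest becomes a base justified by one of
  -- the others; if a side task is on top, it must be strictly lower to keep the stack sorted.
  start : Stack X → List (Task X) → Stack X
  start σ                []           = σ
  start []               (x ∷ [])     = (side , x) ∷ []
  start ((base , w) ∷ σ) (x ∷ [])     = (side , x) ∷ (base , w) ∷ σ
  start ((side , w) ∷ σ) (x ∷ [])     = (side , w) ∷ σ
  start []               (x ∷ y ∷ ys) = (base , lowest x (y ∷ ys)) ∷ []
  start ((base , w) ∷ σ) (x ∷ y ∷ ys) = (base , lowest x (y ∷ ys)) ∷ (base , w) ∷ σ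
  start ((side , w) ∷ σ) (x ∷ y ∷ ys) =
    if level (lowest x (y ∷ ys)) <ᵇ level w
    then (base , lowest x (y ∷ ys)) ∷ (side , w) ∷ σ
    else (side , w) ∷ σ

  continues : List (Task X) → Task X → Bool
  continues cs x = any (λ c → (name c == name x) ∧ samePhase (phase c) (phase x)) cs

  -- Only the top was processed in the last interval, so no other task on the stack can have changed
  -- its phase.
  pop : List (Task X) → Stack X → Stack X
  pop cs []            = []
  pop cs ((κ , x) ∷ σ) = if continues cs x then (κ , x) ∷ σ else σ

  started : Stack X → Task X → Bool
  started σ c = any (λ x → name c == name (proj₂ x)) σ

  waiting : List (Task X) → Stack X → List (Task X)
  waiting cs σ = filterᵇ (λ c → not (started σ c) ∧ under σ (level c)) cs

  resume : List (Task X) → Stack X → Stack X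
  resume cs σ = start σ (waiting cs σ)

  advance : List (Task X) → Stack X → Stack X
  advance cs σ = resume cs (pop cs σ)

  current : Stack X → Maybe X
  current []            = nothing
  current ((κ , x) ∷ σ) = just (name x)

-- Invariance of the machine under renaming

rename : {X Y : Set} → (X → Y) → Task X → Task Y
rename f x = record { name = f (name x) ; level = level x ; phase = phase x }

any-map : {A B : Set} (f : A → B) (p : B → Bool) (xs : List A) → any p (map f xs) ≡ any (p ∘ f) xs
any-map f p []       = refl
any-map f p (x ∷ xs) with p (f x)
... | true  = refl
... | false = any-map f p xs

any-cong : {A : Set} {p q : A → Bool} → (∀ x → p x ≡ q x) → ∀ xs → any p xs ≡ any q xs
any-cong h []       = refl
any-cong {p = p} {q} h (x ∷ xs) with p x | q x | h x
... | true  | .true  | refl = refl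
... | false | .false | refl = any-cong h xs

filterᵇ-map : {A B : Set} (f : A → B) (p : B → Bool) (xs : List A) →
  filterᵇ p (map f xs) ≡ map f (filterᵇ (p ∘ f) xs)
filterᵇ-map f p []       = refl
filterᵇ-map f p (x ∷ xs) with p (f x)
... | true  = cong (f x ∷_) (filterᵇ-map f p xs)
... | false = filterᵇ-map f p xs

filterᵇ-cong : {A : Set} {p q : A → Bool} → (∀ x → p x ≡ q x) → ∀ xs → filterᵇ p xs ≡ filterᵇ q xs
filterᵇ-cong h []       = refl
filterᵇ-cong {p = p} {q} h (x ∷ xs) with p x | q x | h x
... | true  | .true  | refl = cong (x ∷_) (filterᵇ-cong h xs)
... | false | .false | refl = filterᵇ-cong h xs

-- Names enter the machine only through the equality test, so each operation commutes with a
-- renaming that preserves this test.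
module Simulation {X Y : Set} (_=X_ : X → X → Bool) (_=Y_ : Y → Y → Bool)
  (f : X → Y) (f-eq : ∀ a b → (f a =Y f b) ≡ (a =X b)) where

  private
    module MX = Machine _=X_
    module MY = Machine _=Y_

  r : Task X → Task Y
  r = rename f

  rs : Stack X → Stack Y
  rs = map (map₂ r)

  under-r : ∀ σ ℓ → MY.under (rs σ) ℓ ≡ MX.under σ ℓ
  under-r []               ℓ = refl
  under-r ((base , x) ∷ σ) ℓ = refl
  under-r ((side , x) ∷ σ) ℓ = under-r σ ℓ

  lowest-r : ∀ x ys → MY.lowest (r x) (map r ys) ≡ r (MX.lowest x ys)
  lowest-r x []       = refl
  lowest-r x (y ∷ ys) with level y <ᵇ level x
  ... | true  = lowest-r y ys
  ... | false = lowest-r x ys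

  start-r : ∀ σ xs → MY.start (rs σ) (map r xs) ≡ rs (MX.start σ xs)
  start-r []               []           = refl
  start-r (_ ∷ _)          []           = refl
  start-r []               (x ∷ [])     = refl
  start-r ((base , w) ∷ σ) (x ∷ [])     = refl
  start-r ((side , w) ∷ σ) (x ∷ [])     = refl
  start-r []               (x ∷ y ∷ ys) rewrite lowest-r x (y ∷ ys) = refl
  start-r ((base , w) ∷ σ) (x ∷ y ∷ ys) rewrite lowest-r x (y ∷ ys) = refl
  start-r ((side , w) ∷ σ) (x ∷ y ∷ ys) rewrite lowest-r x (y ∷ ys)
    with level (MX.lowest x (y ∷ ys)) <ᵇ level w
  ... | true  = refl
  ... | false = refl

  pop-r : ∀ cs σ → MY.pop (map r cs) (rs σ) ≡ rs (MX.pop cs σ)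
  pop-r cs []            = refl
  pop-r cs ((κ , x) ∷ σ)
    rewrite trans (any-map r (λ c → (name c =Y f (name x)) ∧ MY.samePhase (phase c) (phase x)) cs)
      (any-cong (λ c → cong (_∧ MY.samePhase (phase c) (phase x)) (f-eq (name c) (name x))) cs)
    with MX.continues cs x
  ... | true  = refl
  ... | false = refl

  waiting-r : ∀ cs σ → MY.waiting (map r cs) (rs σ) ≡ map r (MX.waiting cs σ)
  waiting-r cs σ = trans (filterᵇ-map r _ cs) (cong (map r) (filterᵇ-cong lem cs))
    where
    lem : ∀ c → (not (MY.started (rs σ) (r c)) ∧ MY.under (rs σ) (level c))
              ≡ (not (MX.started σ c) ∧ MX.under σ (level c))
    lem c = cong₂ (λ a b → not a ∧ b)
      (trans (any-map (map₂ r) _ σ) (any-cong (λ x → f-eq (name c) (name (proj₂ x))) σ))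
      (under-r σ (level c))

  advance-r : ∀ cs σ → MY.advance (map r cs) (rs σ) ≡ rs (MX.advance cs σ)
  advance-r cs σ rewrite pop-r cs σ | waiting-r cs (MX.pop cs σ) =
    start-r (MX.pop cs σ) (MX.waiting cs (MX.pop cs σ))

-- Tasks read off from snapshots

hintLevel : Maybe ℕ → ℕ → ℕ
hintLevel nothing  x = bits x
hintLevel (just p̂) x = bits p̂ ⊔ bits x

hintPhase : Maybe ℕ → ℕ → Maybe ℕ
hintPhase nothing  x = just (bits x)
hintPhase (just _) x = nothing

viewTask : JobView → Task ℕ
viewTask v = task (JobView.name v) (hintLevel hint processed) (hintPhase hint processed)
  where open JobView v using (hint; processed)

tasks : Snapshot → List (Task ℕ)
tasks s = map viewTask (filterᵇ (not ∘ JobView.completed) s)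

-- An online algorithm has no memory besides the history, so the stack is rebuilt by replaying all
-- snapshots, oldest first.
stack : List Snapshot → Stack ℕ
stack []      = []
stack (s ∷ h) = Machine.advance _≡ᵇ_ (tasks s) (stack h)

algorithm : OnlineAlgorithm
algorithm h = Machine.current _≡ᵇ_ (stack h)

-- Cuts and the invariants of one step

-- Levels and phases are abstract functions of the work done. The stack argument relies only on
-- levels being bounded, never dropping, and staying put while the phase does.
module Invariants {n : ℕ} (release proc : Fin n → ℕ)
  (Λ : Fin n → ℕ → ℕ) (ph : Fin n → ℕ → Maybe ℕ)
  (Λ-mono : ∀ j {x y} → x ≤ y → Λ j x ≤ Λ j y)
  (Λ-phase : ∀ j x → ph j (suc x) ≡ ph j x → Λ j (suc x) ≡ Λ j x)
  (top : ℕ) (Λ<top : ∀ j x → Λ j x < top) where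

  Job : Set
  Job = Fin n

  jobs : List Job
  jobs = allFin n

  -- An untouched job counts as being right after a change of information; so every unfinished job
  -- outside the stack is at a break and has much work left.
  Break : Job → ℕ → Set
  Break j zero    = ⊤
  Break j (suc x) = ph j (suc x) ≢ ph j x

  -- The level at which the last of x units was processed (irrelevant if x = 0).
  K : Job → ℕ → ℕ
  K j x = Λ j (pred x)

  Alive : ℕ → (Job → ℕ) → Job → Set
  Alive t e j = release j ≤ t × e j < proc j

  Runs : Job → (e e′ : Job → ℕ) → Set
  Runs j e e′ = e′ j ≡ suc (e j) × (∀ i → i ≢ j → e′ i ≡ e i)

  NotYet : ℕ → (Job → ℕ) → Set
  NotYet t e = ∀ i → t ≤ release i → e i ≡ 0

  -- In `work` an exceptional job is credited with all its work, also that done before `since`. The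
  -- credit is restricted to jobs last processed below `κ`, because only those have potential to pay
  -- with at the level considered.
  record Cut (t : ℕ) (e : Job → ℕ) (X : List Job) (κ : ℕ) : Set where
    field
      since  : ℕ
      since≤ : since ≤ t
      work   : t ≤ since + (∑ jobs (λ j → (since ≤? release j) ⊳ e j)
                          + ∑ X (λ j → (K j (e j) <? κ) ⊳ e j))
      low    : ∀ j → since ≤ release j → 0 < e j → K j (e j) < κ
      live   : ∀ i → Alive t e i → Λ i (e i) < κ → since ≤ release i ⊎ i ∈ X
  open Cut

  cut-now : ∀ {t e X κ} → NotYet t e →
    (∀ i → Alive t e i → Λ i (e i) < κ → t ≤ release i ⊎ i ∈ X) → Cut t e X κ
  cut-now {t} ny h = record
    { since  = t
    ; since≤ = ≤-refl
    ; work   = m≤m+n t _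
    ; low    = λ j t≤r 0<e → ⊥-elim (<-irrefl (sym (ny j t≤r)) 0<e)
    ; live   = h
    }

  module Step {t e e′ j} (runs : Runs j e e′) (alive : Alive t e j) where

    e≤e′ : ∀ i → e i ≤ e′ i
    e≤e′ i with i Fin.≟ j
    ... | yes refl = ≤-trans (n≤1+n _) (≤-reflexive (sym (proj₁ runs)))
    ... | no i≢j   = ≤-reflexive (sym (proj₂ runs i i≢j))

    notYet′ : NotYet t e → NotYet (suc t) e′
    notYet′ ny i t<r with i Fin.≟ j
    ... | yes refl = ⊥-elim (<-irrefl refl (≤-trans t<r (proj₁ alive)))
    ... | no i≢j   = trans (proj₂ runs i i≢j) (ny i (≤-trans (n≤1+n t) t<r))

    bounded′ : (∀ i → e i ≤ proc i) → ∀ i → e′ i ≤ proc i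
    bounded′ h i with i Fin.≟ j
    ... | yes refl = ≤-trans (≤-reflexive (proj₁ runs)) (proj₂ alive)
    ... | no i≢j   = ≤-trans (≤-reflexive (proj₂ runs i i≢j)) (h i)

    alive-back : ∀ {i} → Alive (suc t) e′ i →
      suc t ≤ release i ⊎ (Alive t e i × Λ i (e i) ≤ Λ i (e′ i))
    alive-back {i} (r≤ , e′<p) with release i ≤? t
    ... | yes r≤t = inj₂ ((r≤t , ≤-<-trans (e≤e′ i) e′<p) , Λ-mono i (e≤e′ i))
    ... | no r≰t  = inj₁ (≰⇒> r≰t)

    -- Levels never drop, so apart from `X` only jobs released at the new time or later can be below
    -- `κ`, and the cut may start there.
    cut-reset : ∀ {X κ} → NotYet t e → (∀ i → Alive t e i → Λ i (e i) < κ → i ∈ X) →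
      Cut (suc t) e′ X κ
    cut-reset ny h = cut-now (notYet′ ny) λ i al Λ< → case alive-back al of λ where
      (inj₁ r)           → inj₁ r
      (inj₂ (al₀ , Λ≤)) → inj₂ (h i al₀ (≤-<-trans Λ≤ Λ<))

    K′j : K j (e′ j) ≡ Λ j (e j)
    K′j rewrite proj₁ runs = refl

    -- By `live` the processed job was released since the cut or is exceptional, so the elapsed unit
    -- is recorded in one of the two sums of `work`.
    cut-run : ∀ {X κ} → Λ j (e j) < κ → Cut t e X κ → Cut (suc t) e′ X κ
    cut-run {X} {κ} l<κ c = record
      { since  = s
      ; since≤ = m≤n⇒m≤1+n (since≤ c)
      ; work   = ≤-trans (s≤s (work c)) (≤-trans (≤-reflexive (sym (+-suc s _))) (+-monoʳ-≤ s grow))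
      ; low    = low′
      ; live   = λ i al Λ< → case alive-back al of λ where
          (inj₁ r)          → inj₁ (≤-trans (m≤n⇒m≤1+n (since≤ c)) r)
          (inj₂ (al₀ , Λ≤)) → live c i al₀ (≤-<-trans Λ≤ Λ<)
      }
      where
      s = since c
      f f′ g g′ : Job → ℕ
      f  i = (s ≤? release i) ⊳ e i
      f′ i = (s ≤? release i) ⊳ e′ i
      g  i = (K i (e i) <? κ) ⊳ e i
      g′ i = (K i (e′ i) <? κ) ⊳ e′ i
      f≤ : ∀ i → f i ≤ f′ i
      f≤ i = ⊳-mono-→ (s ≤? release i) (s ≤? release i) (λ x → x) (e≤e′ i)
      K′j<κ : K j (e′ j) < κ
      K′j<κ = ≤-<-trans (≤-reflexive K′j) l<κ
      g≤ : ∀ i → g i ≤ g′ i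
      g≤ i with i Fin.≟ j
      ... | yes refl = ⊳-mono-→ (K j (e j) <? κ) (K j (e′ j) <? κ) (λ _ → K′j<κ) (e≤e′ j)
      ... | no i≢j   = ≤-reflexive (cong (λ x → (K i x <? κ) ⊳ x) (sym (proj₂ runs i i≢j)))
      ej< : e j < e′ j
      ej< = ≤-reflexive (sym (proj₁ runs))
      grow : ∑ jobs f + ∑ X g < ∑ jobs f′ + ∑ X g′
      grow with live c j alive l<κ
      ... | inj₁ s≤r = +-mono-<-≤ (∑-strict jobs f≤ (∈-allFin j)
              (subst₂ _<_ (sym (⊳-yes (s ≤? release j) s≤r (e j))) (sym (⊳-yes (s ≤? release j) s≤r (e′ j))) ej<))
              (∑-mono X g≤)
      -- The guard may have failed before this unit; the summand then rises from 0 to `e′ j`, which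
      -- is an increase as well.
      ... | inj₂ j∈X = +-mono-≤-< (∑-mono jobs f≤) (∑-strict X g≤ j∈X
              (≤-<-trans (⊳-≤ (K j (e j) <? κ) (e j))
                (subst (e j <_) (sym (⊳-yes (K j (e′ j) <? κ) K′j<κ (e′ j))) ej<)))
      low′ : ∀ i → s ≤ release i → 0 < e′ i → K i (e′ i) < κ
      low′ i s≤r 0<e′ with i Fin.≟ j
      ... | yes refl = K′j<κ
      ... | no i≢j   = subst (λ x → K i x < κ) (sym (proj₂ runs i i≢j))
                         (low c i s≤r (subst (0 <_) (proj₂ runs i i≢j) 0<e′))

  -- Stacks, bands and the invariant

  lv : Kind × Task Job → ℕ
  lv = level ∘ proj₂

  names : Stack Job → List Job
  names = map (name ∘ proj₂)

  -- The strict upper bound on the levels of waiting tasks; `top` acts as a base beneath the whole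
  -- stack.
  bnd : Stack Job → ℕ
  bnd []               = top
  bnd ((base , x) ∷ σ) = level x
  bnd ((side , x) ∷ σ) = bnd σ

  bnd-above : ∀ {l} σ → l < top → All (λ a → l < lv a) σ → l < bnd σ
  bnd-above []               l<top _         = l<top
  bnd-above ((base , x) ∷ σ) l<top (l< ∷ _)  = l<
  bnd-above ((side , x) ∷ σ) l<top (_ ∷ l<s) = bnd-above σ l<top l<s

  Sorted : Stack Job → Set
  Sorted = AllPairs (λ a b → lv a < lv b)

  -- No two side tasks are adjacent, which bounds the length of the stack by twice the number of
  -- bases plus one.
  data Shape : Stack Job → Set where
    empty  : Shape []
    onBase : ∀ {x σ} → Shape σ → Shape ((base , x) ∷ σ)
    on[]   : ∀ {w} → Shape ((side , w) ∷ [])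
    onSide : ∀ {w x σ} → Shape ((base , x) ∷ σ) → Shape ((side , w) ∷ (base , x) ∷ σ)

  Shape-tail : ∀ {a σ} → Shape (a ∷ σ) → Shape σ
  Shape-tail (onBase s) = s
  Shape-tail on[]       = empty
  Shape-tail (onSide s) = s

  Entry : ℕ → (Job → ℕ) → Kind × Task Job → Set
  Entry t e (κ , x) = Alive t e (name x) × level x ≡ Λ (name x) (e (name x)) × phase x ≡ ph (name x) (e (name x))

  -- The intervals of levels allowed for the witnesses of different bases are disjoint, so the
  -- witnesses are distinct. `ns` remains the whole stack during the recursion: a witness must be
  -- off all of it.
  Backed : ℕ → (Job → ℕ) → List Job → Stack Job → Set
  Backed t e ns []               = ⊤
  Backed t e ns ((side , x) ∷ σ) = Backed t e ns σ
  Backed t e ns ((base , x) ∷ σ) =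
    (∃[ f ] Alive t e f × f ∉ ns × level x ≤ Λ f (e f) × Λ f (e f) < bnd σ) × Backed t e ns σ

  Cuts : ℕ → (Job → ℕ) → Stack Job → Set
  Cuts t e []               = Cut t e [] top
  Cuts t e ((side , x) ∷ σ) = Cuts t e σ
  Cuts t e ((base , x) ∷ σ) = Cut t e [] (level x) × Cuts t e σ

  cut-bnd : ∀ {t e} σ → Cuts t e σ → Cut t e [] (bnd σ)
  cut-bnd []               c       = c
  cut-bnd ((base , x) ∷ σ) (c , _) = c
  cut-bnd ((side , x) ∷ σ) c       = cut-bnd σ c

  -- The exceptional jobs X k are the same for all levels between two
  -- consecutive bases; hi is the level of the deeper one.
  record Band (t : ℕ) (e : Job → ℕ) (X : ℕ → List Job) (k : ℕ) : Set where
    field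
      hi    : ℕ
      k<hi  : k < hi
      same  : ∀ {k′} → k ≤ k′ → k′ < hi → X k′ ≡ X k
      outer : Cut t e [] hi
      inner : Cut t e (X k) (suc k)
      small : length (X k) ≤ 2

  override : ℕ → List Job → (ℕ → List Job) → ℕ → List Job
  override l Z X k with k <? l
  ... | yes _ = Z
  ... | no  _ = X k

  override-< : ∀ {l Z X k} → k < l → override l Z X k ≡ Z
  override-< {l} {k = k} k<l with k <? l
  ... | yes _ = refl
  ... | no ≮  = ⊥-elim (≮ k<l)

  override-≥ : ∀ {l Z X k} → l ≤ k → override l Z X k ≡ X k
  override-≥ {l} {k = k} l≤k with k <? l
  ... | yes k<l = ⊥-elim (<-irrefl refl (<-≤-trans k<l l≤k))
  ... | no _    = refl

  band-override-≥ : ∀ {t e X Z l k} → l ≤ k → Band t e X k → Band t e (override l Z X) k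
  band-override-≥ l≤k b = record
    { hi = hi ; k<hi = k<hi ; outer = outer
    ; same = λ k≤ k< → trans (override-≥ (≤-trans l≤k k≤)) (trans (same k≤ k<) (sym (override-≥ l≤k)))
    ; inner = subst (λ Y → Cut _ _ Y _) (sym (override-≥ l≤k)) inner
    ; small = subst (λ Y → length Y ≤ 2) (sym (override-≥ l≤k)) small }
    where open Band b

  band-override-< : ∀ {t e X Z l k} → k < l → Cut t e [] l → Cut t e Z (suc k) → length Z ≤ 2 →
    Band t e (override l Z X) k
  band-override-< {l = l} k<l out inn sm = record
    { hi = l ; k<hi = k<l ; outer = out
    ; same = λ _ k′< → trans (override-< k′<) (sym (override-< k<l))
    ; inner = subst (λ Y → Cut _ _ Y _) (sym (override-< k<l)) inn
    ; small = subst (λ Y → length Y ≤ 2) (sym (override-< k<l)) sm }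

  -- When the base of level `l` disappears, the levels below `l` join the band containing `l` and
  -- take over its exceptions.
  band-merge : ∀ {t e X l k} → k < l → Band t e X l → Cut t e (X l) (suc k) →
    Band t e (override l (X l) X) k
  band-merge {X = X} {l = l} {k} k<l b inn = record
    { hi = hi ; k<hi = <-trans k<l k<hi ; outer = outer
    ; same = λ {k′} _ k′<hi → trans (value k′<hi) (sym (override-< k<l))
    ; inner = subst (λ Y → Cut _ _ Y _) (sym (override-< k<l)) inn
    ; small = subst (λ Y → length Y ≤ 2) (sym (override-< k<l)) small }
    where
    open Band b
    value : ∀ {k′} → k′ < hi → override l (X l) X k′ ≡ X l
    value {k′} k′<hi with k′ <? l
    ... | yes _ = refl
    ... | no ≮  = same (≮⇒≥ ≮) k′<hi

  record Core (t : ℕ) (e : Job → ℕ) (X : ℕ → List Job) (σ : Stack Job) : Set where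
    field
      notYet  : NotYet t e
      bounded : ∀ i → e i ≤ proc i
      others  : ∀ i → Alive t e i → i ∈ names σ ⊎ Break i (e i)
      sorted  : Sorted σ
      shape   : Shape σ
      backed  : Backed t e (names σ) σ
      cuts    : Cuts t e σ
      bands   : ∀ k → k < top → Band t e X k

  -- The state at time `t` between the two halves of `advance`: an outdated top is gone, and the
  -- next task is not yet chosen.
  record Before (t : ℕ) (e : Job → ℕ) (X : ℕ → List Job) (σ : Stack Job) : Set where
    field
      core    : Core t e X σ
      entries : All (Entry t e) σ
    open Core core public

  -- The state after a unit of work, before the top is examined. Its level and phase refer to the
  -- work `e₀` before that unit. The last condition, for bases, is what lets cuts restart when the
  -- base is popped.
  data After (t : ℕ) (e : Job → ℕ) (X : ℕ → List Job) : Stack Job → Set where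
    idle : Core t e X [] → After t e X []
    ran  : ∀ {κ x σ e₀} → Core t e X ((κ , x) ∷ σ) → All (Entry t e) σ →
      release (name x) ≤ t → e (name x) ≡ suc e₀ →
      level x ≡ Λ (name x) e₀ → phase x ≡ ph (name x) e₀ →
      (κ ≡ base → ∀ i → Alive t e i → Λ i (e i) < level x → t ≤ release i) →
      After t e X ((κ , x) ∷ σ)

  Clean : ℕ → (Job → ℕ) → ℕ → Set
  Clean t e l = ∀ i → Alive t e i → Λ i (e i) < l → ⊥

  -- If no unfinished job is below the processed one, every cut survives: one above its level
  -- records the unit, and one at or below its level restarts at the new time.
  module CleanStep {t e e′ j} (runs : Runs j e e′) (alive : Alive t e j)
    (ny : NotYet t e) (clean : Clean t e (Λ j (e j))) where
    open Step runs alive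

    clean-reset : ∀ {X κ} → κ ≤ Λ j (e j) → Cut (suc t) e′ X κ
    clean-reset κ≤l = cut-reset ny (λ i al Λ< → ⊥-elim (clean i al (<-≤-trans Λ< κ≤l)))

    clean-cut : ∀ {X κ} → Cut t e X κ → Cut (suc t) e′ X κ
    clean-cut {κ = κ} c with Λ j (e j) <? κ
    ... | yes l<κ = cut-run l<κ c
    ... | no l≮κ  = clean-reset (≮⇒≥ l≮κ)

    clean-cuts : ∀ σ → Cuts t e σ → Cuts (suc t) e′ σ
    clean-cuts []               c        = clean-cut c
    clean-cuts ((side , x) ∷ σ) cs       = clean-cuts σ cs
    clean-cuts ((base , x) ∷ σ) (c , cs) = clean-cut c , clean-cuts σ cs

    clean-band : ∀ {X k} → Band t e X k → Band (suc t) e′ X k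
    clean-band b = record { hi = hi ; k<hi = k<hi ; same = same
      ; outer = clean-cut outer ; inner = clean-cut inner ; small = small }
      where open Band b

    clean-below : ∀ i → Alive (suc t) e′ i → Λ i (e′ i) < Λ j (e j) → suc t ≤ release i
    clean-below i al Λ< = case alive-back al of λ where
      (inj₁ r)          → r
      (inj₂ (al₀ , Λ≤)) → ⊥-elim (clean i al₀ (≤-<-trans Λ≤ Λ<))

  module Keep {t e e′ j} (runs : Runs j e e′) (alive : Alive t e j) (ny : NotYet t e) where
    open Step runs alive

    keep-entry : ∀ {a} → name (proj₂ a) ≢ j → Entry t e a → Entry (suc t) e′ a
    keep-entry {κ , x} ≢j ((r≤ , e<p) , leq , peq)
      rewrite proj₂ runs (name x) ≢j = (m≤n⇒m≤1+n r≤ , e<p) , leq , peq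

    keep-others : ∀ {ns ns′} → j ∈ ns′ → (∀ {i} → i ∈ ns → i ∈ ns′) →
      (∀ i → Alive t e i → i ∈ ns ⊎ Break i (e i)) →
      ∀ i → Alive (suc t) e′ i → i ∈ ns′ ⊎ Break i (e′ i)
    keep-others j∈ ⊆ h i al with i Fin.≟ j
    ... | yes refl = inj₁ j∈
    ... | no i≢j with alive-back al
    ...   | inj₁ t<r rewrite notYet′ ny i t<r = inj₂ tt
    ...   | inj₂ (al₀ , _) with h i al₀
    ...     | inj₁ i∈  = inj₁ (⊆ i∈)
    ...     | inj₂ brk rewrite proj₂ runs i i≢j = inj₂ brk

    -- Witnesses have level at least `bnd σ`, so the hypothesis is needed only there. A newly pushed
    -- task has a lower level and hence is no witness of an older base.
    keep-backed : ∀ {ns ns′} σ →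
      (∀ {f} → f ∉ ns → bnd σ ≤ Λ f (e f) → f ≢ j × f ∉ ns′) →
      Sorted σ →
      Backed t e ns σ → Backed (suc t) e′ ns′ σ
    keep-backed []               h s b = tt
    keep-backed ((side , x) ∷ σ) h (_ ∷ s) b = keep-backed σ h s b
    keep-backed ((base , x) ∷ σ) h (x< ∷ s) ((f , (r≤ , e<p) , f∉ , lo , hi) , b)
      with h f∉ lo
    ... | f≢j , f∉′ =
      (f , (m≤n⇒m≤1+n r≤ , subst (_< proc f) (sym eq) e<p) , f∉′
         , subst (λ y → level x ≤ Λ f y) (sym eq) lo , subst (λ y → Λ f y < bnd σ) (sym eq) hi)
      , keep-backed σ (λ g∉ lo′ → h g∉ (≤-trans (deeper σ x<) lo′)) s b
      where
      eq = proj₂ runs f f≢j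
      deeper : ∀ σ → All (λ a → level x < lv a) σ → level x ≤ bnd σ
      deeper σ x< with level x <? top
      ... | yes x<top = <⇒≤ (bnd-above σ x<top x<)
      ... | no x≮top  = ⊥-elim (x≮top (≤-<-trans lo (Λ<top f (e f))))

  level<top : ∀ (x : Task Job) {m} → level x ≡ Λ (name x) m → level x < top
  level<top x leq rewrite leq = Λ<top _ _

  names∉ : ∀ {t e} (x : Task Job) {σ} → level x ≡ Λ (name x) (e (name x)) →
    All (λ a → level x < lv a) σ → All (Entry t e) σ → name x ∉ names σ
  names∉ x leq (x< ∷ _)  ((_ , l , _) ∷ _)  (here refl) = <-irrefl (trans leq (sym l)) x<
  names∉ x leq (_ ∷ x<s) (_ ∷ es) (there p) = names∉ x leq x<s es p

  keep-entries : ∀ {t e e′ j} (runs : Runs j e e′) (alive : Alive t e j) (ny : NotYet t e) →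
    ∀ {σ} → j ∉ names σ → All (Entry t e) σ → All (Entry (suc t) e′) σ
  keep-entries runs al ny j∉ []         = []
  keep-entries runs al ny {a ∷ _} j∉ (en ∷ ens) =
    Keep.keep-entry runs al ny {a} (λ eq → j∉ (here (sym eq))) en
    ∷ keep-entries runs al ny (j∉ ∘ there) ens

  run-top : ∀ {t e e′ X κ x σ} → Before t e X ((κ , x) ∷ σ) → Runs (name x) e e′ →
    Clean t e (level x) → After (suc t) e′ X ((κ , x) ∷ σ)
  run-top {t} {e} {e′} {X} {κ} {x} {σ} b runs clean
    with Before.entries b | Before.sorted b
  ... | (alive , leq , peq) ∷ ens | x< ∷ sσ = ran
    (record
      { notYet  = notYet′ notYet
      ; bounded = bounded′ bounded
      ; others  = keep-others (here refl) (λ z → z) others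
      ; sorted  = sorted
      ; shape   = shape
      ; backed  = keep-backed ((κ , x) ∷ σ) (λ f∉ _ → (λ { refl → f∉ (here refl) }) , f∉) sorted backed
      ; cuts    = clean-cuts ((κ , x) ∷ σ) cuts
      ; bands   = λ k k< → clean-band (bands k k<)
      })
    (keep-entries runs alive notYet (names∉ x leq x< ens) ens)
    (m≤n⇒m≤1+n (proj₁ alive)) (proj₁ runs) leq peq
    (λ _ i al Λ< → clean-below i al (subst (Λ i (e′ i) <_) leq Λ<))
    where
    open Before b
    open Step runs alive
    open Keep runs alive notYet
    open CleanStep runs alive notYet (subst (Clean t e) leq clean)

  -- Below a new base all cuts restart, so no exceptions are left there; a side task does not affect
  -- the bands.
  newExceptions : Kind → ℕ → (ℕ → List Job) → ℕ → List Job
  newExceptions base l X = override l [] X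
  newExceptions side l X = X

  run-new : ∀ {t e e′ X κ x σ} → Before t e X σ → Runs (name x) e e′ →
    Entry t e (κ , x) → name x ∉ names σ → All (λ a → level x < lv a) σ → Shape ((κ , x) ∷ σ) →
    Clean t e (level x) →
    (κ ≡ base → ∃[ f ] Alive t e f × f ≢ name x × f ∉ names σ × level x ≤ Λ f (e f) × Λ f (e f) < bnd σ) →
    After (suc t) e′ (newExceptions κ (level x) X) ((κ , x) ∷ σ)
  run-new {t} {e} {e′} {X} {κ} {x} {σ} b runs (alive , leq , peq) x∉ x< sh clean back = ran
    (record
      { notYet  = notYet′ notYet
      ; bounded = bounded′ bounded
      ; others  = keep-others (here refl) there others
      ; sorted  = x< ∷ sorted
      ; shape   = sh
      ; backed  = backed′ κ back
      ; cuts    = cuts′ κ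
      ; bands   = bands′ κ
      })
    (keep-entries runs alive notYet x∉ entries)
    (m≤n⇒m≤1+n (proj₁ alive)) (proj₁ runs) leq peq
    (λ _ i al Λ< → clean-below i al (subst (Λ i (e′ i) <_) leq Λ<))
    where
    open Before b
    open Step runs alive
    open Keep runs alive notYet
    open CleanStep runs alive notYet (subst (Clean t e) leq clean)
    oldBacked : Backed (suc t) e′ (name x ∷ names σ) σ
    oldBacked = keep-backed σ fresh sorted backed
      where
      fresh : ∀ {f} → f ∉ names σ → bnd σ ≤ Λ f (e f) → f ≢ name x × f ∉ name x ∷ names σ
      fresh {f} f∉ lo = f≢ , λ { (here eq) → f≢ eq ; (there p) → f∉ p }
        where
        f≢ : f ≢ name x
        f≢ refl = <-irrefl leq (<-≤-trans (bnd-above σ (level<top x leq) x<) lo)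
    backed′ : ∀ κ → (κ ≡ base → ∃[ f ] Alive t e f × f ≢ name x × f ∉ names σ × level x ≤ Λ f (e f) × Λ f (e f) < bnd σ) →
      Backed (suc t) e′ (name x ∷ names σ) ((κ , x) ∷ σ)
    backed′ side h = oldBacked
    backed′ base h with h refl
    ... | f , (r≤ , e<p) , f≢ , f∉ , lo , hi =
      (f , (m≤n⇒m≤1+n r≤ , subst (_< proc f) (sym eq) e<p)
         , (λ { (here eq) → f≢ eq ; (there p) → f∉ p })
         , subst (λ y → level x ≤ Λ f y) (sym eq) lo , subst (λ y → Λ f y < bnd σ) (sym eq) hi)
      , oldBacked
      where eq = proj₂ runs f f≢
    reset : ∀ {Z κ} → κ ≤ level x → Cut (suc t) e′ Z κ
    reset κ≤ = clean-reset (subst (_ ≤_) leq κ≤)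
    cuts′ : ∀ κ → Cuts (suc t) e′ ((κ , x) ∷ σ)
    cuts′ side = clean-cuts σ cuts
    cuts′ base = reset ≤-refl , clean-cuts σ cuts
    bands′ : ∀ κ k → k < top → Band (suc t) e′ (newExceptions κ (level x) X) k
    bands′ side k k< = clean-band (bands k k<)
    bands′ base k k< with k <? level x
    ... | yes k<l = band-override-< k<l (reset ≤-refl) (reset k<l) z≤n
    ... | no k≮l  = band-override-≥ (≮⇒≥ k≮l) (clean-band (bands k k<))

  -- The one step in which a task z is passed over: it and the running side
  -- task w become the exceptional jobs of the band below the topmost base.
  run-forced : ∀ {t e e′ X w σ} z → Before t e X ((side , w) ∷ σ) → Runs (name w) e e′ →
    (∀ i → Alive t e i → Λ i (e i) < bnd σ → i ∈ z ∷ name w ∷ []) →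
    After (suc t) e′ (override (bnd σ) (z ∷ name w ∷ []) X) ((side , w) ∷ σ)
  run-forced {t} {e} {e′} {X} {w} {σ} z b runs only
    with Before.entries b | Before.sorted b
  ... | (alive , leq , peq) ∷ ens | w< ∷ sσ = ran
    (record
      { notYet  = notYet′ notYet
      ; bounded = bounded′ bounded
      ; others  = keep-others (here refl) (λ z → z) others
      ; sorted  = sorted
      ; shape   = shape
      ; backed  = keep-backed ((side , w) ∷ σ) (λ f∉ _ → (λ { refl → f∉ (here refl) }) , f∉) sorted backed
      ; cuts    = forced-cuts σ w< cuts
      ; bands   = bands′
      })
    (keep-entries runs alive notYet (names∉ w leq w< ens) ens)
    (m≤n⇒m≤1+n (proj₁ alive)) (proj₁ runs) leq peq
    (λ ())
    where
    open Before b
    open Step runs alive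
    open Keep runs alive notYet
    w<bnd : Λ (name w) (e (name w)) < bnd σ
    w<bnd = subst (_< bnd σ) leq (bnd-above σ (level<top w leq) w<)
    forced-cuts : ∀ σ → All (λ a → level w < lv a) σ → Cuts t e σ → Cuts (suc t) e′ σ
    forced-cuts []               _         c        = cut-run (Λ<top _ _) c
    forced-cuts ((side , x) ∷ σ) (_ ∷ w<)  cs       = forced-cuts σ w< cs
    forced-cuts ((base , x) ∷ σ) (w<x ∷ w<) (c , cs) =
      cut-run (subst (_< level x) leq w<x) c , forced-cuts σ w< cs
    bands′ : ∀ k → k < top → Band (suc t) e′ (override (bnd σ) (z ∷ name w ∷ []) X) k
    bands′ k k< with k <? bnd σ
    -- The unfinished jobs below the topmost base are just `z` and the side task, so the inner cut
    -- restarts with these two as exceptions.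
    ... | yes k<b = band-override-< k<b (cut-run w<bnd (cut-bnd σ cuts))
            (cut-reset notYet (λ i al Λ< → only i al (<-≤-trans Λ< k<b))) ≤-refl
    -- The side task is below the base, hence below these levels, and their cuts record its unit.
    ... | no k≮b  = band-override-≥ (≮⇒≥ k≮b) (record { hi = B.hi ; k<hi = B.k<hi ; same = B.same
            ; outer = cut-run (<-trans w<k B.k<hi) B.outer
            ; inner = cut-run (m≤n⇒m≤1+n w<k) B.inner ; small = B.small })
      where
      module B = Band (bands k k<)
      w<k = <-≤-trans w<bnd (≮⇒≥ k≮b)

  -- With nothing unfinished, all cuts can restart: jobs alive at the next time are released only
  -- then.
  run-idle : ∀ {t e X} → Before t e X [] → (∀ i → ¬ Alive t e i) → After (suc t) e X []
  run-idle {t} {e} {X} b dead = idle (record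
    { notYet  = λ i t<r → notYet i (≤-trans (n≤1+n t) t<r)
    ; bounded = bounded
    ; others  = λ i al → inj₂ (subst (Break i) (sym (notYet i (≤-trans (n≤1+n t) (late al)))) tt)
    ; sorted  = []
    ; shape   = empty
    ; backed  = tt
    ; cuts    = cut
    ; bands   = λ k k< → let open Band (bands k k<) in record
        { hi = hi ; k<hi = k<hi ; same = same ; outer = cut ; inner = cut ; small = small }
    })
    where
    open Before b
    late : ∀ {i} → Alive (suc t) e i → suc t ≤ release i
    late {i} (_ , e<p) with release i ≤? t
    ... | yes r≤t = ⊥-elim (dead i (r≤t , e<p))
    ... | no r≰t  = ≰⇒> r≰t
    cut : ∀ {Z κ} → Cut (suc t) e Z κ
    cut = cut-now (λ i t<r → notYet i (≤-trans (n≤1+n t) t<r)) (λ i al _ → inj₁ (late al))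

  Backed-tail : ∀ {t e ns a} σ → Backed t e ns (a ∷ σ) → Backed t e ns σ
  Backed-tail {a = base , _} σ (_ , b) = b
  Backed-tail {a = side , _} σ b       = b

  Backed-⊆ : ∀ {t e ns ns′} σ → (∀ {i} → i ∈ ns′ → i ∈ ns) → Backed t e ns σ → Backed t e ns′ σ
  Backed-⊆ []               ⊆ b = tt
  Backed-⊆ ((side , x) ∷ σ) ⊆ b = Backed-⊆ σ ⊆ b
  Backed-⊆ ((base , x) ∷ σ) ⊆ ((f , al , f∉ , r) , b) = (f , al , f∉ ∘ ⊆ , r) , Backed-⊆ σ ⊆ b

  Cuts-tail : ∀ {t e a} σ → Cuts t e (a ∷ σ) → Cuts t e σ
  Cuts-tail {a = base , _} σ (_ , c) = c
  Cuts-tail {a = side , _} σ c       = c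

  poppedExceptions : Kind → ℕ → (ℕ → List Job) → ℕ → List Job
  poppedExceptions base l X = override l (X l) X
  poppedExceptions side l X = X

  keep-top : ∀ {t e X κ x σ} → After t e X ((κ , x) ∷ σ) →
    Alive t e (name x) → ph (name x) (e (name x)) ≡ phase x → Before t e X ((κ , x) ∷ σ)
  keep-top {e = e} {x = x} (ran {e₀ = e₀} core ens r≤ eq leq peq _) al ph≡ = record
    { core = core
    ; entries = (al , trans leq (trans (sym Λ≡) (cong (Λ (name x)) (sym eq))) , sym ph≡) ∷ ens }
    where
    Λ≡ : Λ (name x) (suc e₀) ≡ Λ (name x) e₀
    Λ≡ = Λ-phase (name x) e₀ (trans (cong (ph (name x)) (sym eq)) (trans ph≡ peq))

  -- A job that leaves the stack unfinished has changed its phase with its last unit, so it is at a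
  -- break.
  pop-top : ∀ {t e X κ x σ} → After t e X ((κ , x) ∷ σ) →
    (Alive t e (name x) → ph (name x) (e (name x)) ≢ phase x) →
    Before t e (poppedExceptions κ (level x) X) σ
  pop-top {t} {e} {X} {κ} {x} {σ} (ran {e₀ = e₀} core ens r≤ eq leq peq below) done = record
    { core = record
        { notYet = notYet ; bounded = bounded ; others = others′
        ; sorted = tail sorted ; shape = Shape-tail shape
        ; backed = Backed-⊆ σ there (Backed-tail {a = κ , x} σ backed)
        ; cuts = Cuts-tail {a = κ , x} σ cuts ; bands = bands′ κ below }
    ; entries = ens }
    where
    open Core core
    tail : ∀ {a σ} → Sorted (a ∷ σ) → Sorted σ
    tail (_ ∷ s) = s
    others′ : ∀ i → Alive t e i → i ∈ names σ ⊎ Break i (e i)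
    others′ i al with others i al
    ... | inj₁ (here refl) = inj₂ (subst (Break i) (sym eq)
                               λ p → done al (trans (cong (ph i) eq) (trans p (sym peq))))
    ... | inj₁ (there p)   = inj₁ p
    ... | inj₂ brk         = inj₂ brk
    x<top : level x < top
    x<top = subst (_< top) (sym leq) (Λ<top _ _)
    bands′ : ∀ κ → (κ ≡ base → ∀ i → Alive t e i → Λ i (e i) < level x → t ≤ release i) →
      ∀ k → k < top → Band t e (poppedExceptions κ (level x) X) k
    bands′ side _ k k< = bands k k<
    bands′ base b k k< with k <? level x
    -- When the base was last run no unfinished job was below it, so those below it now were
    -- released at `t` or later and the inner cut starts at `t`.
    ... | yes k<l = band-merge k<l (bands (level x) x<top)
            (cut-now notYet (λ i al Λ< → inj₁ (b refl i al (<-≤-trans Λ< k<l))))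
    ... | no k≮l  = band-override-≥ (≮⇒≥ k≮l) (bands k k<)

  idle-before : ∀ {t e X} → After t e X [] → Before t e X []
  idle-before (idle core) = record { core = core ; entries = [] }

-- Decisions

_==_ : ∀ {n} → Fin n → Fin n → Bool
a == b = does (a Fin.≟ b)

module Decisions {n : ℕ} (release proc : Fin n → ℕ)
  (Λ : Fin n → ℕ → ℕ) (ph : Fin n → ℕ → Maybe ℕ)
  (Λ-mono : ∀ j {x y} → x ≤ y → Λ j x ≤ Λ j y)
  (Λ-phase : ∀ j x → ph j (suc x) ≡ ph j x → Λ j (suc x) ≡ Λ j x)
  (top : ℕ) (Λ<top : ∀ j x → Λ j x < top) where

  open Invariants release proc Λ ph Λ-mono Λ-phase top Λ<top public
  open Machine {Fin n} _==_ public

  lowest-≤ : ∀ x ys {c} → c ∈ x ∷ ys → level (lowest x ys) ≤ level c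
  lowest-≤ x []       (here refl) = ≤-refl
  lowest-≤ x (y ∷ ys) c∈ with level y <ᵇ level x in eq
  lowest-≤ x (y ∷ ys) (here refl) | true =
    ≤-trans (lowest-≤ y ys (here refl)) (<⇒≤ (<ᵇ⇒< (level y) (level x) (subst T (sym eq) tt)))
  lowest-≤ x (y ∷ ys) (there c∈)  | true = lowest-≤ y ys c∈
  lowest-≤ x (y ∷ ys) (here refl) | false = lowest-≤ x ys (here refl)
  lowest-≤ x (y ∷ ys) (there (here refl)) | false = ≤-trans (lowest-≤ x ys (here refl))
    (≮⇒≥ (λ y<x → subst T eq (<⇒<ᵇ y<x)))
  lowest-≤ x (y ∷ ys) (there (there c∈)) | false = lowest-≤ x ys (there c∈)

  lowest-∈ : ∀ x ys → lowest x ys ∈ x ∷ ys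
  lowest-∈ x []       = here refl
  lowest-∈ x (y ∷ ys) with level y <ᵇ level x
  ... | true  = there (lowest-∈ y ys)
  ... | false with lowest-∈ x ys
  ...   | here eq  = here eq
  ...   | there l∈ = there (there l∈)

  record Waiting (t : ℕ) (e : Job → ℕ) (σ : Stack Job) (W : List (Task Job)) : Set where
    field
      sound    : ∀ {c} → c ∈ W → Entry t e (base , c) × name c ∉ names σ × level c < bnd σ
      complete : ∀ i → Alive t e i → i ∉ names σ → Λ i (e i) < bnd σ → ∃[ c ] c ∈ W × name c ≡ i
      unique   : Unique (map name W)

  data Outcome (t : ℕ) (e : Job → ℕ) (σ : Stack Job) : Set where
    idles : ∀ {X} → σ ≡ [] → (∀ i → ¬ Alive t e i) → After (suc t) e X [] → Outcome t e σ
    runs  : ∀ j → current σ ≡ just j → Alive t e j →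
      (∀ e′ → Runs j e e′ → ∃[ X ] After (suc t) e′ X σ) → Outcome t e σ

  -- An unfinished job below `l` would be on the stack or, as `l` is at most `bnd σ`, waiting; both
  -- places hold only levels from `l` on.
  clean-from : ∀ {t e σ W l} → All (Entry t e) σ → All (λ a → l ≤ lv a) σ →
    Waiting t e σ W → l ≤ bnd σ → (∀ {c} → c ∈ W → l ≤ level c) → Clean t e l
  clean-from {t} {e} {σ} ens l≤ w l≤b l≤W i al Λ< with _∈?_ Fin._≟_ i (names σ)
  ... | yes i∈ = on ens l≤ i∈
    where
    on : ∀ {σ} → All (Entry t e) σ → All (λ a → _ ≤ lv a) σ → i ∈ names σ → ⊥
    on ((_ , leq , _) ∷ _) (l≤ ∷ _) (here refl) = <-irrefl refl (<-≤-trans Λ< (≤-trans l≤ (≤-reflexive leq)))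
    on (_ ∷ ens) (_ ∷ l≤) (there p) = on ens l≤ p
  ... | no i∉ with Waiting.complete w i al i∉ (<-≤-trans Λ< l≤b)
  ...   | c , c∈ , refl = <-irrefl refl (<-≤-trans Λ<
            (≤-trans (l≤W c∈) (≤-reflexive (proj₁ (proj₂ (proj₁ (Waiting.sound w c∈)))))))

  -- The witness for a new base: names of waiting tasks are distinct, so one of the first two tasks
  -- is not the chosen one.
  other : ∀ {t e σ x y ys} → Waiting t e σ (x ∷ y ∷ ys) → let m = lowest x (y ∷ ys) in
    ∃[ f ] Alive t e f × f ≢ name m × f ∉ names σ × level m ≤ Λ f (e f) × Λ f (e f) < bnd σ
  other {t} {e} {σ} {x} {y} {ys} w = pick (name m Fin.≟ name x)
    where
    m = lowest x (y ∷ ys)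
    pack : ∀ {c} → c ∈ x ∷ y ∷ ys → name c ≢ name m →
      ∃[ f ] Alive t e f × f ≢ name m × f ∉ names σ × level m ≤ Λ f (e f) × Λ f (e f) < bnd σ
    pack {c} c∈ ≢m = let (al , leq , _) , ∉σ , <b = Waiting.sound w c∈ in
      name c , al , ≢m , ∉σ , subst (level m ≤_) leq (lowest-≤ x (y ∷ ys) c∈) , subst (_< bnd σ) leq <b
    x≢y : name x ≢ name y
    x≢y with Waiting.unique w
    ... | (≢y ∷ _) ∷ _ = ≢y
    pick : Dec (name m ≡ name x) → _
    pick (yes m≡x) = pack (there (here refl)) (λ y≡m → x≢y (trans (sym m≡x) (sym y≡m)))
    pick (no m≢x)  = pack (here refl) (λ x≡m → m≢x (sym x≡m))

  top-least : ∀ {a σ} → Sorted (a ∷ σ) → All (λ b → lv a ≤ lv b) (a ∷ σ)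
  top-least (a< ∷ _) = ≤-refl ∷ All.map <⇒≤ a<

  top≤bnd : ∀ κ {x σ} → level x < top → Sorted ((κ , x) ∷ σ) → level x ≤ bnd ((κ , x) ∷ σ)
  top≤bnd base         _ _        = ≤-refl
  top≤bnd side {x} {σ} x<top (x< ∷ _) = <⇒≤ (bnd-above σ x<top x<)

  again : ∀ {t e X κ x σ W} → Before t e X ((κ , x) ∷ σ) → Waiting t e ((κ , x) ∷ σ) W →
    (∀ {c} → c ∈ W → level x ≤ level c) → Outcome t e ((κ , x) ∷ σ)
  again {κ = κ} {x} b w x≤W with Before.entries b
  ... | (al , leq , _) ∷ _ = runs (name x) refl al λ e′ r → _ , run-top b r
    (clean-from (Before.entries b) (top-least (Before.sorted b)) w
      (top≤bnd κ (level<top x leq) (Before.sorted b)) x≤W)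

  fresh-task : ∀ {t e X κ c σ W} → Before t e X σ → Waiting t e σ W → c ∈ W →
    (∀ {d} → d ∈ W → level c ≤ level d) → All (λ a → level c < lv a) σ → Shape ((κ , c) ∷ σ) →
    (κ ≡ base → ∃[ f ] Alive t e f × f ≢ name c × f ∉ names σ × level c ≤ Λ f (e f) × Λ f (e f) < bnd σ) →
    Outcome t e ((κ , c) ∷ σ)
  fresh-task {κ = κ} {c} b w c∈ c≤ c< sh back =
    let (al , leq , peq) , ∉σ , <b = Waiting.sound w c∈ in
    runs (name c) refl al λ e′ r → _ , run-new {κ = κ} b r (al , leq , peq) ∉σ c< sh
      (clean-from (Before.entries b) (All.map <⇒≤ c<) w (<⇒≤ <b) c≤) back

  -- By `Shape` a base or nothing lies under the side task, so deeper jobs have levels from `bnd σ`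
  -- on. Below that, only the side task and the single waiting task remain.
  forced-step : ∀ {t e X v σ c} → Before t e X ((side , v) ∷ σ) → Waiting t e ((side , v) ∷ σ) (c ∷ []) →
    Outcome t e ((side , v) ∷ σ)
  forced-step {t} {e} {X} {v} {σ} {c} b w with Before.entries b
  ... | (al , leq , _) ∷ ens = runs (name v) refl al λ e′ r → _ , run-forced (name c) b r only
    where
    deep : ∀ {i} σ → Sorted σ → All (Entry t e) σ → Shape ((side , v) ∷ σ) → i ∈ names σ → bnd σ ≤ Λ i (e i)
    deep ((base , x) ∷ σ) (x< ∷ _) ((_ , leq , _) ∷ ens) _ (here refl) = ≤-reflexive leq
    deep {i} ((base , x) ∷ σ) (x< ∷ _) (_ ∷ ens) _ (there p) = below σ x< ens p
      where
      below : ∀ σ → All (λ a → level x < lv a) σ → All (Entry t e) σ → i ∈ names σ → level x ≤ Λ i (e i)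
      below (_ ∷ σ) (x< ∷ _) ((_ , leq , _) ∷ _) (here refl) = ≤-trans (<⇒≤ x<) (≤-reflexive leq)
      below (_ ∷ σ) (_ ∷ x<) (_ ∷ ens) (there p) = below σ x< ens p
    deep ((side , x) ∷ σ) _ _ () _
    sσ : Sorted σ
    sσ with Before.sorted b
    ... | _ ∷ s = s
    only : ∀ i → Alive t e i → Λ i (e i) < bnd σ → i ∈ name c ∷ name v ∷ []
    only i ali Λ< with _∈?_ Fin._≟_ i (names ((side , v) ∷ σ))
    ... | yes (here refl) = there (here refl)
    ... | yes (there p)   = ⊥-elim (<-irrefl refl (<-≤-trans Λ< (deep σ sσ ens (Before.shape b) p)))
    ... | no i∉ with Waiting.complete w i ali i∉ Λ<
    ...   | _ , here refl , refl = here refl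

  single : ∀ {c : Task Job} {d} → d ∈ c ∷ [] → level c ≤ level d
  single (here refl) = ≤-refl

  above-base : ∀ {t e X v σ l} → Before t e X ((base , v) ∷ σ) → l < level v →
    All (λ a → l < lv a) ((base , v) ∷ σ)
  above-base b l<v with Before.sorted b
  ... | v< ∷ _ = l<v ∷ All.map (<-trans l<v) v<

  -- The clauses mirror those of `start`: idle, continue a clean top, push a clean task, or take the
  -- forced step.
  step : ∀ {t e X} σ W → Before t e X σ → Waiting t e σ W → Outcome t e (start σ W)
  step {t} {e} [] [] b w = idles refl dead (run-idle b dead)
    where
    dead : ∀ i → ¬ Alive t e i
    dead i al with Waiting.complete w i al (λ ()) (Λ<top i (e i))
    ... | _ , () , _
  step ((base , v) ∷ σ) [] b w = again b w (λ ())
  step ((side , v) ∷ σ) [] b w = again b w (λ ())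
  step [] (c ∷ []) b w = fresh-task b w (here refl) single [] on[] (λ ())
  step ((base , v) ∷ σ) (c ∷ []) b w =
    fresh-task b w (here refl) single
      (above-base b (proj₂ (proj₂ (Waiting.sound w (here refl))))) (onSide (Before.shape b)) (λ ())
  step ((side , v) ∷ σ) (c ∷ []) b w = forced-step b w
  step [] (x ∷ y ∷ ys) b w =
    fresh-task b w (lowest-∈ x (y ∷ ys)) (lowest-≤ x (y ∷ ys)) [] (onBase empty) (λ _ → other w)
  step ((base , v) ∷ σ) (x ∷ y ∷ ys) b w =
    fresh-task b w (lowest-∈ x (y ∷ ys)) (lowest-≤ x (y ∷ ys))
      (above-base b (proj₂ (proj₂ (Waiting.sound w (lowest-∈ x (y ∷ ys))))))
      (onBase (Before.shape b)) (λ _ → other w)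
  step ((side , v) ∷ σ) (x ∷ y ∷ ys) b w
    with level (lowest x (y ∷ ys)) <ᵇ level v in eq
  -- Even the lowest waiting task is not below the side task, so continuing the side task is clean.
  ... | false = again b w (λ c∈ → ≤-trans
          (≮⇒≥ (λ m<v → subst T eq (<⇒<ᵇ m<v))) (lowest-≤ x (y ∷ ys) c∈))
  ... | true  = fresh-task b w (lowest-∈ x (y ∷ ys)) (lowest-≤ x (y ∷ ys))
          (m<v ∷ deeper) (onBase (Before.shape b)) (λ _ → other w)
    where
    m<v = <ᵇ⇒< (level (lowest x (y ∷ ys))) (level v) (subst T (sym eq) tt)
    deeper : All (λ a → level (lowest x (y ∷ ys)) < lv a) σ
    deeper with Before.sorted b
    ... | v< ∷ _ = All.map (<-trans m<v) v<

-- Counting unfinished jobs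

count-members : ∀ {n} (ns : List (Fin n)) → ∑ (allFin n) (λ j → _∈?_ Fin._≟_ j ns ⊳ 1) ≤ length ns
count-members {n} [] = ≤-trans (∑-mono (allFin n) {g = λ _ → 0} (λ j → z≤n)) (≤-reflexive (∑-0 (allFin n)))
count-members {n} (k ∷ ns) = begin
  ∑ (allFin n) (λ j → _∈?_ Fin._≟_ j (k ∷ ns) ⊳ 1)
    ≤⟨ ∑-mono (allFin n) pointwise ⟩
  ∑ (allFin n) (λ j → (j Fin.≟ k) ⊳ 1 + _∈?_ Fin._≟_ j ns ⊳ 1)
    ≡⟨ ∑-+ (allFin n) _ _ ⟩
  ∑ (allFin n) (λ j → (j Fin.≟ k) ⊳ 1) + ∑ (allFin n) (λ j → _∈?_ Fin._≟_ j ns ⊳ 1)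
    ≤⟨ +-mono-≤ (once k) (count-members ns) ⟩
  suc (length ns) ∎
  where
  open ≤-Reasoning
  pointwise : ∀ j → _∈?_ Fin._≟_ j (k ∷ ns) ⊳ 1 ≤ (j Fin.≟ k) ⊳ 1 + _∈?_ Fin._≟_ j ns ⊳ 1
  pointwise j = ⊳-⊎ (_∈?_ Fin._≟_ j (k ∷ ns)) (j Fin.≟ k) (_∈?_ Fin._≟_ j ns)
    (λ { (here eq) → inj₁ eq ; (there j∈) → inj₂ j∈ }) 1
  once : ∀ {n} (k : Fin n) → ∑ (allFin n) (λ j → (j Fin.≟ k) ⊳ 1) ≤ 1
  once {suc n} k = ≤-trans (≤-reflexive (cong (λ z → (Fin.zero Fin.≟ k) ⊳ 1 + z) (shift k))) (split k)
    where
    shift : ∀ k → ∑ (tabulate Fin.suc) (λ j → (j Fin.≟ k) ⊳ 1)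
                ≡ ∑ (allFin n) (λ j → (Fin.suc j Fin.≟ k) ⊳ 1)
    shift k = cong sum (trans (map-tabulate Fin.suc (λ j → (j Fin.≟ k) ⊳ 1))
      (sym (map-tabulate (λ j → j) (λ j → (Fin.suc j Fin.≟ k) ⊳ 1))))
    split : ∀ k → (Fin.zero Fin.≟ k) ⊳ 1 + ∑ (allFin n) (λ j → (Fin.suc j Fin.≟ k) ⊳ 1) ≤ 1
    split Fin.zero    = ≤-reflexive (cong suc (trans (∑-cong (allFin n) {g = λ _ → 0} (λ j → refl)) (∑-0 (allFin n))))
    split (Fin.suc k) = ≤-trans (≤-reflexive (∑-cong (allFin n) same)) (once k)
      where
      same : ∀ j → (Fin.suc j Fin.≟ Fin.suc k) ⊳ 1 ≡ (j Fin.≟ k) ⊳ 1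
      same j with j Fin.≟ k
      ... | yes _ = refl
      ... | no _  = refl

module Competitive {n : ℕ} (release proc : Fin n → ℕ)
  (Λ : Fin n → ℕ → ℕ) (ph : Fin n → ℕ → Maybe ℕ)
  (Λ-mono : ∀ j {x y} → x ≤ y → Λ j x ≤ Λ j y)
  (Λ-phase : ∀ j x → ph j (suc x) ≡ ph j x → Λ j (suc x) ≡ Λ j x)
  (top : ℕ) (Λ<top : ∀ j x → Λ j x < top) where

  open Decisions release proc Λ ph Λ-mono Λ-phase top Λ<top public

  Alive? : ∀ t e j → Dec (Alive t e j)
  Alive? t e j = (release j ≤? t) ×-dec (e j <? proc j)

  _∈J?_ : ∀ (j : Job) js → Dec (j ∈ js)
  _∈J?_ = _∈?_ Fin._≟_

  alive# : ℕ → (Job → ℕ) → ℕ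
  alive# t e = ∑ jobs (λ j → Alive? t e j ⊳ 1)

  bases : Stack Job → ℕ
  bases []               = 0
  bases ((base , x) ∷ σ) = suc (bases σ)
  bases ((side , x) ∷ σ) = bases σ

  mutual
    length-bases : ∀ {σ} → Shape σ → length σ ≤ suc (2 * bases σ)
    length-bases empty            = z≤n
    length-bases {_ ∷ _} (onBase s) = m≤n⇒m≤1+n (length-base s)
    length-bases on[]             = ≤-refl
    length-bases (onSide (onBase s)) = s≤s (length-base s)

    length-base : ∀ {σ} → Shape σ → suc (length σ) ≤ 2 * suc (bases σ)
    length-base {σ} s = ≤-trans (s≤s (length-bases s)) (≤-reflexive (sym (*-suc 2 (bases σ))))

  cut-top : ∀ {t e} σ → Cuts t e σ → Cut t e [] top
  cut-top []               c        = c
  cut-top ((base , x) ∷ σ) (_ , cs) = cut-top σ cs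
  cut-top ((side , x) ∷ σ) cs       = cut-top σ cs

  module _ {t : ℕ} {e : Job → ℕ} where

    Idle? : ∀ (ns : List Job) l j → Dec (Alive t e j × j ∉ ns × l ≤ Λ j (e j))
    Idle? ns l j = Alive? t e j ×-dec (¬? (j ∈J? ns) ×-dec (l ≤? Λ j (e j)))

    -- The witness of the topmost base is below the bound of the rest of the stack, so it was not
    -- counted for any deeper base.
    bases-≤ : ∀ ns σ → Backed t e ns σ → bases σ ≤ ∑ jobs (λ j → Idle? ns (bnd σ) j ⊳ 1)
    bases-≤ ns []               b = z≤n
    bases-≤ ns ((side , x) ∷ σ) b = bases-≤ ns σ b
    bases-≤ ns ((base , x) ∷ σ) ((f , al , f∉ , lo , hi) , b) =
      ≤-trans (s≤s (bases-≤ ns σ b)) (∑-strict jobs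
        (λ j → ⊳-mono-→ (Idle? ns (bnd σ) j) (Idle? ns (level x) j)
          (λ { (a , j∉ , b≤) → a , j∉ , ≤-trans (≤-trans lo (<⇒≤ hi)) b≤ }) ≤-refl)
        (∈-allFin f)
        (subst₂ _<_ (sym (⊳-no (Idle? ns (bnd σ) f) (λ { (_ , _ , b≤) → <-irrefl refl (<-≤-trans hi b≤) }) 1))
                    (sym (⊳-yes (Idle? ns (level x) f) (al , f∉ , lo) 1)) (s≤s z≤n)))

  -- Comparison with another schedule at a fixed time

  module Versus {t e X σ} (b : Before t e X σ) (eO : Job → ℕ)
    (slow : ∀ s → s ≤ t → s + ∑ jobs (λ j → (s ≤? release j) ⊳ eO j) ≤ t) where

    open Before b

    M : Job → Set
    M = Alive t eO

    M? : ∀ j → Dec (M j)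
    M? = Alive? t eO

    Left : ℕ → Job → Set
    Left s j = s ≤ release j × Alive t e j × ¬ M j

    Left? : ∀ s j → Dec (Left s j)
    Left? s j = (s ≤? release j) ×-dec (Alive? t e j ×-dec ¬? (M? j))

    Owed? : ∀ s j → Dec (s ≤ release j × M j)
    Owed? s j = (s ≤? release j) ×-dec M? j

    module _ {Z κ} (c : Cut t e Z κ) where
      open Cut c

      private
        -- If the other schedule has finished the job, then `eO j` is at least `proc j` and covers
        -- both the work done and the work left; otherwise the job is owed and covers its own work.
        pointwise : ∀ j → (since ≤? release j) ⊳ e j + Left? since j ⊳ (proc j ∸ e j)
                        ≤ Owed? since j ⊳ e j + (since ≤? release j) ⊳ eO j
        pointwise j with since ≤? release j
        ... | no _ = z≤n
        ... | yes s≤r with M? j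
        ...   | yes _ with Alive? t e j
        ...     | yes _ = ≤-trans (≤-reflexive (+-identityʳ (e j))) (m≤m+n (e j) _)
        ...     | no _  = ≤-trans (≤-reflexive (+-identityʳ (e j))) (m≤m+n (e j) _)
        pointwise j | yes s≤r | no ¬m with Alive? t e j
        ...     | yes (r≤t , e<p) = ≤-trans (≤-reflexive (m+[n∸m]≡n (<⇒≤ e<p))) (≮⇒≥ (λ eO<p → ¬m (r≤t , eO<p)))
        ...     | no ¬al with release j ≤? t
        ...       | no r≰t  = ≤-trans (≤-reflexive (trans (+-identityʳ (e j)) (notYet j (<⇒≤ (≰⇒> r≰t))))) z≤n
        ...       | yes r≤t = ≤-trans (≤-reflexive (+-identityʳ (e j)))
                    (≤-trans (bounded j) (≮⇒≥ (λ eO<p → ¬m (r≤t , eO<p))))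

      -- Since the cut, the work recorded by the algorithm fills the whole time, which is all that
      -- the other schedule can have used: `O ≤ E + S`. Adding the pointwise comparison
      -- `E + L ≤ W + O` and cancelling gives the bound.
      volume : ∑ jobs (λ j → Left? since j ⊳ (proc j ∸ e j))
             ≤ ∑ jobs (λ j → Owed? since j ⊳ e j) + ∑ Z (λ j → (K j (e j) <? κ) ⊳ e j)
      volume = +-cancelˡ-≤ (E + O) _ _ (begin
        E + O + L            ≡⟨ lem₁ E O L ⟩
        O + (E + L)          ≤⟨ +-mono-≤ O≤ EL≤ ⟩
        E + S + (W + O)      ≡⟨ lem₂ E S W O ⟩
        E + O + (W + S)      ∎)
        where
        open ≤-Reasoning
        E = ∑ jobs (λ j → (since ≤? release j) ⊳ e j)
        O = ∑ jobs (λ j → (since ≤? release j) ⊳ eO j)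
        L = ∑ jobs (λ j → Left? since j ⊳ (proc j ∸ e j))
        W = ∑ jobs (λ j → Owed? since j ⊳ e j)
        S = ∑ Z (λ j → (K j (e j) <? κ) ⊳ e j)
        lem₁ : ∀ E O L → E + O + L ≡ O + (E + L)
        lem₁ = solve-∀
        lem₂ : ∀ E S W O → E + S + (W + O) ≡ E + O + (W + S)
        lem₂ = solve-∀
        O≤ : O ≤ E + S
        O≤ = +-cancelˡ-≤ since _ _ (≤-trans (slow since since≤) work)
        EL≤ : E + L ≤ W + O
        EL≤ = ≤-trans (≤-reflexive (sym (∑-+ jobs _ _)))
          (≤-trans (∑-mono jobs pointwise) (≤-reflexive (∑-+ jobs _ _)))

    Kₑ : Job → ℕ
    Kₑ j = K j (e j)

    -- A job unfinished in the other schedule brings along the at most two exceptions of the band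
    -- where it was last processed. Repetitions are kept, so that each entry pays on its own.
    Ms sources : List Job
    Ms      = filter M? jobs
    sources = concatMap (λ j → j ∷ X (Kₑ j)) Ms

    m : ℕ
    m = alive# t eO

    length-Ms : length Ms ≡ m
    length-Ms = length-filter-∑ M? jobs

    length-sources : length sources ≤ 3 * m
    length-sources = begin
      length sources                             ≡⟨ sym (∑-1 sources) ⟩
      ∑ sources (λ _ → 1)                        ≡⟨ ∑-concatMap (λ j → j ∷ X (Kₑ j)) Ms (λ _ → 1) ⟩
      ∑ Ms (λ j → suc (∑ (X (Kₑ j)) (λ _ → 1)))  ≤⟨ ∑-mono Ms (λ j → s≤s (≤-trans (≤-reflexive (∑-1 (X (Kₑ j)))) (Band.small (bands (Kₑ j) (Λ<top j _))))) ⟩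
      ∑ Ms (λ _ → 3 * 1)                         ≡⟨ ∑-*ˡ Ms 3 (λ _ → 1) ⟩
      3 * ∑ Ms (λ _ → 1)                         ≡⟨ cong (3 *_) (trans (∑-1 Ms) length-Ms) ⟩
      3 * m                                      ∎
      where open ≤-Reasoning

    M⊆sources : ∀ {j} → M j → j ∈ sources
    M⊆sources {j} Mj = ∈-concatMap⁺ (λ j → j ∷ X (Kₑ j))
      (Any.map (λ { refl → here refl }) (∈-filter⁺ M? (∈-allFin j) Mj))

    X⊆sources : ∀ {j i} → M j → i ∈ X (Kₑ j) → i ∈ sources
    X⊆sources {j} Mj i∈ = ∈-concatMap⁺ (λ j → j ∷ X (Kₑ j))
      (Any.map (λ { refl → there i∈ }) (∈-filter⁺ M? (∈-allFin j) Mj))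

    Item : Job → Set
    Item j = Alive t e j × j ∉ names σ × j ∉ sources

    Item? : ∀ j → Dec (Item j)
    Item? j = Alive? t e j ×-dec (¬? (j ∈J? names σ) ×-dec ¬? (j ∈J? sources))

    module Level (k : ℕ) where

      At? : ∀ j → Dec (Item j × Λ j (e j) ≡ k)
      At? j = Item? j ×-dec (Λ j (e j) ≟ k)

      rem pay : Job → ℕ
      rem j = At? j ⊳ (proc j ∸ e j)
      pay j = (Kₑ j ≤? k) ⊳ e j

      private
        -- An item of level `k` is live for the cut. Not being a source, it is neither exceptional
        -- nor unfinished in the other schedule, so its remaining work is on the left of `volume`;
        -- `Kₑ≤` makes all owed work payable at level `k`.
        bound-by : ∀ {Z κ} (c : Cut t e Z κ) → k < κ →
          (∀ {i} → i ∈ Z → i ∈ sources) →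
          (∀ j → M j → 0 < e j → Kₑ j < κ → Kₑ j ≤ k) →
          ∑ jobs rem ≤ ∑ Ms pay + ∑ Z (λ j → (K j (e j) <? κ) ⊳ e j)
        bound-by {Z} {κ} c k<κ Z⊆ Kₑ≤ = ≤-trans (∑-mono jobs (λ j →
            ⊳-mono-→ (At? j) (Left? (Cut.since c) j) (left j) ≤-refl))
          (≤-trans (volume c) (+-monoˡ-≤ _ owed))
          where
          left : ∀ j → Item j × Λ j (e j) ≡ k → Left (Cut.since c) j
          left j ((al , _ , j∉) , refl) with Cut.live c j al k<κ
          ... | inj₁ s≤r = s≤r , al , λ Mj → j∉ (M⊆sources Mj)
          ... | inj₂ j∈Z = ⊥-elim (j∉ (Z⊆ j∈Z))
          owed : ∑ jobs (λ j → Owed? (Cut.since c) j ⊳ e j) ≤ ∑ Ms pay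
          owed = ≤-trans (∑-mono jobs pointwise) (≤-reflexive (sym (∑-filter M? jobs pay)))
            where
            pointwise : ∀ j → Owed? (Cut.since c) j ⊳ e j ≤ M? j ⊳ pay j
            pointwise j with Owed? (Cut.since c) j
            ... | no _ = z≤n
            ... | yes (s≤r , Mj) = ≤-trans paid (≤-reflexive (sym (⊳-yes (M? j) Mj (pay j))))
              where
              paid : e j ≤ pay j
              paid with e j ≟ 0
              ... | yes e≡0 = ≤-trans (≤-reflexive e≡0) z≤n
              ... | no e≢0  = ≤-reflexive (sym (⊳-yes (Kₑ j ≤? k)
                    (Kₑ≤ j Mj (n≢0⇒n>0 e≢0) (Cut.low c j s≤r (n≢0⇒n>0 e≢0))) (e j)))

        sources-split : ∑ sources pay ≡ ∑ Ms pay + ∑ Ms (λ j → ∑ (X (Kₑ j)) pay)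
        sources-split = trans (∑-concatMap (λ j → j ∷ X (Kₑ j)) Ms pay) (∑-+ Ms _ _)

      -- If a job unfinished in the other schedule was last processed at a level of
      -- the band above k, then the exceptional jobs of that band are sources and
      -- the inner cut applies.  Otherwise such jobs after the outer cut were last
      -- processed below k, and no exceptions are needed.
      paid-for : k < top → ∑ jobs rem ≤ ∑ sources pay
      paid-for k<top with Fin.any? (λ j → M? j ×-dec ((k ≤? Kₑ j) ×-dec (Kₑ j <? Band.hi (bands k k<top))))
      ... | yes (j , Mj , k≤ , <hi) = begin
        ∑ jobs rem
          ≤⟨ bound-by inner ≤-refl (λ i∈ → X⊆sources Mj (subst (_ ∈_) (sym X≡) i∈)) (λ _ _ _ → s≤s⁻¹) ⟩
        ∑ Ms pay + ∑ (X k) (λ i → (K i (e i) <? suc k) ⊳ e i)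
          ≤⟨ +-monoʳ-≤ (∑ Ms pay) (∑-mono (X k) (λ i → ⊳-mono-→ (K i (e i) <? suc k) (Kₑ i ≤? k) s≤s⁻¹ ≤-refl)) ⟩
        ∑ Ms pay + ∑ (X k) pay
          ≡⟨ cong (λ Z → ∑ Ms pay + ∑ Z pay) (sym X≡) ⟩
        ∑ Ms pay + ∑ (X (Kₑ j)) pay
          ≤⟨ +-monoʳ-≤ (∑ Ms pay) (∑-member Ms (λ j → ∑ (X (Kₑ j)) pay) (∈-filter⁺ M? (∈-allFin j) Mj)) ⟩
        ∑ Ms pay + ∑ Ms (λ j → ∑ (X (Kₑ j)) pay)
          ≡⟨ sym sources-split ⟩
        ∑ sources pay ∎
        where
        open ≤-Reasoning
        open Band (bands k k<top)
        X≡ : X (Kₑ j) ≡ X k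
        X≡ = same k≤ <hi
      ... | no none = begin
        ∑ jobs rem       ≤⟨ bound-by outer k<hi (λ ()) below ⟩
        ∑ Ms pay + 0     ≤⟨ +-monoʳ-≤ (∑ Ms pay) z≤n ⟩
        ∑ Ms pay + ∑ Ms (λ j → ∑ (X (Kₑ j)) pay) ≡⟨ sym sources-split ⟩
        ∑ sources pay ∎
        where
        open ≤-Reasoning
        open Band (bands k k<top)
        below : ∀ j → M j → 0 < e j → Kₑ j < hi → Kₑ j ≤ k
        below j Mj _ <hi with k ≤? Kₑ j
        ... | yes k≤ = ⊥-elim (none (j , Mj , k≤ , <hi))
        ... | no k≰  = <⇒≤ (≰⇒> k≰)

    -- Two ratios as pairs of naturals: after a change of information a job needs at least `α / β`
    -- times `2 ^ level` more, and the work done on a job is at most `δ / γ` times the power for its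
    -- last level. They will be ε/(2μ₁) and μ₂.
    module Bounds (α β γ δ : ℕ)
      (big  : ∀ j x → Break j x → x < proc j → α * 2 ^ Λ j x ≤ β * (proc j ∸ x))
      (done : ∀ j x → x < proc j → γ * suc x ≤ δ * 2 ^ Λ j x)
      (αγ≤βδ : α * γ ≤ β * δ) where

      private
        items : List Job
        items = filter Item? jobs

        spent : ∀ j → γ * e j ≤ δ * 2 ^ Kₑ j
        spent j with e j | bounded j
        ... | zero  | _   = ≤-trans (≤-reflexive (*-zeroʳ γ)) z≤n
        ... | suc x | x<p = done j x x<p

        levelBound : ∀ k → α * γ * (2 ^ k * ∑ (map (λ j → Λ j (e j)) items) (λ f → (f ≟ k) ⊳ 1))
                         ≤ β * δ * ∑ (map Kₑ sources) (λ s → (s ≤? k) ⊳ 2 ^ s)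
        levelBound k with k <? top
        ... | no k≮top = ≤-trans (≤-reflexive (trans (cong (λ z → α * γ * (2 ^ k * z)) none)
                (trans (cong (α * γ *_) (*-zeroʳ (2 ^ k))) (*-zeroʳ (α * γ))))) z≤n
          where
          none : ∑ (map (λ j → Λ j (e j)) items) (λ f → (f ≟ k) ⊳ 1) ≡ 0
          none = trans (∑-map (λ j → Λ j (e j)) items _) (trans (∑-cong items
            (λ j → ⊳-no (Λ j (e j) ≟ k) (λ eq → k≮top (subst (_< top) eq (Λ<top j (e j)))) 1)) (∑-0 items))
        ... | yes k<top = begin
          α * γ * (2 ^ k * ∑ (map (λ j → Λ j (e j)) items) (λ f → (f ≟ k) ⊳ 1))
            ≡⟨ cong (λ z → α * γ * (2 ^ k * z)) (trans (∑-map (λ j → Λ j (e j)) items _) (∑-filter Item? jobs _)) ⟩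
          α * γ * (2 ^ k * ∑ jobs (λ j → Item? j ⊳ ((Λ j (e j) ≟ k) ⊳ 1)))
            ≡⟨ lem₁ α γ (2 ^ k) _ ⟩
          γ * (α * 2 ^ k * ∑ jobs (λ j → Item? j ⊳ ((Λ j (e j) ≟ k) ⊳ 1)))
            ≡⟨ cong (γ *_) (sym (∑-*ˡ jobs (α * 2 ^ k) _)) ⟩
          γ * ∑ jobs (λ j → α * 2 ^ k * (Item? j ⊳ ((Λ j (e j) ≟ k) ⊳ 1)))
            ≤⟨ *-monoʳ-≤ γ (∑-mono jobs large) ⟩
          γ * ∑ jobs (λ j → β * rem j)
            ≡⟨ cong (γ *_) (∑-*ˡ jobs β rem) ⟩
          γ * (β * ∑ jobs rem)
            ≤⟨ *-monoʳ-≤ γ (*-monoʳ-≤ β (paid-for k<top)) ⟩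
          γ * (β * ∑ sources pay)
            ≡⟨ lem₂ γ β _ ⟩
          β * (γ * ∑ sources pay)
            ≡⟨ cong (β *_) (sym (∑-*ˡ sources γ pay)) ⟩
          β * ∑ sources (λ j → γ * pay j)
            ≤⟨ *-monoʳ-≤ β (∑-mono sources cheap) ⟩
          β * ∑ sources (λ j → δ * ((Kₑ j ≤? k) ⊳ 2 ^ Kₑ j))
            ≡⟨ cong (β *_) (∑-*ˡ sources δ _) ⟩
          β * (δ * ∑ sources (λ j → (Kₑ j ≤? k) ⊳ 2 ^ Kₑ j))
            ≡⟨ sym (*-assoc β δ _) ⟩
          β * δ * ∑ sources (λ j → (Kₑ j ≤? k) ⊳ 2 ^ Kₑ j)
            ≡⟨ cong (β * δ *_) (sym (∑-map Kₑ sources _)) ⟩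
          β * δ * ∑ (map Kₑ sources) (λ s → (s ≤? k) ⊳ 2 ^ s) ∎
          where
          open ≤-Reasoning
          open Level k
          lem₁ : ∀ α γ p c → α * γ * (p * c) ≡ γ * (α * p * c)
          lem₁ = solve-∀
          lem₂ : ∀ γ β c → γ * (β * c) ≡ β * (γ * c)
          lem₂ = solve-∀
          large : ∀ j → α * 2 ^ k * (Item? j ⊳ ((Λ j (e j) ≟ k) ⊳ 1)) ≤ β * rem j
          large j with Item? j | Λ j (e j) ≟ k
          ... | no _  | _ = ≤-trans (≤-reflexive (*-zeroʳ (α * 2 ^ k))) z≤n
          ... | yes _ | no _ = ≤-trans (≤-reflexive (*-zeroʳ (α * 2 ^ k))) z≤n
          ... | yes (al , j∉ , _) | yes refl with others j al
          ...   | inj₁ j∈  = ⊥-elim (j∉ j∈)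
          ...   | inj₂ brk = ≤-trans (≤-reflexive (*-identityʳ _)) (big j (e j) brk (proj₂ al))
          cheap : ∀ j → γ * pay j ≤ δ * ((Kₑ j ≤? k) ⊳ 2 ^ Kₑ j)
          cheap j with Kₑ j ≤? k
          ... | yes _ = spent j
          ... | no _  = ≤-trans (≤-reflexive (*-zeroʳ γ)) z≤n

        items-bound : α * γ * length items ≤ 2 * (β * δ) * length sources
        items-bound = subst₂ (λ x y → α * γ * x ≤ 2 * (β * δ) * y)
          (length-map (λ j → Λ j (e j)) items) (length-map Kₑ sources)
          (Charging.charging (α * γ) (β * δ) (map Kₑ sources) (map (λ j → Λ j (e j)) items) levelBound)

        F : ℕ
        F = ∑ jobs (λ j → (Alive? t e j ×-dec ¬? (j ∈J? names σ)) ⊳ 1)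

        F≤ : F ≤ length sources + length items
        F≤ = begin
          F ≤⟨ ∑-mono jobs pointwise ⟩
          ∑ jobs (λ j → (j ∈J? sources) ⊳ 1 + Item? j ⊳ 1) ≡⟨ ∑-+ jobs _ _ ⟩
          ∑ jobs (λ j → (j ∈J? sources) ⊳ 1) + ∑ jobs (λ j → Item? j ⊳ 1)
            ≤⟨ +-mono-≤ (count-members sources) (≤-reflexive (sym (length-filter-∑ Item? jobs))) ⟩
          length sources + length items ∎
          where
          open ≤-Reasoning
          pointwise : ∀ j → (Alive? t e j ×-dec ¬? (j ∈J? names σ)) ⊳ 1 ≤ (j ∈J? sources) ⊳ 1 + Item? j ⊳ 1
          pointwise j = ⊳-⊎ (Alive? t e j ×-dec ¬? (j ∈J? names σ)) (j ∈J? sources) (Item? j) split 1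
            where
            split : Alive t e j × j ∉ names σ → j ∈ sources ⊎ Item j
            split (al , j∉) with j ∈J? sources
            ... | yes j∈ = inj₁ j∈
            ... | no j∉′ = inj₂ (al , j∉ , j∉′)

        stack≤ : length σ ≤ suc (2 * F)
        stack≤ = ≤-trans (length-bases shape) (s≤s (*-monoʳ-≤ 2 (≤-trans (bases-≤ (names σ) σ backed)
          (∑-mono jobs (λ j → ⊳-mono-→ (Idle? {t} {e} (names σ) (bnd σ) j)
            (Alive? t e j ×-dec ¬? (j ∈J? names σ)) (λ { (al , j∉ , _) → al , j∉ }) ≤-refl)))))

        N = alive# t e

        N≤ : N ≤ length σ + F
        N≤ = begin
          N ≤⟨ ∑-mono jobs pointwise ⟩
          ∑ jobs (λ j → (j ∈J? names σ) ⊳ 1 + (Alive? t e j ×-dec ¬? (j ∈J? names σ)) ⊳ 1) ≡⟨ ∑-+ jobs _ _ ⟩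
          ∑ jobs (λ j → (j ∈J? names σ) ⊳ 1) + F
            ≤⟨ +-monoˡ-≤ F (≤-trans (count-members (names σ)) (≤-reflexive (length-map (name ∘ proj₂) σ))) ⟩
          length σ + F ∎
          where
          open ≤-Reasoning
          pointwise : ∀ j → Alive? t e j ⊳ 1 ≤ (j ∈J? names σ) ⊳ 1 + (Alive? t e j ×-dec ¬? (j ∈J? names σ)) ⊳ 1
          pointwise j = ⊳-⊎ (Alive? t e j) (j ∈J? names σ) (Alive? t e j ×-dec ¬? (j ∈J? names σ)) split 1
            where
            split : Alive t e j → j ∈ names σ ⊎ (Alive t e j × j ∉ names σ)
            split al with j ∈J? names σ
            ... | yes j∈ = inj₁ j∈
            ... | no j∉  = inj₂ (al , j∉)

        -- Each source counts once for itself and twice by the charging argument, and there are at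
        -- most `3 * m` sources: 9 = (1 + 2) * 3.
        αγF≤ : α * γ * F ≤ 9 * (β * δ * m)
        αγF≤ = begin
          α * γ * F ≤⟨ *-monoʳ-≤ (α * γ) F≤ ⟩
          α * γ * (length sources + length items) ≡⟨ *-distribˡ-+ (α * γ) (length sources) (length items) ⟩
          α * γ * length sources + α * γ * length items
            ≤⟨ +-mono-≤ (*-monoˡ-≤ (length sources) αγ≤βδ) items-bound ⟩
          β * δ * length sources + 2 * (β * δ) * length sources ≡⟨ lem₁ (β * δ) (length sources) ⟩
          3 * (β * δ) * length sources ≤⟨ *-monoʳ-≤ (3 * (β * δ)) length-sources ⟩
          3 * (β * δ) * (3 * m) ≡⟨ lem₂ (β * δ) m ⟩
          9 * (β * δ * m) ∎
          where
          open ≤-Reasoning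
          lem₁ : ∀ x y → x * y + 2 * x * y ≡ 3 * x * y
          lem₁ = solve-∀
          lem₂ : ∀ x y → 3 * x * (3 * y) ≡ 9 * (x * y)
          lem₂ = solve-∀

      -- If the other schedule had nothing unfinished, the cut at `top`, which has no exceptions,
      -- would leave no remaining work either.
      some : ∀ {i} → Alive t e i → 0 < m
      some {i} al with m ≟ 0
      ... | no m≢0  = n≢0⇒n>0 m≢0
      ... | yes m≡0 = ⊥-elim (<-irrefl refl (begin-strict
        0                             <⟨ m<n⇒0<n∸m (proj₂ al) ⟩
        proc i ∸ e i                  ≡⟨ sym (⊳-yes (Left? s i) (s≤r , al , ¬M) _) ⟩
        Left? s i ⊳ (proc i ∸ e i)    ≤⟨ ∑-member jobs _ (∈-allFin i) ⟩
        ∑ jobs (λ j → Left? s j ⊳ (proc j ∸ e j)) ≤⟨ volume c ⟩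
        ∑ jobs (λ j → Owed? s j ⊳ e j) + 0 ≡⟨ +-identityʳ _ ⟩
        ∑ jobs (λ j → Owed? s j ⊳ e j) ≡⟨ trans (∑-cong jobs (λ j → ⊳-no (Owed? s j) (dead j ∘ proj₂) _)) (∑-0 jobs) ⟩
        0 ∎))
        where
        open ≤-Reasoning
        c = cut-top σ cuts
        s = Cut.since c
        dead : ∀ j → ¬ M j
        dead j Mj = <-irrefl refl (<-≤-trans (s≤s z≤n) (≤-trans
          (≤-trans (≤-reflexive (sym (⊳-yes (M? j) Mj 1))) (∑-member jobs _ (∈-allFin j)))
          (≤-reflexive m≡0)))
        ¬M = dead i
        s≤r : s ≤ release i
        s≤r with Cut.live c i al (Λ<top i (e i))
        ... | inj₁ p = p

      -- The stack has at most `2 * F + 1` jobs, so `N ≤ 3 * F + 1` and 28 = 3 * 9 + 1; `some`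
      -- charges the additive 1 to `m`.
      local : α * γ * alive# t e ≤ 28 * (β * δ * m)
      local with Fin.any? (Alive? t e)
      ... | no none = ≤-trans (≤-reflexive (trans (cong (α * γ *_)
              (trans (∑-cong jobs (λ j → ⊳-no (Alive? t e j) (λ al → none (j , al)) 1)) (∑-0 jobs)))
              (*-zeroʳ (α * γ)))) z≤n
      ... | yes (i , al) = begin
        α * γ * N                     ≤⟨ *-monoʳ-≤ (α * γ) (≤-trans N≤ (+-monoˡ-≤ F stack≤)) ⟩
        α * γ * (suc (2 * F) + F)     ≡⟨ lem₁ (α * γ) F ⟩
        3 * (α * γ * F) + α * γ * 1   ≤⟨ +-mono-≤ (*-monoʳ-≤ 3 αγF≤) (*-mono-≤ αγ≤βδ (some al)) ⟩
        3 * (9 * (β * δ * m)) + β * δ * m ≡⟨ lem₂ (β * δ * m) ⟩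
        28 * (β * δ * m)              ∎
        where
        open ≤-Reasoning
        lem₁ : ∀ x F → x * (suc (2 * F) + F) ≡ 3 * (x * F) + x * 1
        lem₁ = solve-∀
        lem₂ : ∀ x → 3 * (9 * x) + x ≡ 28 * x
        lem₂ = solve-∀

-- Schedules, flow times and the run of the algorithm

module Levels {n} (threshold estimate : Fin n → ℕ) where

  hintAt : Fin n → ℕ → Maybe ℕ
  hintAt j x = if does (threshold j ≤? x) then just (estimate j) else nothing

  lev : Fin n → ℕ → ℕ
  lev j x = hintLevel (hintAt j x) x

  ph : Fin n → ℕ → Maybe ℕ
  ph j x = hintPhase (hintAt j x) x

  hinted : ∀ {j x} → threshold j ≤ x → hintAt j x ≡ just (estimate j)
  hinted {j} {x} q≤x = cong (λ b → if b then just (estimate j) else nothing) (dec-true (threshold j ≤? x) q≤x)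

  unhinted : ∀ {j x} → x < threshold j → hintAt j x ≡ nothing
  unhinted {j} {x} x<q = cong (λ b → if b then just (estimate j) else nothing)
    (dec-false (threshold j ≤? x) (<⇒≱ x<q))

  lev-hinted : ∀ {j x} → threshold j ≤ x → lev j x ≡ bits (estimate j) ⊔ bits x
  lev-hinted {x = x} q≤x = cong (λ h → hintLevel h x) (hinted q≤x)

  lev-unhinted : ∀ {j x} → x < threshold j → lev j x ≡ bits x
  lev-unhinted {x = x} x<q = cong (λ h → hintLevel h x) (unhinted x<q)

  ph-hinted : ∀ {j x} → threshold j ≤ x → ph j x ≡ nothing
  ph-hinted {x = x} q≤x = cong (λ h → hintPhase h x) (hinted q≤x)

  ph-unhinted : ∀ {j x} → x < threshold j → ph j x ≡ just (bits x)
  ph-unhinted {x = x} x<q = cong (λ h → hintPhase h x) (unhinted x<q)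

  bits≤lev : ∀ j x → bits x ≤ lev j x
  bits≤lev j x with threshold j ≤? x
  ... | yes q≤x = ≤-trans (m≤n⊔m (bits (estimate j)) (bits x)) (≤-reflexive (sym (lev-hinted q≤x)))
  ... | no q≰x  = ≤-reflexive (sym (lev-unhinted (≰⇒> q≰x)))

  lev-mono : ∀ j {x y} → x ≤ y → lev j x ≤ lev j y
  lev-mono j {x} {y} x≤y with threshold j ≤? x
  ... | yes q≤x = subst₂ _≤_ (sym (lev-hinted q≤x)) (sym (lev-hinted (≤-trans q≤x x≤y)))
                    (⊔-monoʳ-≤ (bits (estimate j)) (bits-mono x≤y))
  ... | no q≰x  = ≤-trans (≤-reflexive (lev-unhinted (≰⇒> q≰x))) (≤-trans (bits-mono x≤y) (bits≤lev j y))

  -- The level stays fixed once the estimate is known.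
  Λ : Fin n → ℕ → ℕ
  Λ j x = lev j (x ⊓ threshold j)

  Λ-mono : ∀ j {x y} → x ≤ y → Λ j x ≤ Λ j y
  Λ-mono j x≤y = lev-mono j (⊓-monoˡ-≤ (threshold j) x≤y)

  Λ-before : ∀ {j x} → x ≤ threshold j → Λ j x ≡ lev j x
  Λ-before {j} x≤q = cong (lev j) (m≤n⇒m⊓n≡m x≤q)

  Λ-after : ∀ {j x} → threshold j ≤ x → Λ j x ≡ bits (estimate j) ⊔ bits (threshold j)
  Λ-after {j} q≤x = trans (cong (lev j) (m≥n⇒m⊓n≡n q≤x)) (lev-hinted ≤-refl)

  -- Before the estimate is known the phase records the level, afterwards the level is constant, and
  -- the revelation itself changes the phase.
  Λ-phase : ∀ j x → ph j (suc x) ≡ ph j x → Λ j (suc x) ≡ Λ j x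
  Λ-phase j x eq with threshold j ≤? x
  ... | yes q≤x = trans (Λ-after (m≤n⇒m≤1+n q≤x)) (sym (Λ-after q≤x))
  ... | no q≰x with threshold j ≤? suc x
  ...   | yes q≤sx = case trans (sym (ph-hinted q≤sx)) (trans eq (ph-unhinted (≰⇒> q≰x))) of λ ()
  ...   | no q≰sx  = begin
    Λ j (suc x)   ≡⟨ Λ-before (<⇒≤ (≰⇒> q≰sx)) ⟩
    lev j (suc x) ≡⟨ lev-unhinted (≰⇒> q≰sx) ⟩
    bits (suc x)  ≡⟨ Maybe.just-injective (trans (sym (ph-unhinted (≰⇒> q≰sx))) (trans eq (ph-unhinted (≰⇒> q≰x)))) ⟩
    bits x        ≡⟨ sym (lev-unhinted (≰⇒> q≰x)) ⟩
    lev j x       ≡⟨ sym (Λ-before (<⇒≤ (≰⇒> q≰x))) ⟩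
    Λ j x         ∎
    where open ≡-Reasoning

  top : ℕ
  top = suc (∑ (allFin n) (λ j → bits (estimate j) ⊔ bits (threshold j)))

  Λ<top : ∀ j x → Λ j x < top
  Λ<top j x = s≤s (≤-trans (lev-mono j (m⊓n≤n x (threshold j)))
    (≤-trans (≤-reflexive (lev-hinted ≤-refl))
      (∑-member (allFin n) (λ j → bits (estimate j) ⊔ bits (threshold j)) (∈-allFin j))))

  -- The phase is `nothing` from the threshold on, so its last change happens there. Hence a job at
  -- a break still has at least an ε fraction of its work left.
  break-≤ : ∀ {j x} → (∀ {w} → x ≡ suc w → ph j (suc w) ≢ ph j w) → x ≤ threshold j
  break-≤ {j} {zero}  _ = z≤n
  break-≤ {j} {suc w} h with threshold j ≤? w
  ... | yes q≤w = ⊥-elim (h refl (trans (ph-hinted (m≤n⇒m≤1+n q≤w)) (sym (ph-hinted q≤w))))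
  ... | no q≰w  = ≰⇒> q≰w

-- Work and total flow time of a schedule

module Schedules (I : Instance) where
  open Instance I

  jobs′ : List Job
  jobs′ = allFin n

  timesIn-∷ : ∀ d ds j → timesIn (d ∷ ds) j ≡ (just j ≟ᴰ d) ⊳ 1 + timesIn ds j
  timesIn-∷ d ds j = trans (length-filter-∑ (just j ≟ᴰ_) (d ∷ ds))
    (cong ((just j ≟ᴰ d) ⊳ 1 +_) (sym (length-filter-∑ (just j ≟ᴰ_) ds)))

  module _ (S : Schedule) where

    el : ℕ → Job → ℕ
    el t j = elapsed S j t

    el-suc : ∀ t j → el (suc t) j ≡ (just j ≟ᴰ S t) ⊳ 1 + el t j
    el-suc t j = timesIn-∷ (S t) (applyDownFrom S t) j

    el-mono : ∀ j {s t} → s ≤ t → el s j ≤ el t j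
    el-mono j = step-mono (λ t → el t j) (λ t → ≤-trans (m≤n+m _ _) (≤-reflexive (sym (el-suc t j))))

    one-job : ∀ d → ∑ jobs′ (λ j → (just j ≟ᴰ d) ⊳ 1) ≤ 1
    one-job nothing  = ≤-trans (≤-reflexive (trans (∑-cong jobs′ (λ j → ⊳-no (just j ≟ᴰ nothing) (λ ()) 1)) (∑-0 jobs′))) z≤n
    one-job (just k) = ≤-trans (∑-mono jobs′ (λ j → ⊳-mono-→ (just j ≟ᴰ just k) (_∈?_ Fin._≟_ j (k ∷ []))
      (λ eq → here (Maybe.just-injective eq)) ≤-refl)) (count-members (k ∷ []))

    module _ (feasible : Feasible S) where

      el-notYet : ∀ t j → t ≤ release j → el t j ≡ 0
      el-notYet zero    j _   = refl
      el-notYet (suc t) j t<r = trans (el-suc t j)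
        (cong₂ _+_ (⊳-no (just j ≟ᴰ S t) (λ eq → <⇒≱ t<r (proj₁ (feasible t j (sym eq)))) 1)
                   (el-notYet t j (<⇒≤ t<r)))

      slow : ∀ {t} T → T ≤ t → T + ∑ jobs′ (λ j → (T ≤? release j) ⊳ el t j) ≤ t
      slow {t} T T≤t = go (≤⇒≤′ T≤t)
        where
        go : ∀ {t} → T ≤′ t → T + ∑ jobs′ (λ j → (T ≤? release j) ⊳ el t j) ≤ t
        go (≤′-reflexive refl) = ≤-reflexive (trans (cong (T +_) (trans (∑-cong jobs′ zero-before) (∑-0 jobs′))) (+-identityʳ T))
          where
          zero-before : ∀ j → (T ≤? release j) ⊳ el T j ≡ 0
          zero-before j with T ≤? release j
          ... | yes T≤r = el-notYet T j T≤r
          ... | no _    = refl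
        go {suc t} (≤′-step T≤t) = begin
          T + ∑ jobs′ (λ j → (T ≤? release j) ⊳ el (suc t) j)
            ≤⟨ +-monoʳ-≤ T (∑-mono jobs′ pointwise) ⟩
          T + ∑ jobs′ (λ j → (just j ≟ᴰ S t) ⊳ 1 + (T ≤? release j) ⊳ el t j)
            ≡⟨ cong (T +_) (∑-+ jobs′ _ _) ⟩
          T + (∑ jobs′ (λ j → (just j ≟ᴰ S t) ⊳ 1) + ∑ jobs′ (λ j → (T ≤? release j) ⊳ el t j))
            ≤⟨ +-monoʳ-≤ T (+-monoˡ-≤ _ (one-job (S t))) ⟩
          T + suc (∑ jobs′ (λ j → (T ≤? release j) ⊳ el t j))
            ≡⟨ +-suc T _ ⟩
          suc (T + ∑ jobs′ (λ j → (T ≤? release j) ⊳ el t j))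
            ≤⟨ s≤s (go T≤t) ⟩
          suc t ∎
          where
          open ≤-Reasoning
          pointwise : ∀ j → (T ≤? release j) ⊳ el (suc t) j ≤ (just j ≟ᴰ S t) ⊳ 1 + (T ≤? release j) ⊳ el t j
          pointwise j with T ≤? release j
          ... | yes _ = ≤-reflexive (el-suc t j)
          ... | no _  = z≤n

    unfinished : ℕ → ℕ
    unfinished t = ∑ jobs′ (λ j → ((release j ≤? t) ×-dec (el t j <? proc j)) ⊳ 1)

    -- A job is unfinished from its release until its completion, so exchanging sums counts
    -- unfinished jobs over time. `H` is free above all completion times, so two schedules can share
    -- it.
    flow-as-sum : ∀ {F} (flow : HasTotalFlow S F) H → (∀ j → proj₁ flow j ≤ H) →
      F ≡ ∑ (downFrom H) unfinished
    flow-as-sum (C , isC , refl) H C≤H = begin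
      ∑ jobs′ (λ j → C j ∸ release j)
        ≡⟨ ∑-cong jobs′ (λ j → sym (duration j H (C≤H j))) ⟩
      ∑ jobs′ (λ j → ∑ (downFrom H) (λ t → ((release j ≤? t) ×-dec (el t j <? proc j)) ⊳ 1))
        ≡⟨ ∑-swap jobs′ (downFrom H) _ ⟩
      ∑ (downFrom H) unfinished ∎
      where
      open ≡-Reasoning
      finished : ∀ j {t} → C j ≤ t → proc j ≤ el t j
      finished j C≤t = ≤-trans (m∸n≡0⇒m≤n (proj₁ (isC j))) (el-mono j C≤t)
      pending : ∀ j {t} → t < C j → el t j < proc j
      pending j {t} t<C = ≰⇒> (λ p≤ → <⇒≱ t<C (proj₂ (isC j) t (m≤n⇒m∸n≡0 p≤)))
      -- Truncating the completion time at `H` makes the claim provable by induction on `H`.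
      upto : ∀ j H → ∑ (downFrom H) (λ t → ((release j ≤? t) ×-dec (el t j <? proc j)) ⊳ 1)
                   ≡ (C j ⊓ H) ∸ release j
      upto j zero = sym (trans (cong (_∸ release j) (⊓-zeroʳ (C j))) (0∸n≡0 (release j)))
      upto j (suc H) = extend (C j ≤? H) (release j ≤? H)
        where
        active? = (release j ≤? H) ×-dec (el H j <? proc j)
        rest = ∑ (downFrom H) (λ t → ((release j ≤? t) ×-dec (el t j <? proc j)) ⊳ 1)
        rest-long : ¬ C j ≤ H → rest ≡ H ∸ release j
        rest-long C≰H = trans (upto j H) (cong (_∸ release j) (m≥n⇒m⊓n≡n (<⇒≤ (≰⇒> C≰H))))
        extend : Dec (C j ≤ H) → Dec (release j ≤ H) → active? ⊳ 1 + rest ≡ (C j ⊓ suc H) ∸ release j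
        extend (yes C≤H) _ = trans
          (cong₂ _+_ (⊳-no active? (λ { (_ , e<p) → <⇒≱ e<p (finished j C≤H) }) 1) (upto j H))
          (cong (_∸ release j) (trans (m≤n⇒m⊓n≡m C≤H) (sym (m≤n⇒m⊓n≡m (m≤n⇒m≤1+n C≤H)))))
        extend (no C≰H) (yes r≤H) = trans
          (cong₂ _+_ (⊳-yes active? (r≤H , pending j (≰⇒> C≰H)) 1) (rest-long C≰H))
          (trans (sym (+-∸-assoc 1 r≤H)) (cong (_∸ release j) (sym (m≥n⇒m⊓n≡n (≰⇒> C≰H)))))
        extend (no C≰H) (no r≰H) = trans
          (cong₂ _+_ (⊳-no active? (λ { (r≤ , _) → r≰H r≤ }) 1) (rest-long C≰H))
          (trans (m≤n⇒m∸n≡0 (<⇒≤ (≰⇒> r≰H)))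
            (sym (trans (cong (_∸ release j) (m≥n⇒m⊓n≡n (≰⇒> C≰H))) (m≤n⇒m∸n≡0 (≰⇒> r≰H)))))
      duration : ∀ j H → C j ≤ H → ∑ (downFrom H) (λ t → ((release j ≤? t) ×-dec (el t j <? proc j)) ⊳ 1)
                                 ≡ C j ∸ release j
      duration j H C≤H = trans (upto j H) (cong (_∸ release j) (m≤n⇒m⊓n≡m C≤H))

least : ∀ {P : ℕ → Set} → (∀ t → Dec (P t)) → ∀ t → P t → ∃[ c ] P c × (∀ s → P s → c ≤ s)
least P? zero    p = 0 , p , λ _ _ → z≤n
least {P} P? (suc t) p with P? 0
... | yes p₀ = 0 , p₀ , λ _ _ → z≤n
... | no ¬p₀ = let c , pc , min = least (P? ∘ suc) t p in suc c , pc , λ where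
  zero    p₀ → ⊥-elim (¬p₀ p₀)
  (suc s) ps → s≤s (min s ps)

-- The run of the algorithm on an instance

module World (I : Instance) where
  open Instance I
  open Levels threshold estimate
  open Schedules I
  open Competitive release proc Λ ph Λ-mono Λ-phase top Λ<top public hiding (Job)

  worldTask : List Decision → Job → Task Job
  worldTask past j = task j (lev j (timesIn past j)) (ph j (timesIn past j))

  liveJobs : List Decision → List Job
  liveJobs past = filterᵇ (λ j → not (does (proc j ≤? timesIn past j)))
    (filter (λ j → release j ≤? length past) (allFin n))

  live# : List Decision → List (Task Job)
  live# past = map (worldTask past) (liveJobs past)

  worldStack : List Decision → Stack Job
  worldStack []         = advance (live# []) []
  worldStack (d ∷ past) = advance (live# (d ∷ past)) (worldStack past)

  label-eq : ∀ a b → (label a ≡ᵇ label b) ≡ (a == b)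
  label-eq a b with a Fin.≟ b
  ... | yes refl = dec-true (label a ≟ label a) refl
  ... | no a≢b   = dec-false (label a ≟ label b) (a≢b ∘ label-injective)

  module Sim = Simulation _==_ _≡ᵇ_ label label-eq

  tasks-live# : ∀ past → tasks (snapshot I past) ≡ map Sim.r (live# past)
  tasks-live# past = begin
    map viewTask (filterᵇ (not ∘ JobView.completed) (map (view I past) released))
      ≡⟨ cong (map viewTask) (filterᵇ-map (view I past) _ released) ⟩
    map viewTask (map (view I past) (liveJobs past))
      ≡⟨ sym (map-∘ (liveJobs past)) ⟩
    map (viewTask ∘ view I past) (liveJobs past)
      ≡⟨ map-∘ (liveJobs past) ⟩
    map Sim.r (live# past) ∎
    where
    open ≡-Reasoning
    released = filter (λ j → release j ≤? length past) (allFin n)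

  stack-world : ∀ past → stack (history I past) ≡ Sim.rs (worldStack past)
  stack-world [] = trans (cong (λ cs → Machine.advance _≡ᵇ_ cs []) (tasks-live# []))
    (Sim.advance-r (live# []) [])
  stack-world (d ∷ past) = trans
    (cong₂ (Machine.advance _≡ᵇ_) (tasks-live# (d ∷ past)) (stack-world past))
    (Sim.advance-r (live# (d ∷ past)) (worldStack past))

  jobLabelled-label : ∀ j → jobLabelled I (label j) ≡ just j
  jobLabelled-label j with Fin.any? (λ i → label i ≟ label j)
  ... | yes (i , eq) = cong just (label-injective eq)
  ... | no none      = ⊥-elim (none (j , refl))

  past : ℕ → List Decision
  past = decisions I algorithm

  length-past : ∀ t → length (past t) ≡ t
  length-past zero    = refl
  length-past (suc t) = cong suc (length-past t)

  R : Schedule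
  R = run I algorithm

  R-current : ∀ t → R t ≡ current (worldStack (past t))
  R-current t = trans (cong (λ σ → Machine.current _≡ᵇ_ σ >>= jobLabelled I) (stack-world (past t)))
    (lem (worldStack (past t)))
    where
    lem : ∀ σ → (Machine.current _≡ᵇ_ (Sim.rs σ) >>= jobLabelled I) ≡ current σ
    lem []            = refl
    lem ((κ , x) ∷ σ) = jobLabelled-label (name x)

  past-R : ∀ t → past t ≡ applyDownFrom R t
  past-R zero    = refl
  past-R (suc t) = cong (R t ∷_) (past-R t)

  e : ℕ → Job → ℕ
  e t j = timesIn (past t) j

  e-suc : ∀ t j → e (suc t) j ≡ (just j ≟ᴰ R t) ⊳ 1 + e t j
  e-suc t = timesIn-∷ (R t) (past t)

  runs-e : ∀ {t j} → R t ≡ just j → Runs j (e t) (e (suc t))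
  runs-e {t} {j} Rt = trans (e-suc t j) (cong (_+ e t j) (⊳-yes (just j ≟ᴰ R t) (sym Rt) 1))
    , λ i i≢j → trans (e-suc t i) (cong (_+ e t i) (⊳-no (just i ≟ᴰ R t)
        (λ eq → i≢j (Maybe.just-injective (trans eq Rt))) 1))

  idle-e : ∀ {t} → R t ≡ nothing → ∀ j → e (suc t) j ≡ e t j
  idle-e {t} Rt j = trans (e-suc t j) (cong (_+ e t j) (⊳-no (just j ≟ᴰ R t)
    (λ eq → case trans eq Rt of λ ()) 1))

  ∈-live⁻ : ∀ {t j} → j ∈ liveJobs (past t) → Alive t (e t) j
  ∈-live⁻ {t} {j} j∈ with ∈-filter⁻ _ {xs = filter (λ j → release j ≤? length (past t)) (allFin n)} j∈
  ... | j∈′ , unf = subst (release j ≤_) (length-past t)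
        (proj₂ (∈-filter⁻ (λ j → release j ≤? length (past t)) {xs = allFin n} j∈′))
      , ≰⇒> (λ p≤ → subst (T ∘ not) (dec-true (proc j ≤? e t j) p≤) unf)

  ∈-live⁺ : ∀ {t j} → Alive t (e t) j → j ∈ liveJobs (past t)
  ∈-live⁺ {t} {j} (r≤ , e<p) = ∈-filter⁺ _
    (∈-filter⁺ (λ j → release j ≤? length (past t)) (∈-allFin j) (subst (release j ≤_) (sym (length-past t)) r≤))
    (subst (T ∘ not) (sym (dec-false (proc j ≤? e t j) (<⇒≱ e<p))) tt)

  under-bnd : ∀ σ {ℓ} → T (under σ ℓ) → ℓ < top → ℓ < bnd σ
  under-bnd []               _ ℓ< = ℓ<
  under-bnd ((base , x) ∷ σ) u _  = <ᵇ⇒< _ _ u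
  under-bnd ((side , x) ∷ σ) u ℓ< = under-bnd σ u ℓ<

  bnd-under : ∀ σ {ℓ} → ℓ < bnd σ → T (under σ ℓ)
  bnd-under []               _  = tt
  bnd-under ((base , x) ∷ σ) ℓ< = <⇒<ᵇ ℓ<
  bnd-under ((side , x) ∷ σ) ℓ< = bnd-under σ ℓ<

  ==⇒≡ : ∀ {a b : Job} → T (a == b) → a ≡ b
  ==⇒≡ {a} {b} t with a Fin.≟ b
  ... | yes eq = eq

  ≡⇒== : ∀ {a b : Job} → a ≡ b → T (a == b)
  ≡⇒== {a} {b} eq = subst T (sym (dec-true (a Fin.≟ b) eq)) tt

  started⁻ : ∀ σ {c} → T (started σ c) → name c ∈ names σ
  started⁻ σ {c} t = go σ (any⁻ _ σ t)
    where
    go : ∀ σ → Any.Any (λ x → T (name c == name (proj₂ x))) σ → name c ∈ names σ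
    go (x ∷ σ) (here t)  = here (==⇒≡ t)
    go (x ∷ σ) (there p) = there (go σ p)

  started⁺ : ∀ σ {c} → name c ∈ names σ → T (started σ c)
  started⁺ σ {c} c∈ = any⁺ _ (go σ c∈)
    where
    go : ∀ σ → name c ∈ names σ → Any.Any (λ x → T (name c == name (proj₂ x))) σ
    go (x ∷ σ) (here eq) = here (≡⇒== eq)
    go (x ∷ σ) (there p) = there (go σ p)

  T-not : ∀ {b} → T (not b) → ¬ T b
  T-not {false} _ ()

  not-T : ∀ {b} → ¬ T b → T (not b)
  not-T {false} _ = tt
  not-T {true}  h = h tt

  Break⇒≤ : ∀ {j x} → Break j x → x ≤ threshold j
  Break⇒≤ {j} {zero}  _   = z≤n
  Break⇒≤ {j} {suc w} brk = break-≤ {j} (λ { refl → brk })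

  waiting-spec : ∀ {t X σ} → Before t (e t) X σ → Waiting t (e t) σ (waiting (live# (past t)) σ)
  waiting-spec {t} {X} {σ} b = record
    { sound    = sound
    ; complete = complete
    ; unique   = unique
    }
    where
    p : Task Job → Bool
    p c = not (started σ c) ∧ under σ (level c)
    -- The algorithm computes levels from all work done, whereas `Λ` stops at the threshold; the two
    -- agree for jobs at a break.
    breaks : ∀ {i} → Alive t (e t) i → i ∉ names σ → Λ i (e t i) ≡ lev i (e t i)
    breaks {i} al i∉ with Before.others b i al
    ... | inj₁ i∈  = ⊥-elim (i∉ i∈)
    ... | inj₂ brk = Λ-before {i} (Break⇒≤ brk)
    sound : ∀ {c} → c ∈ waiting (live# (past t)) σ →
      Entry t (e t) (base , c) × name c ∉ names σ × level c < bnd σ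
    sound c∈ with ∈-filter⁻ _ {xs = live# (past t)} c∈
    ... | c∈′ , ok with ∈-map⁻ (worldTask (past t)) c∈′
    ...   | i , i∈ , refl = (al , leq , refl) , i∉
          , under-bnd σ (proj₂ ok′) (subst (_< top) (sym leq) (Λ<top i _))
      where
      al = ∈-live⁻ i∈
      ok′ = Equivalence.to (T-∧ {not (started σ (worldTask (past t) i))}) ok
      i∉ : i ∉ names σ
      i∉ i∈σ = T-not (proj₁ ok′) (started⁺ σ {worldTask (past t) i} i∈σ)
      leq = sym (breaks al i∉)
    complete : ∀ i → Alive t (e t) i → i ∉ names σ → Λ i (e t i) < bnd σ →
      ∃[ c ] c ∈ waiting (live# (past t)) σ × name c ≡ i
    complete i al i∉ Λ< = worldTask (past t) i
      , ∈-filter⁺ _ (∈-map⁺ (worldTask (past t)) (∈-live⁺ al))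
          (Equivalence.from T-∧ (not-T (λ s → i∉ (started⁻ σ {worldTask (past t) i} s))
            , bnd-under σ (subst (_< bnd σ) (breaks al i∉) Λ<)))
      , refl
    unique : Unique (map name (waiting (live# (past t)) σ))
    unique = subst Unique (sym eq) (Unique.filter⁺ _ (Unique.filter⁺ _ (Unique.filter⁺ _ (Unique.allFin⁺ n))))
      where
      eq : map name (waiting (live# (past t)) σ) ≡ filterᵇ (p ∘ worldTask (past t)) (liveJobs (past t))
      eq = trans (cong (map name) (filterᵇ-map (worldTask (past t)) p (liveJobs (past t))))
        (trans (sym (map-∘ _)) (trans (map-cong (λ _ → refl) _) (map-id _)))

  continues⁻ : ∀ t {x} → T (continues (live# (past t)) x) →
    Alive t (e t) (name x) × ph (name x) (e t (name x)) ≡ phase x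
  continues⁻ t {x} c = go (liveJobs (past t)) ∈-live⁻ (any⁻ _ (live# (past t)) c)
    where
    go : ∀ js → (∀ {j} → j ∈ js → Alive t (e t) j) →
      Any.Any (λ c → T ((name c == name x) ∧ samePhase (phase c) (phase x))) (map (worldTask (past t)) js) →
      Alive t (e t) (name x) × ph (name x) (e t (name x)) ≡ phase x
    go (j ∷ js) al (here ok) with Equivalence.to (T-∧ {j == name x}) ok
    ... | j= , ph= with ==⇒≡ {j} {name x} j=
    ...   | refl with Maybe.≡-dec _≟_ (ph j (e t j)) (phase x)
    ...     | yes eq = al (here refl) , eq
    go (j ∷ js) al (there p) = go js (al ∘ there) p

  continues⁺ : ∀ t {x} → Alive t (e t) (name x) → ph (name x) (e t (name x)) ≡ phase x →
    T (continues (live# (past t)) x)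
  continues⁺ t {x} al eq = any⁺ _ (Any.map (λ { refl → Equivalence.from T-∧
      (≡⇒== {name x} refl , subst T (sym (dec-true (Maybe.≡-dec _≟_ _ _) eq)) tt) })
    (∈-map⁺ (worldTask (past t)) (∈-live⁺ al)))

  pop-after : ∀ {t X} σ → After t (e t) X σ → ∃[ X′ ] Before t (e t) X′ (pop (live# (past t)) σ)
  pop-after [] a = _ , idle-before a
  pop-after {t} ((κ , x) ∷ σ) a with continues (live# (past t)) x in eq
  ... | true  = let al , ph≡ = continues⁻ t {x} (subst T (sym eq) tt) in _ , keep-top a al ph≡
  ... | false = _ , pop-top a (λ al ph≡ → subst T eq (continues⁺ t {x} al ph≡))

  -- The stack between popping and resuming, where the invariant is stated; at time 0 there is
  -- nothing to pop.
  pending : ℕ → Stack Job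
  pending zero    = []
  pending (suc t) = pop (live# (past (suc t))) (worldStack (past t))

  worldStack-pending : ∀ t → worldStack (past t) ≡ resume (live# (past t)) (pending t)
  worldStack-pending zero    = refl
  worldStack-pending (suc t) = refl

  outcome : ∀ {t X} → Before t (e t) X (pending t) → Outcome t (e t) (worldStack (past t))
  outcome {t} b = subst (Outcome t (e t)) (sym (worldStack-pending t)) (step (pending t) _ b (waiting-spec b))

  initial : ∃[ X ] Before 0 (e 0) X []
  initial = (λ _ → []) , record
    { core = record
        { notYet = λ _ _ → refl ; bounded = λ _ → z≤n ; others = λ _ _ → inj₂ tt
        ; sorted = [] ; shape = empty ; backed = tt ; cuts = cut
        ; bands = λ k k<top → record { hi = top ; k<hi = k<top ; same = λ _ _ → refl
            ; outer = cut ; inner = cut ; small = z≤n } }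
    ; entries = [] }
    where
    open import Data.List.Relation.Unary.AllPairs using ([])
    cut : ∀ {κ} → Cut 0 (e 0) [] κ
    cut = cut-now (λ _ _ → refl) (λ _ _ _ → inj₁ z≤n)

  -- After idling, the work functions of the two times agree only pointwise, so the invariant is
  -- transported field by field.
  After-cong : ∀ {t f g X} σ → (∀ j → f j ≡ g j) → σ ≡ [] → After t f X σ → After t g X σ
  After-cong {t} {f} {g} {X} .[] f≗g refl (idle core) = idle record
    { notYet = λ i t≤r → trans (sym (f≗g i)) (notYet i t≤r)
    ; bounded = λ i → subst (_≤ proc i) (f≗g i) (bounded i)
    ; others = λ i al → inj₂ (subst (Break i) (f≗g i) (break i (alive al)))
    ; sorted = sorted ; shape = shape ; backed = tt ; cuts = cut′ cuts
    ; bands = λ k k<top → let open Band (bands k k<top) in record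
        { hi = hi ; k<hi = k<hi ; same = same ; outer = cut′ outer ; inner = cut′ inner ; small = small } }
    where
    open Core core
    alive : ∀ {i} → Alive t g i → Alive t f i
    alive {i} (r≤ , e<p) = r≤ , subst (_< proc i) (sym (f≗g i)) e<p
    break : ∀ i → Alive t f i → Break i (f i)
    break i al with others i al
    ... | inj₂ brk = brk
    cut′ : ∀ {Z κ} → Cut t f Z κ → Cut t g Z κ
    cut′ {Z} {κ} c = record
      { since = since ; since≤ = since≤
      ; work = subst (t ≤_) (cong (since +_) (cong₂ _+_
          (∑-cong jobs (λ j → cong ((since ≤? release j) ⊳_) (f≗g j)))
          (∑-cong Z (λ j → cong (λ x → (K j x <? κ) ⊳ x) (f≗g j))))) work
      ; low = λ j T≤r 0<g → subst (λ x → K j x < κ) (f≗g j) (low j T≤r (subst (0 <_) (sym (f≗g j)) 0<g))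
      ; live = λ i al Λ< → live i (alive al) (subst (λ x → Λ i x < κ) (sym (f≗g i)) Λ<) }
      where open Cut c

  invariant : ∀ t → ∃[ X ] Before t (e t) X (pending t)
  invariant zero    = initial
  invariant (suc t) with invariant t
  ... | X , b with outcome {t} b
  ...   | idles σ≡[] _ a = pop-after (worldStack (past t))
            (After-cong (worldStack (past t)) (λ j → sym (idle-e {t} R≡ j)) σ≡[] (subst (After (suc t) (e t) _) (sym σ≡[]) a))
    where
    R≡ : R t ≡ nothing
    R≡ = trans (R-current t) (cong current σ≡[])
  ...   | runs j cur al after = pop-after (worldStack (past t))
            (proj₂ (after (e (suc t)) (runs-e {t} (trans (R-current t) cur))))

  el-e : ∀ t j → el R t j ≡ e t j
  el-e t j = cong (λ ds → timesIn ds j) (sym (past-R t))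

  R-feasible : Feasible R
  R-feasible t j Rt with invariant t
  ... | X , b with outcome {t} b
  ...   | idles σ≡[] _ _ = case trans (sym Rt) (trans (R-current t) (cong current σ≡[])) of λ ()
  ...   | runs i cur (r≤ , e<p) _ with trans (sym Rt) (trans (R-current t) cur)
  ...     | refl = r≤ , m<n⇒0<n∸m (subst (_< proc j) (sym (el-e t j)) e<p)

  horizon : ℕ
  horizon = suc (∑ (allFin n) release + ∑ (allFin n) proc)

  -- At most `∑ proc` units can follow the cut at `top`, so at the horizon this cut starts after all
  -- releases; a job still unfinished would have to be released from it on.
  all-done : ∀ j → proc j ≤ el R horizon j
  all-done j = subst (proc j ≤_) (sym (el-e horizon j)) (≮⇒≥ not-alive)
    where
    X = proj₁ (invariant horizon)
    b = proj₂ (invariant horizon)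
    c = cut-top (pending horizon) (Before.cuts b)
    open Cut c
    late : ∑ (allFin n) release < since
    late = +-cancelʳ-≤ (∑ (allFin n) proc) _ _ (≤-trans work (+-monoʳ-≤ since
      (≤-trans (≤-reflexive (+-identityʳ _)) (∑-mono (allFin n) (λ j → ≤-trans (⊳-≤ (since ≤? release j) _) (Before.bounded b j))))))
    r< : release j < since
    r< = ≤-<-trans (∑-member (allFin n) release (∈-allFin j)) late
    not-alive : ¬ e horizon j < proc j
    not-alive e<p with live j (<⇒≤ (<-≤-trans r< since≤) , e<p) (Λ<top j _)
    ... | inj₁ T≤r = <⇒≱ r< T≤r

  completion : ∀ j → ∃[ c ] IsCompletionTime R j c
  completion j = least (λ t → remaining R j t ≟ 0) horizon (m≤n⇒m∸n≡0 (all-done j))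

  R-flow : ∃[ F ] HasTotalFlow R F
  R-flow = _ , proj₁ ∘ completion , proj₂ ∘ completion , refl

  module _ (α β γ δ : ℕ)
    (big  : ∀ j x → Break j x → x < proc j → α * 2 ^ Λ j x ≤ β * (proc j ∸ x))
    (done : ∀ j x → x < proc j → γ * suc x ≤ δ * 2 ^ Λ j x)
    (αγ≤βδ : α * γ ≤ β * δ) where

    flow-bound : ∀ {S F V} → HasTotalFlow R F → Feasible S → HasTotalFlow S V →
      α * γ * F ≤ 28 * (β * δ) * V
    flow-bound {S} {F} {V} flowR feasible flowS = begin
      α * γ * F
        ≡⟨ cong (α * γ *_) (flow-as-sum R flowR H (λ j → ≤-trans (∑-member (allFin n) _ (∈-allFin j)) (m≤m+n _ _))) ⟩
      α * γ * ∑ (downFrom H) (unfinished R)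
        ≡⟨ sym (∑-*ˡ (downFrom H) (α * γ) _) ⟩
      ∑ (downFrom H) (λ t → α * γ * unfinished R t)
        ≤⟨ ∑-mono (downFrom H) pointwise ⟩
      ∑ (downFrom H) (λ t → 28 * (β * δ) * unfinished S t)
        ≡⟨ ∑-*ˡ (downFrom H) (28 * (β * δ)) _ ⟩
      28 * (β * δ) * ∑ (downFrom H) (unfinished S)
        ≡⟨ cong (28 * (β * δ) *_) (sym (flow-as-sum S flowS H (λ j → ≤-trans (∑-member (allFin n) _ (∈-allFin j)) (m≤n+m _ _)))) ⟩
      28 * (β * δ) * V ∎
      where
      open ≤-Reasoning
      -- A common bound on the completion times of both schedules.
      H = ∑ (allFin n) (proj₁ flowR) + ∑ (allFin n) (proj₁ flowS)
      pointwise : ∀ t → α * γ * unfinished R t ≤ 28 * (β * δ) * unfinished S t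
      pointwise t = begin
        α * γ * unfinished R t ≡⟨ cong (α * γ *_) (∑-cong (allFin n) (λ j → cong (λ x → ((release j ≤? t) ×-dec (x <? proc j)) ⊳ 1) (el-e t j))) ⟩
        α * γ * alive# t (e t) ≤⟨ Versus.Bounds.local (proj₂ (invariant t)) (el S t) (slow S feasible) α β γ δ big done αγ≤βδ ⟩
        28 * (β * δ * unfinished S t) ≡⟨ sym (*-assoc 28 (β * δ) _) ⟩
        28 * (β * δ) * unfinished S t ∎

-- Rational and real parameters

-- ε = `x / y`, μ₁ = `a₁ / b₁` and μ₂ = `a₂ / b₂`, with all conditions of the model multiplied out.
module Parameters (I : Instance) (x y a₁ b₁ a₂ b₂ : ℕ)
  (under : ∀ j → b₂ * Instance.proc I j ≤ a₂ * Instance.estimate I j)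
  (over  : ∀ j → b₁ * Instance.estimate I j ≤ a₁ * Instance.proc I j)
  (early : ∀ j → y * Instance.threshold I j + x * Instance.proc I j ≤ y * Instance.proc I j)
  (x≤y : x ≤ y) (b₁≤a₁ : b₁ ≤ a₁) (b₂≤a₂ : b₂ ≤ a₂) where

  open Instance I
  open Levels threshold estimate
  open World I using (R; flow-bound)
  open Schedules I

  remains : ∀ j {z} → z ≤ threshold j → x * proc j ≤ y * (proc j ∸ z)
  remains j {z} z≤q = begin
    x * proc j                ≡⟨ sym (m+n∸m≡n (y * z) (x * proc j)) ⟩
    y * z + x * proc j ∸ y * z ≤⟨ ∸-monoˡ-≤ (y * z) (≤-trans (+-monoˡ-≤ (x * proc j) (*-monoʳ-≤ y z≤q)) (early j)) ⟩
    y * proc j ∸ y * z        ≡⟨ sym (*-distribˡ-∸ y (proc j) z) ⟩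
    y * (proc j ∸ z)          ∎
    where open ≤-Reasoning

  bits-bound : ∀ z {m} → z ≤ m → 1 ≤ m → 2 ^ bits z ≤ 2 * m
  bits-bound zero    _   1≤m = ≤-trans 1≤m (m≤m+n _ _)
  bits-bound (suc z) z≤m _   = ≤-trans (bits-≤ z) (*-monoʳ-≤ 2 z≤m)

  -- The power is at most twice the larger of the work done (or 1) and, once known, the estimate;
  -- these are at most `proc j` and μ₁ times `proc j`.
  small : ∀ j z → z < proc j → b₁ * 2 ^ lev j z ≤ 2 * (a₁ * proc j)
  small j z z<p = case′
    where
    open ≤-Reasoning
    via-elapsed : b₁ * 2 ^ bits z ≤ 2 * (a₁ * proc j)
    via-elapsed = begin
      b₁ * 2 ^ bits z    ≤⟨ *-mono-≤ b₁≤a₁ (bits-bound z (<⇒≤ z<p) (proc≥1 j)) ⟩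
      a₁ * (2 * proc j)  ≡⟨ lem a₁ (proc j) ⟩
      2 * (a₁ * proc j)  ∎
      where
      lem : ∀ a p → a * (2 * p) ≡ 2 * (a * p)
      lem = solve-∀
    via-estimate : b₁ * 2 ^ bits (estimate j) ≤ 2 * (a₁ * proc j)
    via-estimate = begin
      b₁ * 2 ^ bits (estimate j)  ≤⟨ *-monoʳ-≤ b₁ (bits-bound (estimate j) ≤-refl (estimate≥1 j)) ⟩
      b₁ * (2 * estimate j)       ≡⟨ lem b₁ (estimate j) ⟩
      2 * (b₁ * estimate j)       ≤⟨ *-monoʳ-≤ 2 (over j) ⟩
      2 * (a₁ * proc j)           ∎
      where
      lem : ∀ a p → a * (2 * p) ≡ 2 * (a * p)
      lem = solve-∀
    case′ : b₁ * 2 ^ lev j z ≤ 2 * (a₁ * proc j)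
    case′ with threshold j ≤? z
    ... | no q≰z = subst (λ l → b₁ * 2 ^ l ≤ _) (sym (lev-unhinted {j} (≰⇒> q≰z))) via-elapsed
    ... | yes q≤z with ⊔-sel (bits (estimate j)) (bits z)
    ...   | inj₁ eq = subst (λ l → b₁ * 2 ^ l ≤ _) (sym (trans (lev-hinted {j} q≤z) eq)) via-estimate
    ...   | inj₂ eq = subst (λ l → b₁ * 2 ^ l ≤ _) (sym (trans (lev-hinted {j} q≤z) eq)) via-elapsed

  big : ∀ j z → World.Break I j z → z < proc j → x * b₁ * 2 ^ Λ j z ≤ 2 * (y * a₁) * (proc j ∸ z)
  big j z brk z<p = begin
    x * b₁ * 2 ^ Λ j z            ≡⟨ cong (λ l → x * b₁ * 2 ^ l) (Λ-before {j} z≤q) ⟩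
    x * b₁ * 2 ^ lev j z          ≡⟨ *-assoc x b₁ _ ⟩
    x * (b₁ * 2 ^ lev j z)        ≤⟨ *-monoʳ-≤ x (small j z z<p) ⟩
    x * (2 * (a₁ * proc j))       ≡⟨ lem₁ x a₁ (proc j) ⟩
    2 * a₁ * (x * proc j)         ≤⟨ *-monoʳ-≤ (2 * a₁) (remains j z≤q) ⟩
    2 * a₁ * (y * (proc j ∸ z))   ≡⟨ lem₂ a₁ y (proc j ∸ z) ⟩
    2 * (y * a₁) * (proc j ∸ z)   ∎
    where
    open ≤-Reasoning
    z≤q = World.Break⇒≤ I {j} brk
    lem₁ : ∀ x a p → x * (2 * (a * p)) ≡ 2 * a * (x * p)
    lem₁ = solve-∀
    lem₂ : ∀ a y r → 2 * a * (y * r) ≡ 2 * (y * a) * r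
    lem₂ = solve-∀

  -- Before the estimate is known the level is the logarithm of the work itself. Later the work is
  -- at most `proc j`, hence at most μ₂ times the estimate, whose logarithm the level contains.
  done : ∀ j z → z < proc j → b₂ * suc z ≤ a₂ * 2 ^ Λ j z
  done j z z<p with threshold j ≤? z
  ... | no q≰z = *-mono-≤ b₂≤a₂ (subst (λ l → suc z ≤ 2 ^ l)
          (sym (trans (Λ-before {j} (<⇒≤ (≰⇒> q≰z))) (lev-unhinted {j} (≰⇒> q≰z)))) (bits-< z))
  ... | yes q≤z = begin
    b₂ * suc z                   ≤⟨ *-monoʳ-≤ b₂ z<p ⟩
    b₂ * proc j                  ≤⟨ under j ⟩
    a₂ * estimate j              ≤⟨ *-monoʳ-≤ a₂ (<⇒≤ (bits-< (estimate j))) ⟩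
    a₂ * 2 ^ bits (estimate j)   ≤⟨ *-monoʳ-≤ a₂ (^-monoʳ-≤ 2 (≤-trans (m≤m⊔n (bits (estimate j)) (bits (threshold j))) (≤-reflexive (sym (Λ-after {j} q≤z))))) ⟩
    a₂ * 2 ^ Λ j z               ∎
    where open ≤-Reasoning

  bound : ∀ {S F V} → HasTotalFlow R F → Feasible S → HasTotalFlow S V →
    x * b₁ * b₂ * F ≤ 56 * (y * a₁ * a₂) * V
  bound {V = V} flowR feasible flowS = ≤-trans
    -- The 2 in `2 * (y * a₁)` comes from rounding up to a power of two and turns 28 into 56.
    (flow-bound (x * b₁) (2 * (y * a₁)) b₂ a₂ big done
      (*-mono-≤ (≤-trans (*-mono-≤ x≤y b₁≤a₁) (m≤m+n _ _)) b₂≤a₂) flowR feasible flowS)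
    (≤-reflexive (lem (y * a₁) a₂ V))
    where
    lem : ∀ u a v → 28 * (2 * u * a) * v ≡ 56 * (u * a) * v
    lem = solve-∀

-- Natural numbers and fractions among the rationals

ι : ℕ → ℚ
ι k = ℤ.+ k ℚ./ 1

ι-toℚᵘ : ∀ k → ℚ.toℚᵘ (ι k) ℚᵘ.≃ ℚᵘ.mkℚᵘ (ℤ.+ k) 0
ι-toℚᵘ k = ℚ.toℚᵘ-fromℚᵘ (ℚᵘ.mkℚᵘ (ℤ.+ k) 0)

ι-* : ∀ k l → ι (k * l) ≡ ι k ℚ.* ι l
ι-* k l = ℚ.toℚᵘ-injective (ℚᵘ.≃-trans (ι-toℚᵘ (k * l)) (ℚᵘ.≃-sym
  (ℚᵘ.≃-trans (ℚ.toℚᵘ-homo-* (ι k) (ι l)) (ℚᵘ.≃-trans (ℚᵘ.*-cong (ι-toℚᵘ k) (ι-toℚᵘ l))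
    (ℚᵘ.*≡* (cong (ℤ._* ℤ.+ 1) (sym (ℤ.pos-* k l))))))))

ι-+ : ∀ k l → ι (k + l) ≡ ι k ℚ.+ ι l
ι-+ k l = ℚ.toℚᵘ-injective (ℚᵘ.≃-trans (ι-toℚᵘ (k + l)) (ℚᵘ.≃-sym
  (ℚᵘ.≃-trans (ℚ.toℚᵘ-homo-+ (ι k) (ι l)) (ℚᵘ.≃-trans (ℚᵘ.+-cong (ι-toℚᵘ k) (ι-toℚᵘ l))
    (ℚᵘ.*≡* (cong (ℤ._* ℤ.+ 1) (trans (cong₂ ℤ._+_ (ℤ.*-identityʳ (ℤ.+ k)) (ℤ.*-identityʳ (ℤ.+ l)))
      (sym (ℤ.pos-+ k l)))))))))

ι-mono : ∀ {k l} → k ≤ l → ι k ℚ.≤ ι l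
ι-mono {k} {l} k≤l = ℚ.toℚᵘ-cancel-≤ (ℚᵘ.≤-respˡ-≃ (ℚᵘ.≃-sym (ι-toℚᵘ k)) (ℚᵘ.≤-respʳ-≃ (ℚᵘ.≃-sym (ι-toℚᵘ l))
  (ℚᵘ.*≤* (ℤ.*-monoʳ-≤-nonNeg (ℤ.+ 1) (ℤ.+≤+ k≤l)))))

ι-cancel : ∀ {k l} → ι k ℚ.≤ ι l → k ≤ l
ι-cancel {k} {l} le with ℚᵘ.≤-respˡ-≃ (ι-toℚᵘ k) (ℚᵘ.≤-respʳ-≃ (ι-toℚᵘ l) (ℚ.toℚᵘ-mono-≤ le))
... | ℚᵘ.*≤* h = ℤ.drop‿+≤+ (subst₂ ℤ._≤_ (ℤ.*-identityʳ (ℤ.+ k)) (ℤ.*-identityʳ (ℤ.+ l)) h)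

fraction : ∀ r → 0ℚ ℚ.≤ r → ∃[ a ] ∃[ b ] 0 < b × r ℚ.* ι b ≡ ι a
fraction (ℚ.mkℚ (ℤ.+ a) d c) _ = a , suc d , s≤s z≤n , ℚ.toℚᵘ-injective
  (ℚᵘ.≃-trans (ℚ.toℚᵘ-homo-* (ℚ.mkℚ (ℤ.+ a) d c) (ι (suc d)))
  (ℚᵘ.≃-trans (ℚᵘ.*-cong (ℚᵘ.≃-refl {ℚᵘ.mkℚᵘ (ℤ.+ a) d}) (ι-toℚᵘ (suc d)))
  (ℚᵘ.≃-trans (ℚᵘ.*≡* (trans (ℤ.*-identityʳ _) (cong (ℤ.+ a ℤ.*_) (cong ℤ.+_ (sym (*-identityʳ (suc d)))))))
    (ℚᵘ.≃-sym (ι-toℚᵘ a)))))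
fraction (ℚ.mkℚ (ℤ.-[1+ a ]) d c) (ℚ.*≤* ())

private
  *-monoʳ : ∀ {p q} r → 0ℚ ℚ.≤ r → p ℚ.≤ q → p ℚ.* r ℚ.≤ q ℚ.* r
  *-monoʳ r 0≤r = ℚ.*-monoʳ-≤-nonNeg r {{ℚ.nonNegative 0≤r}}

  *-mono : ∀ {p q r s} → 0ℚ ℚ.≤ r → 0ℚ ℚ.≤ q → p ℚ.≤ q → r ℚ.≤ s → p ℚ.* r ℚ.≤ q ℚ.* s
  *-mono {q = q} {r} 0≤r 0≤q p≤q r≤s =
    ℚ.≤-trans (*-monoʳ r 0≤r p≤q) (ℚ.*-monoˡ-≤-nonNeg q {{ℚ.nonNegative 0≤q}} r≤s)

  0≤ι : ∀ k → 0ℚ ℚ.≤ ι k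
  0≤ι k = ι-mono {0} {k} z≤n

module Rational (I : Instance) (ε m₁ m₂ : ℚ)
  (0≤ε : 0ℚ ℚ.≤ ε) (ε≤1 : ε ℚ.≤ 1ℚ) (1≤m₁ : 1ℚ ℚ.≤ m₁) (1≤m₂ : 1ℚ ℚ.≤ m₂)
  (under : ∀ j → ι (Instance.proc I j) ℚ.≤ m₂ ℚ.* ι (Instance.estimate I j))
  (over  : ∀ j → ι (Instance.estimate I j) ℚ.≤ m₁ ℚ.* ι (Instance.proc I j))
  (early : ∀ j → ι (Instance.threshold I j) ℚ.+ ε ℚ.* ι (Instance.proc I j) ℚ.≤ ι (Instance.proc I j)) where

  open Instance I
  open ℚSolver.+-*-Solver

  private
    0≤1 : 0ℚ ℚ.≤ 1ℚ
    0≤1 = ℚ.<⇒≤ (ℚ.positive⁻¹ 1ℚ)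

    ×-ineq : ∀ a b r k l → r ℚ.* ι b ≡ ι a → ι k ℚ.≤ r ℚ.* ι l → b * k ≤ a * l
    ×-ineq a b r k l eq h = ι-cancel (begin
      ι (b * k)              ≡⟨ trans (cong ι (*-comm b k)) (ι-* k b) ⟩
      ι k ℚ.* ι b            ≤⟨ *-monoʳ (ι b) (0≤ι b) h ⟩
      r ℚ.* ι l ℚ.* ι b      ≡⟨ solve 3 (λ r l b → r :* l :* b := r :* b :* l) refl r (ι l) (ι b) ⟩
      r ℚ.* ι b ℚ.* ι l      ≡⟨ cong (ℚ._* ι l) eq ⟩
      ι a ℚ.* ι l            ≡⟨ sym (ι-* a l) ⟩
      ι (a * l)              ∎)
      where open ℚ.≤-Reasoning

    ≥1 : ∀ {a b r} → r ℚ.* ι b ≡ ι a → 1ℚ ℚ.≤ r → b ≤ a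
    ≥1 {a} {b} {r} eq h = ι-cancel (begin
      ι b            ≡⟨ sym (ℚ.*-identityˡ (ι b)) ⟩
      1ℚ ℚ.* ι b     ≤⟨ *-monoʳ (ι b) (0≤ι b) h ⟩
      r ℚ.* ι b      ≡⟨ eq ⟩
      ι a            ∎)
      where open ℚ.≤-Reasoning

  rational-bound : ∀ {S F V} → HasTotalFlow (run I algorithm) F → Feasible S → HasTotalFlow S V →
    ε ℚ.* ι F ℚ.≤ ι 56 ℚ.* m₁ ℚ.* m₂ ℚ.* ι V
  rational-bound {S} {F} {V} flowR feasible flowS
    with fraction ε 0≤ε | fraction m₁ (ℚ.≤-trans 0≤1 1≤m₁) | fraction m₂ (ℚ.≤-trans 0≤1 1≤m₂)
  ... | x , y , 0<y , eqε | a₁ , b₁ , 0<b₁ , eq₁ | a₂ , b₂ , 0<b₂ , eq₂ =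
    -- Both sides are multiplied by the common denominator `D` of the three parameters, which
    -- reduces the claim to natural numbers.
    ℚ.*-cancelʳ-≤-pos D {{positiveD}} (begin
      ε ℚ.* ι F ℚ.* D
        ≡⟨ cong (ε ℚ.* ι F ℚ.*_) D≡ ⟩
      ε ℚ.* ι F ℚ.* (ι y ℚ.* ι b₁ ℚ.* ι b₂)
        ≡⟨ solve 5 (λ e f y b c → e :* f :* (y :* b :* c) := e :* y :* b :* c :* f) refl ε (ι F) (ι y) (ι b₁) (ι b₂) ⟩
      ε ℚ.* ι y ℚ.* ι b₁ ℚ.* ι b₂ ℚ.* ι F
        ≡⟨ cong (λ z → z ℚ.* ι b₁ ℚ.* ι b₂ ℚ.* ι F) eqε ⟩
      ι x ℚ.* ι b₁ ℚ.* ι b₂ ℚ.* ι F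
        ≡⟨ sym (ι-*₄ x b₁ b₂ F) ⟩
      ι (x * b₁ * b₂ * F)
        ≤⟨ ι-mono (Parameters.bound I x y a₁ b₁ a₂ b₂
             (λ j → ×-ineq a₂ b₂ m₂ (proc j) (estimate j) eq₂ (under j)) (λ j → ×-ineq a₁ b₁ m₁ (estimate j) (proc j) eq₁ (over j)) early′
             x≤y (≥1 eq₁ 1≤m₁) (≥1 eq₂ 1≤m₂) flowR feasible flowS) ⟩
      ι (56 * (y * a₁ * a₂) * V)
        ≡⟨ trans (ι-* (56 * (y * a₁ * a₂)) V) (cong (ℚ._* ι V) (trans (ι-* 56 (y * a₁ * a₂))
             (cong (ι 56 ℚ.*_) (trans (ι-* (y * a₁) a₂) (cong (ℚ._* ι a₂) (ι-* y a₁)))))) ⟩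
      ι 56 ℚ.* (ι y ℚ.* ι a₁ ℚ.* ι a₂) ℚ.* ι V
        ≡⟨ cong₂ (λ u v → ι 56 ℚ.* (ι y ℚ.* u ℚ.* v) ℚ.* ι V) (sym eq₁) (sym eq₂) ⟩
      ι 56 ℚ.* (ι y ℚ.* (m₁ ℚ.* ι b₁) ℚ.* (m₂ ℚ.* ι b₂)) ℚ.* ι V
        ≡⟨ solve 7 (λ c y m b n d v → c :* (y :* (m :* b) :* (n :* d)) :* v := c :* m :* n :* v :* (y :* b :* d))
             refl (ι 56) (ι y) m₁ (ι b₁) m₂ (ι b₂) (ι V) ⟩
      ι 56 ℚ.* m₁ ℚ.* m₂ ℚ.* ι V ℚ.* (ι y ℚ.* ι b₁ ℚ.* ι b₂)
        ≡⟨ cong (ι 56 ℚ.* m₁ ℚ.* m₂ ℚ.* ι V ℚ.*_) (sym D≡) ⟩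
      ι 56 ℚ.* m₁ ℚ.* m₂ ℚ.* ι V ℚ.* D ∎)
    where
    open ℚ.≤-Reasoning
    D = ι (y * b₁ * b₂)
    D≡ : D ≡ ι y ℚ.* ι b₁ ℚ.* ι b₂
    D≡ = trans (ι-* (y * b₁) b₂) (cong (ℚ._* ι b₂) (ι-* y b₁))
    positiveD : ℚ.Positive D
    positiveD = ℚ.positive (ℚ.<-≤-trans (ℚ.positive⁻¹ 1ℚ)
      (ι-mono {1} {y * b₁ * b₂} (*-mono-≤ (*-mono-≤ 0<y 0<b₁) 0<b₂)))
    ι-*₄ : ∀ a b c d → ι (a * b * c * d) ≡ ι a ℚ.* ι b ℚ.* ι c ℚ.* ι d
    ι-*₄ a b c d = trans (ι-* (a * b * c) d) (cong (ℚ._* ι d)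
      (trans (ι-* (a * b) c) (cong (ℚ._* ι c) (ι-* a b))))
    early′ : ∀ j → y * threshold j + x * proc j ≤ y * proc j
    early′ j = ι-cancel (begin
      ι (y * threshold j + x * proc j)
        ≡⟨ trans (ι-+ (y * threshold j) (x * proc j)) (cong₂ ℚ._+_ (ι-* y (threshold j)) (ι-* x (proc j))) ⟩
      ι y ℚ.* ι (threshold j) ℚ.+ ι x ℚ.* ι (proc j)
        ≡⟨ cong (λ z → ι y ℚ.* ι (threshold j) ℚ.+ z ℚ.* ι (proc j)) (sym eqε) ⟩
      ι y ℚ.* ι (threshold j) ℚ.+ ε ℚ.* ι y ℚ.* ι (proc j)
        ≡⟨ solve 4 (λ y q e p → y :* q :+ e :* y :* p := (q :+ e :* p) :* y) refl (ι y) (ι (threshold j)) ε (ι (proc j)) ⟩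
      (ι (threshold j) ℚ.+ ε ℚ.* ι (proc j)) ℚ.* ι y
        ≤⟨ *-monoʳ (ι y) (0≤ι y) (early j) ⟩
      ι (proc j) ℚ.* ι y
        ≡⟨ trans (sym (ι-* (proc j) y)) (cong ι (*-comm (proc j) y)) ⟩
      ι (y * proc j) ∎)
    x≤y : x ≤ y
    x≤y = ι-cancel (begin
      ι x            ≡⟨ sym eqε ⟩
      ε ℚ.* ι y      ≤⟨ *-monoʳ (ι y) (0≤ι y) ε≤1 ⟩
      1ℚ ℚ.* ι y     ≡⟨ ℚ.*-identityˡ (ι y) ⟩
      ι y            ∎)

-- From rational to real parameters

uniform : ∀ {n} {P : Fin n → ℕ → Set} → (∀ j → ∃[ N ] (∀ k → N ≤ k → P j k)) →
  ∃[ N ] (∀ j k → N ≤ k → P j k)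
uniform {n} h = ∑ (allFin n) (proj₁ ∘ h) , λ j k N≤k →
  proj₂ (h j) k (≤-trans (∑-member (allFin n) (proj₁ ∘ h) (∈-allFin j)) N≤k)

-- At a large index `k` the hypotheses hold up to `δ`, so the rational bound applies exactly to
-- `e - δ`, `u₁ + δ` and `u₂ + δ`. Going back costs a factor 2 for each of them: 448 = 8 * 56.
competitive : (μ₁ μ₂ ε : ℝ) → 1ᴿ ≤ᴿ μ₁ → 1ᴿ ≤ᴿ μ₂ → 0ᴿ <ᴿ ε → ε ≤ᴿ 1ᴿ →
  ∀ (I : Instance) → InModel ε μ₁ μ₂ I → ∀ {S F V} →
  Instance.HasTotalFlow I (run I algorithm) F → Instance.Feasible I S → Instance.HasTotalFlow I S V →
  ε *ᴿ fromℕ F ≤ᴿ fromℕ 448 *ᴿ μ₁ *ᴿ μ₂ *ᴿ fromℕ V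
competitive μ₁ μ₂ ε 1≤μ₁ 1≤μ₂ (δ₀ , 0<δ₀ , Nε , ε≥δ₀) ε≤1 I inModel {S} {F} {V} flowR feasible flowS δ′ 0<δ′ =
  N , λ k N≤k → ℚ.≤-trans (at k N≤k)
    (subst (ℚ._≤ rhs k ℚ.+ δ′) (ℚ.+-identityʳ (rhs k)) (ℚ.+-monoʳ-≤ (rhs k) (ℚ.<⇒≤ 0<δ′)))
  where
  open Instance I
  rhs : ℕ → ℚ
  rhs k = ι 448 ℚ.* seq μ₁ k ℚ.* seq μ₂ k ℚ.* ι V
  -- `2δ ≤ δ₀` keeps `e - δ` at least half of `e`, and `2δ ≤ 1` keeps `u + δ` at most twice `u`.
  δ = ½ ℚ.* (δ₀ ℚ.⊓ 1ℚ)
  0<1 : 0ℚ ℚ.< 1ℚ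
  0<1 = ℚ.positive⁻¹ 1ℚ
  0<⊓ : 0ℚ ℚ.< δ₀ ℚ.⊓ 1ℚ
  0<⊓ with ℚ.⊓-sel δ₀ 1ℚ
  ... | inj₁ eq = subst (0ℚ ℚ.<_) (sym eq) 0<δ₀
  ... | inj₂ eq = subst (0ℚ ℚ.<_) (sym eq) 0<1
  0<δ : 0ℚ ℚ.< δ
  0<δ = subst (ℚ._< δ) (ℚ.*-zeroʳ ½) (ℚ.*-monoʳ-<-pos ½ 0<⊓)
  2δ : δ ℚ.+ δ ≡ δ₀ ℚ.⊓ 1ℚ
  2δ = trans (sym (ℚ.*-distribʳ-+ (δ₀ ℚ.⊓ 1ℚ) ½ ½)) (ℚ.*-identityˡ _)
  2δ≤δ₀ : δ ℚ.+ δ ℚ.≤ δ₀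
  2δ≤δ₀ = ℚ.≤-trans (ℚ.≤-reflexive 2δ) (ℚ.p⊓q≤p δ₀ 1ℚ)
  2δ≤1 : δ ℚ.+ δ ℚ.≤ 1ℚ
  2δ≤1 = ℚ.≤-trans (ℚ.≤-reflexive 2δ) (ℚ.p⊓q≤q δ₀ 1ℚ)

  h₁ = 1≤μ₁ δ 0<δ
  h₂ = 1≤μ₂ δ 0<δ
  h₃ = ε≤1 δ 0<δ
  hu = uniform {P = λ j k → ι (proc j) ℚ.≤ seq μ₂ k ℚ.* ι (estimate j) ℚ.+ δ} (λ j → proj₁ (inModel j) δ 0<δ)
  ho = uniform {P = λ j k → ι (estimate j) ℚ.≤ seq μ₁ k ℚ.* ι (proc j) ℚ.+ δ} (λ j → proj₁ (proj₂ (inModel j)) δ 0<δ)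
  he = uniform {P = λ j k → ι (threshold j) ℚ.≤ (1ℚ ℚ.- seq ε k) ℚ.* ι (proc j) ℚ.+ δ} (λ j → proj₂ (proj₂ (inModel j)) δ 0<δ)

  N = Nε + proj₁ h₁ + proj₁ h₂ + proj₁ h₃ + proj₁ hu + proj₁ ho + proj₁ he

  module _ (k : ℕ) (N≤k : N ≤ k) where
    open ℚSolver.+-*-Solver
    open ℚ.≤-Reasoning

    e u₁ u₂ : ℚ
    e  = seq ε k
    u₁ = seq μ₁ k
    u₂ = seq μ₂ k

    N₆ : Nε + proj₁ h₁ + proj₁ h₂ + proj₁ h₃ + proj₁ hu + proj₁ ho ≤ k
    N₆ = m+n≤o⇒m≤o _ N≤k
    N₅ : Nε + proj₁ h₁ + proj₁ h₂ + proj₁ h₃ + proj₁ hu ≤ k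
    N₅ = m+n≤o⇒m≤o _ N₆
    N₄ : Nε + proj₁ h₁ + proj₁ h₂ + proj₁ h₃ ≤ k
    N₄ = m+n≤o⇒m≤o _ N₅
    N₃ : Nε + proj₁ h₁ + proj₁ h₂ ≤ k
    N₃ = m+n≤o⇒m≤o _ N₄
    N₂ : Nε + proj₁ h₁ ≤ k
    N₂ = m+n≤o⇒m≤o _ N₃

    δ₀≤e : δ₀ ℚ.≤ e
    δ₀≤e = subst (ℚ._≤ e) (ℚ.+-identityˡ δ₀) (ε≥δ₀ k (m+n≤o⇒m≤o Nε N₂))
    1≤u₁+δ : 1ℚ ℚ.≤ u₁ ℚ.+ δ
    1≤u₁+δ = proj₂ h₁ k (m+n≤o⇒n≤o Nε N₂)
    1≤u₂+δ : 1ℚ ℚ.≤ u₂ ℚ.+ δ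
    1≤u₂+δ = proj₂ h₂ k (m+n≤o⇒n≤o (Nε + proj₁ h₁) N₃)
    e≤1+δ : e ℚ.≤ 1ℚ ℚ.+ δ
    e≤1+δ = proj₂ h₃ k (m+n≤o⇒n≤o (Nε + proj₁ h₁ + proj₁ h₂) N₄)

    cancel-δ : ∀ {p q} → p ℚ.+ δ ℚ.≤ q ℚ.+ δ → p ℚ.≤ q
    cancel-δ {p} {q} h = subst₂ ℚ._≤_ (lem p δ) (lem q δ) (ℚ.+-monoˡ-≤ (ℚ.- δ) h)
      where
      lem : ∀ p d → p ℚ.+ d ℚ.- d ≡ p
      lem = solve 2 (λ p d → p :+ d :- d := p) refl

    -- Processing times and estimates are at least 1, so an additive error moves into the
    -- coefficient.
    absorb : ∀ u m l → 1 ≤ l → m ℚ.≤ u ℚ.* ι l ℚ.+ δ → m ℚ.≤ (u ℚ.+ δ) ℚ.* ι l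
    absorb u m l 1≤l h = begin
      m                          ≤⟨ h ⟩
      u ℚ.* ι l ℚ.+ δ            ≡⟨ cong (u ℚ.* ι l ℚ.+_) (sym (ℚ.*-identityʳ δ)) ⟩
      u ℚ.* ι l ℚ.+ δ ℚ.* 1ℚ     ≤⟨ ℚ.+-monoʳ-≤ (u ℚ.* ι l) (ℚ.*-monoˡ-≤-nonNeg δ {{ℚ.nonNegative (ℚ.<⇒≤ 0<δ)}} (ι-mono {1} {l} 1≤l)) ⟩
      u ℚ.* ι l ℚ.+ δ ℚ.* ι l    ≡⟨ sym (ℚ.*-distribʳ-+ (ι l) u δ) ⟩
      (u ℚ.+ δ) ℚ.* ι l          ∎

    early : ∀ j → ι (threshold j) ℚ.+ (e ℚ.- δ) ℚ.* ι (proc j) ℚ.≤ ι (proc j)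
    early j = begin
      ι (threshold j) ℚ.+ (e ℚ.- δ) ℚ.* ι (proc j)
        ≤⟨ ℚ.+-monoˡ-≤ _ (absorb (1ℚ ℚ.- e) (ι (threshold j)) (proc j) (proc≥1 j) (proj₂ he j k (m+n≤o⇒n≤o (Nε + proj₁ h₁ + proj₁ h₂ + proj₁ h₃ + proj₁ hu + proj₁ ho) N≤k))) ⟩
      (1ℚ ℚ.- e ℚ.+ δ) ℚ.* ι (proc j) ℚ.+ (e ℚ.- δ) ℚ.* ι (proc j)
        ≡⟨ solve 3 (λ e d p → (con 1ℚ :- e :+ d) :* p :+ (e :- d) :* p := p) refl e δ (ι (proc j)) ⟩
      ι (proc j) ∎

    half-e : e ℚ.≤ (e ℚ.- δ) ℚ.+ (e ℚ.- δ)
    half-e = cancel-δ (cancel-δ (begin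
      e ℚ.+ δ ℚ.+ δ                                  ≡⟨ ℚ.+-assoc e δ δ ⟩
      e ℚ.+ (δ ℚ.+ δ)                                ≤⟨ ℚ.+-monoʳ-≤ e (ℚ.≤-trans 2δ≤δ₀ δ₀≤e) ⟩
      e ℚ.+ e                                        ≡⟨ solve 2 (λ e d → e :+ e := (e :- d) :+ (e :- d) :+ d :+ d) refl e δ ⟩
      (e ℚ.- δ) ℚ.+ (e ℚ.- δ) ℚ.+ δ ℚ.+ δ            ∎))

    0≤e-δ : 0ℚ ℚ.≤ e ℚ.- δ
    0≤e-δ = cancel-δ (begin
      0ℚ ℚ.+ δ         ≤⟨ ℚ.+-monoˡ-≤ δ (ℚ.<⇒≤ 0<δ) ⟩
      δ ℚ.+ δ          ≤⟨ ℚ.≤-trans 2δ≤δ₀ δ₀≤e ⟩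
      e                ≡⟨ solve 2 (λ e d → e := e :- d :+ d) refl e δ ⟩
      e ℚ.- δ ℚ.+ δ    ∎)

    e-δ≤1 : e ℚ.- δ ℚ.≤ 1ℚ
    e-δ≤1 = cancel-δ (ℚ.≤-trans (ℚ.≤-reflexive (solve 2 (λ e d → e :- d :+ d := e) refl e δ)) e≤1+δ)

    double : ∀ u → 1ℚ ℚ.≤ u ℚ.+ δ → u ℚ.+ δ ℚ.≤ u ℚ.+ u
    double u h = ℚ.+-monoʳ-≤ u (cancel-δ (ℚ.≤-trans 2δ≤1 h))

    0≤u+δ : ∀ u → 1ℚ ℚ.≤ u ℚ.+ δ → 0ℚ ℚ.≤ u ℚ.+ δ
    0≤u+δ u = ℚ.≤-trans (ℚ.<⇒≤ 0<1)

    at : e ℚ.* ι F ℚ.≤ ι 448 ℚ.* u₁ ℚ.* u₂ ℚ.* ι V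
    at = begin
      e ℚ.* ι F
        ≤⟨ *-monoʳ (ι F) (0≤ι F) half-e ⟩
      ((e ℚ.- δ) ℚ.+ (e ℚ.- δ)) ℚ.* ι F
        ≡⟨ ℚ.*-distribʳ-+ (ι F) (e ℚ.- δ) (e ℚ.- δ) ⟩
      (e ℚ.- δ) ℚ.* ι F ℚ.+ (e ℚ.- δ) ℚ.* ι F
        ≤⟨ ℚ.+-mono-≤ flows flows ⟩
      ι 56 ℚ.* (u₁ ℚ.+ δ) ℚ.* (u₂ ℚ.+ δ) ℚ.* ι V ℚ.+ ι 56 ℚ.* (u₁ ℚ.+ δ) ℚ.* (u₂ ℚ.+ δ) ℚ.* ι V
        ≡⟨ solve 3 (λ a b v → con (ι 56) :* a :* b :* v :+ con (ι 56) :* a :* b :* v := con (ι 112) :* v :* (a :* b))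
             refl (u₁ ℚ.+ δ) (u₂ ℚ.+ δ) (ι V) ⟩
      ι 112 ℚ.* ι V ℚ.* ((u₁ ℚ.+ δ) ℚ.* (u₂ ℚ.+ δ))
        ≤⟨ ℚ.*-monoˡ-≤-nonNeg (ι 112 ℚ.* ι V) {{ℚ.nonNegative 0≤112V}}
             (*-mono (0≤u+δ u₂ 1≤u₂+δ) (ℚ.≤-trans (0≤u+δ u₁ 1≤u₁+δ) (double u₁ 1≤u₁+δ)) (double u₁ 1≤u₁+δ) (double u₂ 1≤u₂+δ)) ⟩
      ι 112 ℚ.* ι V ℚ.* ((u₁ ℚ.+ u₁) ℚ.* (u₂ ℚ.+ u₂))
        ≡⟨ solve 3 (λ a b v → con (ι 112) :* v :* ((a :+ a) :* (b :+ b)) := con (ι 448) :* a :* b :* v)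
             refl u₁ u₂ (ι V) ⟩
      ι 448 ℚ.* u₁ ℚ.* u₂ ℚ.* ι V ∎
      where
      0≤112V : 0ℚ ℚ.≤ ι 112 ℚ.* ι V
      0≤112V = subst (0ℚ ℚ.≤_) (ι-* 112 V) (0≤ι (112 * V))
      flows : (e ℚ.- δ) ℚ.* ι F ℚ.≤ ι 56 ℚ.* (u₁ ℚ.+ δ) ℚ.* (u₂ ℚ.+ δ) ℚ.* ι V
      flows = Rational.rational-bound I (e ℚ.- δ) (u₁ ℚ.+ δ) (u₂ ℚ.+ δ) 0≤e-δ e-δ≤1 1≤u₁+δ 1≤u₂+δ
        (λ j → absorb u₂ (ι (proc j)) (estimate j) (estimate≥1 j) (proj₂ hu j k (m+n≤o⇒n≤o (Nε + proj₁ h₁ + proj₁ h₂ + proj₁ h₃) N₅)))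
        (λ j → absorb u₁ (ι (estimate j)) (proc j) (proc≥1 j) (proj₂ ho j k (m+n≤o⇒n≤o (Nε + proj₁ h₁ + proj₁ h₂ + proj₁ h₃ + proj₁ hu) N₆)))
        early flowR feasible flowS

theorem1p2 :
    ∃[ C ] 0ᴿ <ᴿ C ×
    (∃[ A ] (∀ (μ₁ μ₂ ε : ℝ) → 1ᴿ ≤ᴿ μ₁ → 1ᴿ ≤ᴿ μ₂ → 0ᴿ <ᴿ ε → ε ≤ᴿ 1ᴿ →
      ∀ (I : Instance) → InModel ε μ₁ μ₂ I →
      Instance.Feasible I (run I A) ×
      (∃[ F ] Instance.HasTotalFlow I (run I A) F ×
        (∀ OPT → Instance.IsOPT I OPT →
          ε *ᴿ fromℕ F ≤ᴿ C *ᴿ μ₁ *ᴿ μ₂ *ᴿ fromℕ OPT))))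
theorem1p2 = fromℕ 448
  , (1ℚ , ℚ.positive⁻¹ 1ℚ , 0 , λ _ _ → ι-mono {1} {448} (s≤s z≤n))
  , algorithm , λ μ₁ μ₂ ε 1≤μ₁ 1≤μ₂ 0<ε ε≤1 I inModel →
      World.R-feasible I
    , proj₁ (World.R-flow I) , proj₂ (World.R-flow I)
    , λ { OPT ((S , feasible , flow) , _) →
          competitive μ₁ μ₂ ε 1≤μ₁ 1≤μ₂ 0<ε ε≤1 I inModel (proj₂ (World.R-flow I)) feasible flow }
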